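{- (i) For each odd integer $D\geq 1$, every $(D,\mathrm{F})_e$-critical multigraph $G$ with $|V(G)|\geq 3$ satisfies $|E(G)|\geq \frac{(4D+3)|V(G)|+2}{2(D+1)}$. (ii) For each even integer $D\geq 2$, every $(D,\mathrm{F})_e$-critical multigraph $G$ with $|V(G)|\geq 3$ satisfies $|E(G)|\geq \frac{(4D+1)|V(G)|+2}{2D+1}$.
   Context: All multigraphs are loopless; edges are counted with multiplicity. A forest is an acyclic multigraph, where a pair of parallel edges counts as a cycle. A $(D,\mathrm{F})_e$-coloring of a multigraph $G$ is a partition $(M,F)$ of $V(G)$ such that $G[M]$ is a forest each of whose connected components has at most $D$ edges and $G[F]$ is a forest. A multigraph is $(D,\mathrm{F})_e$-critical if it has no $(D,\mathrm{F})_e$-coloring but every proper subgraph of it has one. -}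

module Defs where

open import Data.Nat using (ℕ; zero; suc; _≤_; _<_)
open import Data.Fin using (Fin; inject₁; fromℕ) renaming (zero to fzero; suc to fsuc)
open import Data.Bool using (Bool; true; false)
open import Data.Product using (_×_; _,_; proj₁; proj₂; Σ; ∃)
open import Data.Sum using (_⊎_)
open import Data.Empty using (⊥)
open import Relation.Nullary using (¬_)
open import Relation.Binary.PropositionalEquality using (_≡_; _≢_)
open import Function.Definitions using (Injective)

-- A finite loopless multigraph: vertices Fin nV, edges Fin nE (counted with
-- multiplicity), each edge given by its (unordered, stored as ordered) ends.
record Multigraph : Set where
  field
    nV   : ℕ
    nE   : ℕ
    ends : Fin nE → Fin nV × Fin nV
    loopless : ∀ e → proj₁ (ends e) ≢ proj₂ (ends e)
open Multigraph public

Joins : (G : Multigraph) → Fin (nE G) → Fin (nV G) → Fin (nV G) → Set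
Joins G e u v = (ends G e ≡ (u , v)) ⊎ (ends G e ≡ (v , u))

JoinsIn : (G : Multigraph) → (Fin (nV G) → Set) → Fin (nE G) → Fin (nV G) → Fin (nV G) → Set
JoinsIn G S e u v = Joins G e u v × S u × S v

-- A cycle in G[S] of length suc (suc k) ≥ 2: distinct vertices v_0..v_{k+1},
-- distinct edges e_0..e_{k+1}, e_i joining v_i and v_{i+1}, e_{k+1} joining v_{k+1}, v_0.
-- (Two parallel edges form a cycle of length 2.)
record CycleIn (G : Multigraph) (S : Fin (nV G) → Set) : Set where
  field
    k   : ℕ
    vs  : Fin (suc (suc k)) → Fin (nV G)
    es  : Fin (suc (suc k)) → Fin (nE G)
    vs-inj : Injective _≡_ _≡_ vs
    es-inj : Injective _≡_ _≡_ es
    step   : ∀ (i : Fin (suc k)) → JoinsIn G S (es (inject₁ i)) (vs (inject₁ i)) (vs (fsuc i))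
    close  : JoinsIn G S (es (fromℕ (suc k))) (vs (fromℕ (suc k))) (vs fzero)

ForestIn : (G : Multigraph) → (Fin (nV G) → Set) → Set
ForestIn G S = ¬ CycleIn G S

data Reach (G : Multigraph) (S : Fin (nV G) → Set) (u : Fin (nV G)) : Fin (nV G) → Set where
  here : S u → Reach G S u u
  there : ∀ {w v e} → Reach G S u w → JoinsIn G S e w v → Reach G S u v

EdgeInComp : (G : Multigraph) → (Fin (nV G) → Set) → Fin (nV G) → Fin (nE G) → Set
EdgeInComp G S u e = Σ (Fin (nV G)) λ a → Σ (Fin (nV G)) λ b → JoinsIn G S e a b × Reach G S u a

ComponentsAtMost : ℕ → (G : Multigraph) → (Fin (nV G) → Set) → Set
ComponentsAtMost D G S = ∀ (u : Fin (nV G)) → S u →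
  ∀ (j : ℕ) (f : Fin j → Fin (nE G)) → Injective _≡_ _≡_ f →
  (∀ i → EdgeInComp G S u (f i)) → j ≤ D

-- (D,F)_e-coloring: c v ≡ true means v ∈ M, false means v ∈ F.
Coloring : ℕ → Multigraph → Set
Coloring D G = Σ (Fin (nV G) → Bool) λ c →
  ForestIn G (λ v → c v ≡ true) × ComponentsAtMost D G (λ v → c v ≡ true) ×
  ForestIn G (λ v → c v ≡ false)

record Subgraph (H G : Multigraph) : Set where
  field
    φ : Fin (nV H) → Fin (nV G)
    ψ : Fin (nE H) → Fin (nE G)
    φ-inj : Injective _≡_ _≡_ φ
    ψ-inj : Injective _≡_ _≡_ ψ
    compat : ∀ e → Joins G (ψ e) (φ (proj₁ (ends H e))) (φ (proj₂ (ends H e)))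

ProperSubgraph : Multigraph → Multigraph → Set
ProperSubgraph H G = Subgraph H G × (nV H < nV G ⊎ nE H < nE G)

Critical : ℕ → Multigraph → Set
Critical D G = ¬ Coloring D G × (∀ H → ProperSubgraph H G → Coloring D H)

{-# OPTIONS --safe #-}
-- Vertices carry weights: a vertex of weight w counts for 1 + w vertices of its component of G[M],
-- and a component may count for at most K = D + 1, so weight K forces a vertex into F.  An edge costs
-- b and a vertex of weight w is worth 2b - 1 - cost w, where b = 2K and cost w = 2w for odd D; for
-- even D, b and (when w > D/2) cost w are smaller by one.  The claim is that a vertex-minimal
-- uncolourable weighted graph has potential (total worth minus total edge cost) at most -2.
--
-- In a minimal counterexample, contracting a coloured set W (F-part to one vertex forced into F,
-- neighbours of the M-part forced into F) shows that proper subsets have large potential.  Deleting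
-- a vertex of degree 3 and raising the weights of its neighbours then shows that for even D every
-- vertex has negative charge worth - (b/2) deg.  For odd D = 2h + 1 only vertices of degree 3 and
-- weight h survive; they are independent with three distinct neighbours, a vertex of degree 4 has
-- at most two of them as neighbours, and counting leaves K₅ minus an edge, which is colourable.
module Submission where

open import Defs
import Data.Bool as Bool
import Data.Nat.Properties as ℕ
import Data.Product as Product
open import Data.Bool using (Bool; true; false; _∧_; _∨_; not; if_then_else_)
open import Data.Bool.Properties using (∨-zeroʳ)
open import Data.Empty using (⊥; ⊥-elim)
open import Data.Fin using (Fin; toℕ; fromℕ<) renaming (zero to fzero; suc to fsuc)
open import Data.Fin.Properties using (_≟_; any?; all?; toℕ-injective; toℕ-inject₁; toℕ-fromℕ; toℕ<n; toℕ-fromℕ<; injective⇒≤)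
open import Data.Fin.Relation.Unary.Top using (view; ‵fromℕ; ‵inject₁)
open import Data.Fin.Subset.Properties using (anySubset?)
open import Data.List using ([]; _∷_)
open import Data.Nat hiding (_≟_)
open import Data.Nat.Properties hiding (_≟_)
open import Data.Nat.Tactic.RingSolver using (solve; solve-∀)
open import Data.Product using (_×_; _,_; proj₁; proj₂; Σ; ∃; Σ-syntax; ∃-syntax)
open import Data.Product.Properties using (,-injective)
open import Data.Sum using (_⊎_; inj₁; inj₂)
open import Data.Vec using (lookup; tabulate)
open import Data.Vec.Properties using (lookup∘tabulate)
open import Function using (_∘_)
open import Function.Definitions using (Injective)
open import Relation.Binary.PropositionalEquality
open import Relation.Nullary using (¬_; Dec; yes; no; does; contradiction)
open import Relation.Nullary.Decidable using (map′; dec-true; dec-false; _×-dec_; _→-dec_; ¬?; decidable-stable)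
open import Algebra.Properties.Semiring.Sum +-*-semiring using (sum; sum-cong-≗; ∑-distrib-+; ∑-comm; *-distribˡ-sum)

-- Weights serve two purposes. A deleted vertex `v` with three edges, put back last, may have to
-- join `M`, where the component of one neighbour must absorb it; raising all neighbours by
-- `suc (w v)` reserves the room beforehand. And weight `K` prescribes the class `F`, so contracted
-- graphs stay within the class of weighted graphs. The obstacle is odd `D`: at a vertex of degree 3
-- and weight `h`, the three raises cost `3 * (2 * h + 2)`, exactly the `b + 2 + 2 * h` that the
-- comparison of potentials demands. No contradiction arises, and such a vertex has charge +1. The
-- same coincidence is then exploited: deleting one of these vertices lowers the potential by at
-- most 1 and leaves a minimal uncolourable set, so several can be deleted in succession. The
-- parameter `τ` records the accumulated loss; the lemmas on minimal sets assume only potential at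
-- least `-τ`, and are used with `τ` equal to 1, 2 and 3.

private
  variable
    n : ℕ

-- Linear arithmetic by certificates: the hypotheses are added with `⊕`, after multiplication with
-- `scale`, into a single `l ≤ r`; `k` is the slack left over, and the ring solver only has to check
-- an identity.
≤-by : ∀ {l r x y} k → l ≤ r → x + r + k ≡ y + l → x ≤ y
≤-by {l} {r} {x} {y} k l≤r eq = +-cancelʳ-≤ l x y (begin
  x + l      ≤⟨ +-monoʳ-≤ x l≤r ⟩
  x + r      ≤⟨ m≤m+n (x + r) k ⟩
  x + r + k  ≡⟨ eq ⟩
  y + l      ∎)
  where open ≤-Reasoning

⊥-by : ∀ {l r} k → l ≤ r → l ≡ suc (r + k) → ⊥
⊥-by {l} {r} k l≤r eq = <-irrefl refl (≤-trans (s≤s (m≤m+n r k)) (subst (_≤ r) eq l≤r))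

witness : {X : Set} (x? : Dec X) → does x? ≡ true → X
witness (yes x) _ = x

*-swap : ∀ a b c → a * (b * c) ≡ b * (a * c)
*-swap = solve-∀

infixr 5 _⊕_

_⊕_ : ∀ {a b c d} → a ≤ b → c ≤ d → a + c ≤ b + d
_⊕_ = +-mono-≤

scale : ∀ k {x y} → x ≤ y → k * x ≤ k * y
scale k = *-monoʳ-≤ k

-- Finite sets of vertices and sums over them

VSet : ℕ → Set
VSet n = Fin n → Bool

infix 4 _∈_ _∉_ _⊆_
infixl 6 _∪_ _∩_ _∖_ _⊹_ _−_

-- A record instead of the bare equation: `S u ≡ true` unfolds when `S` is a compound set, and then
-- `S` and `u` could no longer be inferred as implicit arguments.
record _∈_ {n} (u : Fin n) (S : VSet n) : Set where
  constructor mem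
  field inside : S u ≡ true

record _∉_ {n} (u : Fin n) (S : VSet n) : Set where
  constructor nonmem
  field outside : S u ≡ false

open _∈_ public
open _∉_ public

_⊆_ : VSet n → VSet n → Set
S ⊆ T = ∀ u → u ∈ S → u ∈ T

_∪_ _∩_ _∖_ : VSet n → VSet n → VSet n
(S ∪ T) u = S u ∨ T u
(S ∩ T) u = S u ∧ T u
(S ∖ T) u = S u ∧ not (T u)

⁅_⁆ : Fin n → VSet n
⁅ v ⁆ u = does (u ≟ v)

_⊹_ _−_ : VSet n → Fin n → VSet n
S ⊹ v = S ∪ ⁅ v ⁆
S − v = S ∖ ⁅ v ⁆

⟦_⟧ : Bool → ℕ
⟦ true ⟧ = 1
⟦ false ⟧ = 0

∈-or-∉ : (S : VSet n) (u : Fin n) → u ∈ S ⊎ u ∉ S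
∈-or-∉ S u with S u in eq
... | true = inj₁ (mem eq)
... | false = inj₂ (nonmem eq)

≡-or-≢ : (u v : Fin n) → u ≡ v ⊎ u ≢ v
≡-or-≢ u v with u ≟ v
... | yes p = inj₁ p
... | no p = inj₂ p

∈∉-⊥ : {S : VSet n} {u : Fin n} → u ∈ S → u ∉ S → ⊥
∈∉-⊥ (mem p) (nonmem q) with trans (sym p) q
... | ()

⊆-refl : {S : VSet n} → S ⊆ S
⊆-refl u p = p

⊆-trans : {S T U : VSet n} → S ⊆ T → T ⊆ U → S ⊆ U
⊆-trans p q u = q u ∘ p u

∉-⊆ : {S T : VSet n} {u : Fin n} → S ⊆ T → u ∉ T → u ∉ S
∉-⊆ {S = S} {u = u} p u∉T with ∈-or-∉ S u
... | inj₁ u∈S = ⊥-elim (∈∉-⊥ (p u u∈S) u∉T)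
... | inj₂ u∉S = u∉S

∈-⁅⁆ : (v : Fin n) → v ∈ ⁅ v ⁆
∈-⁅⁆ v = mem (dec-true (v ≟ v) refl)

∉-⁅⁆ : {u v : Fin n} → u ≢ v → u ∉ ⁅ v ⁆
∉-⁅⁆ {u = u} {v} u≢v = nonmem (dec-false (u ≟ v) u≢v)

⁅⁆-≡ : {u v : Fin n} → u ∈ ⁅ v ⁆ → u ≡ v
⁅⁆-≡ {u = u} {v} p with ≡-or-≢ u v
... | inj₁ u≡v = u≡v
... | inj₂ u≢v = ⊥-elim (∈∉-⊥ p (∉-⁅⁆ u≢v))

∈-≢ : {S : VSet n} {u v : Fin n} → u ∈ S → v ∉ S → u ≢ v
∈-≢ u∈S v∉S refl = ∈∉-⊥ u∈S v∉S

∪-⊆ˡ : {S T : VSet n} → S ⊆ S ∪ T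
∪-⊆ˡ {T = T} u (mem p) = mem (cong (_∨ T u) p)

∪-⊆ʳ : {S T : VSet n} → T ⊆ S ∪ T
∪-⊆ʳ {S = S} u (mem p) = mem (trans (cong (S u ∨_) p) (∨-zeroʳ (S u)))

∪-inv : {S T : VSet n} {u : Fin n} → u ∈ S ∪ T → u ∈ S ⊎ u ∈ T
∪-inv {S = S} {u = u} (mem p) with S u in eq
... | true = inj₁ (mem eq)
... | false = inj₂ (mem p)

∪-∉ : {S T : VSet n} {u : Fin n} → u ∉ S → u ∉ T → u ∉ S ∪ T
∪-∉ (nonmem p) (nonmem q) = nonmem (cong₂ _∨_ p q)

⊹-∈ : (S : VSet n) (v : Fin n) → v ∈ S ⊹ v
⊹-∈ S v = ∪-⊆ʳ v (∈-⁅⁆ v)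

⊹-⊇ : {S : VSet n} {v : Fin n} → S ⊆ S ⊹ v
⊹-⊇ = ∪-⊆ˡ

⊹-inv : {S : VSet n} {u v : Fin n} → u ∈ S ⊹ v → u ∈ S ⊎ u ≡ v
⊹-inv p with ∪-inv p
... | inj₁ q = inj₁ q
... | inj₂ q = inj₂ (⁅⁆-≡ q)

⊹-⊆ : {S T : VSet n} {v : Fin n} → S ⊆ T → v ∈ T → S ⊹ v ⊆ T
⊹-⊆ S⊆T v∈T u p with ⊹-inv p
... | inj₁ u∈S = S⊆T u u∈S
... | inj₂ refl = v∈T

⊹-mono : {S T : VSet n} {v : Fin n} → S ⊆ T → S ⊹ v ⊆ T ⊹ v
⊹-mono S⊆T = ⊹-⊆ (⊆-trans S⊆T ⊹-⊇) (⊹-∈ _ _)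

⊹-∉ : {S : VSet n} {u v : Fin n} → u ∉ S → u ≢ v → u ∉ S ⊹ v
⊹-∉ u∉S u≢v = ∪-∉ u∉S (∉-⁅⁆ u≢v)

∖-∈ : {S T : VSet n} {u : Fin n} → u ∈ S → u ∉ T → u ∈ S ∖ T
∖-∈ (mem p) (nonmem q) = mem (cong₂ (λ x y → x ∧ not y) p q)

∖-⊆ : {S T : VSet n} → S ∖ T ⊆ S
∖-⊆ {S = S} u (mem p) with S u in eq
... | true = mem eq

∖-∉ : {S T : VSet n} {u : Fin n} → u ∈ S ∖ T → u ∉ T
∖-∉ {S = S} {T} {u} (mem p) with S u | T u in eq
... | true | false = nonmem eq

∩-∈ : {S T : VSet n} {u : Fin n} → u ∈ S → u ∈ T → u ∈ S ∩ T
∩-∈ (mem p) (mem q) = mem (cong₂ _∧_ p q)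

∩-⊆ˡ : {S T : VSet n} → S ∩ T ⊆ S
∩-⊆ˡ {S = S} u (mem p) with S u in eq
... | true = mem eq

∩-⊆ʳ : {S T : VSet n} → S ∩ T ⊆ T
∩-⊆ʳ {S = S} u (mem p) with S u
... | true = mem p

−-∈ : {S : VSet n} {u v : Fin n} → u ∈ S → u ≢ v → u ∈ S − v
−-∈ p u≢v = ∖-∈ p (∉-⁅⁆ u≢v)

−-⊆ : {S : VSet n} {v : Fin n} → S − v ⊆ S
−-⊆ = ∖-⊆

−-≢ : {S : VSet n} {u v : Fin n} → u ∈ S − v → u ≢ v
−-≢ p = ≢-sym (∈-≢ (∈-⁅⁆ _) (∖-∉ p))

−-∉ : {S : VSet n} (v : Fin n) → v ∉ S − v
−-∉ {S = S} v with ∈-or-∉ (S − v) v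
... | inj₁ p = ⊥-elim (−-≢ p refl)
... | inj₂ p = p

⊆-− : {S T : VSet n} {v : Fin n} → S ⊆ T → v ∉ S → S ⊆ T − v
⊆-− S⊆T v∉S u u∈S = −-∈ (S⊆T u u∈S) (∈-≢ u∈S v∉S)

⊹-− : (A : VSet n) (v : Fin n) → A ⊆ (A − v) ⊹ v
⊹-− A v u u∈A with ≡-or-≢ u v
... | inj₁ refl = ⊹-∈ (A − v) v
... | inj₂ u≢v = ⊹-⊇ u (−-∈ u∈A u≢v)

opaque
  -- Opaque so that the set and the summand stay visible to unification.
  ∑ : VSet n → (Fin n → ℕ) → ℕ
  ∑ S f = sum (λ u → ⟦ S u ⟧ * f u)

card : VSet n → ℕ
card S = ∑ S (λ _ → 1)

sum-mono : {f g : Fin n → ℕ} → (∀ u → f u ≤ g u) → sum f ≤ sum g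
sum-mono {zero} f≤g = z≤n
sum-mono {suc n} f≤g = +-mono-≤ (f≤g fzero) (sum-mono (f≤g ∘ fsuc))

opaque
  unfolding ∑

  ∑-mono : (S : VSet n) {f g : Fin n → ℕ} → (∀ u → u ∈ S → f u ≤ g u) → ∑ S f ≤ ∑ S g
  ∑-mono S {f} {g} f≤g = sum-mono pointwise
    where
    pointwise : ∀ u → ⟦ S u ⟧ * f u ≤ ⟦ S u ⟧ * g u
    pointwise u with S u in eq
    ... | true = +-monoˡ-≤ 0 (f≤g u (mem eq))
    ... | false = z≤n

∑-cong : (S : VSet n) {f g : Fin n → ℕ} → (∀ u → u ∈ S → f u ≡ g u) → ∑ S f ≡ ∑ S g
∑-cong S f≡g = ≤-antisym (∑-mono S (λ u p → ≤-reflexive (f≡g u p)))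
                         (∑-mono S (λ u p → ≤-reflexive (sym (f≡g u p))))

opaque
  unfolding ∑

  ∑-⊆ : {S T : VSet n} (f : Fin n → ℕ) → S ⊆ T → ∑ S f ≤ ∑ T f
  ∑-⊆ {S = S} {T} f S⊆T = sum-mono pointwise
    where
    pointwise : ∀ u → ⟦ S u ⟧ * f u ≤ ⟦ T u ⟧ * f u
    pointwise u with S u in eq
    ... | true rewrite inside (S⊆T u (mem eq)) = ≤-refl
    ... | false = z≤n

∑-≗ : {S T : VSet n} (f : Fin n → ℕ) → S ⊆ T → T ⊆ S → ∑ S f ≡ ∑ T f
∑-≗ f p q = ≤-antisym (∑-⊆ f p) (∑-⊆ f q)

opaque
  unfolding ∑

  ∑-+ : (S : VSet n) (f g : Fin n → ℕ) → ∑ S (λ u → f u + g u) ≡ ∑ S f + ∑ S g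
  ∑-+ S f g = trans (sum-cong-≗ (λ u → *-distribˡ-+ ⟦ S u ⟧ (f u) (g u)))
                    (∑-distrib-+ (λ u → ⟦ S u ⟧ * f u) (λ u → ⟦ S u ⟧ * g u))

opaque
  unfolding ∑

  ∑-* : (S : VSet n) (k : ℕ) (f : Fin n → ℕ) → ∑ S (λ u → k * f u) ≡ k * ∑ S f
  ∑-* S k f = trans (sum-cong-≗ (λ u → *-swap ⟦ S u ⟧ k (f u)))
                    (sym (*-distribˡ-sum k (λ u → ⟦ S u ⟧ * f u)))

opaque
  unfolding ∑

  ∑-swap : {k : ℕ} (S : VSet n) (T : VSet k) (f : Fin n → Fin k → ℕ) →
           ∑ S (λ u → ∑ T (f u)) ≡ ∑ T (λ v → ∑ S (λ u → f u v))
  ∑-swap S T f = begin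
    sum (λ u → ⟦ S u ⟧ * sum (λ v → ⟦ T v ⟧ * f u v))
      ≡⟨ sum-cong-≗ (λ u → *-distribˡ-sum ⟦ S u ⟧ (λ v → ⟦ T v ⟧ * f u v)) ⟩
    sum (λ u → sum (λ v → ⟦ S u ⟧ * (⟦ T v ⟧ * f u v)))
      ≡⟨ ∑-comm (λ u v → ⟦ S u ⟧ * (⟦ T v ⟧ * f u v)) ⟩
    sum (λ v → sum (λ u → ⟦ S u ⟧ * (⟦ T v ⟧ * f u v)))
      ≡⟨ sum-cong-≗ (λ v → trans (sum-cong-≗ (λ u → *-swap ⟦ S u ⟧ ⟦ T v ⟧ (f u v)))
                                 (sym (*-distribˡ-sum ⟦ T v ⟧ (λ u → ⟦ S u ⟧ * f u v)))) ⟩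
    sum (λ v → ⟦ T v ⟧ * sum (λ u → ⟦ S u ⟧ * f u v)) ∎
    where
    open ≡-Reasoning

∑-0 : (S : VSet n) {f : Fin n → ℕ} → (∀ u → u ∈ S → f u ≡ 0) → ∑ S f ≡ 0
∑-0 S {f} f≡0 = trans (∑-cong S f≡0) (trans (∑-* S 0 (λ _ → 0)) refl)

-- Disjoint union in terms of indicators, which turns `∑-part` into plain distributivity.
record Part {n} (S S₁ S₂ : VSet n) : Set where
  constructor parts
  field at : ∀ u → ⟦ S u ⟧ ≡ ⟦ S₁ u ⟧ + ⟦ S₂ u ⟧

opaque
  unfolding ∑

  ∑-part : {S S₁ S₂ : VSet n} → Part S S₁ S₂ → ∀ f → ∑ S f ≡ ∑ S₁ f + ∑ S₂ f
  ∑-part {S = S} {S₁} {S₂} (parts p) f =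
    trans (sum-cong-≗ (λ u → trans (cong (_* f u) (p u)) (*-distribʳ-+ (f u) ⟦ S₁ u ⟧ ⟦ S₂ u ⟧)))
          (∑-distrib-+ (λ u → ⟦ S₁ u ⟧ * f u) (λ u → ⟦ S₂ u ⟧ * f u))

part-∩∖ : (S T : VSet n) → Part S (S ∩ T) (S ∖ T)
part-∩∖ S T = parts pointwise
  where
  pointwise : ∀ u → ⟦ S u ⟧ ≡ ⟦ S u ∧ T u ⟧ + ⟦ S u ∧ not (T u) ⟧
  pointwise u with S u | T u
  ... | true | true = refl
  ... | true | false = refl
  ... | false | _ = refl

part-⊆ : {A W : VSet n} → W ⊆ A → Part A W (A ∖ W)
part-⊆ {A = A} {W} W⊆A = parts pointwise
  where
  pointwise : ∀ u → ⟦ A u ⟧ ≡ ⟦ W u ⟧ + ⟦ A u ∧ not (W u) ⟧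
  pointwise u with W u in eq
  ... | true rewrite inside (W⊆A u (mem eq)) = refl
  ... | false with A u
  ...   | true = refl
  ...   | false = refl

part-∪ : {S T : VSet n} → (∀ u → u ∈ S → u ∉ T) → Part (S ∪ T) S T
part-∪ {S = S} {T} dis = parts pointwise
  where
  pointwise : ∀ u → ⟦ S u ∨ T u ⟧ ≡ ⟦ S u ⟧ + ⟦ T u ⟧
  pointwise u with S u in eq
  ... | true rewrite outside (dis u (mem eq)) = refl
  ... | false = refl

part-⊹ : {S : VSet n} {v : Fin n} → v ∉ S → Part (S ⊹ v) S ⁅ v ⁆
part-⊹ v∉S = part-∪ (λ u u∈S → ∉-⁅⁆ (∈-≢ u∈S v∉S))

opaque
  unfolding ∑

  ∑-⁅⁆ : (v : Fin n) (f : Fin n → ℕ) → ∑ ⁅ v ⁆ f ≡ f v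
  ∑-⁅⁆ {suc n} fzero f = trans (cong₂ _+_ (*-identityˡ (f fzero)) (∑-0 {n} (λ _ → false) {f ∘ fsuc} (λ { _ (mem ()) }))) (+-identityʳ _)
  ∑-⁅⁆ {suc n} (fsuc v) f = trans (sum-cong-≗ (λ u → cong (λ b → ⟦ b ⟧ * f (fsuc u)) (lemma u))) (∑-⁅⁆ v (f ∘ fsuc))
    where
    lemma : ∀ u → ⁅ fsuc v ⁆ (fsuc u) ≡ ⁅ v ⁆ u
    lemma u with u ≟ v
    ... | yes _ = refl
    ... | no _ = refl

∑-⊹ : {S : VSet n} {v : Fin n} → v ∉ S → ∀ f → ∑ (S ⊹ v) f ≡ ∑ S f + f v
∑-⊹ {S = S} {v} v∉S f = trans (∑-part (part-⊹ v∉S) f) (cong (∑ S f +_) (∑-⁅⁆ v f))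

∑-− : {S : VSet n} {v : Fin n} → v ∈ S → ∀ f → ∑ S f ≡ ∑ (S − v) f + f v
∑-− {S = S} {v} v∈S f = trans (∑-≗ f (⊹-− S v) (⊹-⊆ −-⊆ v∈S)) (∑-⊹ (−-∉ v) f)

∑-∈ : {S : VSet n} {v : Fin n} → v ∈ S → ∀ f → f v ≤ ∑ S f
∑-∈ {v = v} v∈S f = subst (f v ≤_) (sym (∑-− v∈S f)) (m≤n+m (f v) _)

∑-∉ : {S T : VSet n} {v : Fin n} → S ⊆ T → v ∈ T → v ∉ S → ∀ f → ∑ S f + f v ≤ ∑ T f
∑-∉ {S = S} {v = v} S⊆T v∈T v∉S f = subst (∑ S f + f v ≤_) (sym (∑-− v∈T f))
  (+-monoˡ-≤ (f v) (∑-⊆ f (⊆-− S⊆T v∉S)))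

∑-≡0 : {S : VSet n} {f : Fin n → ℕ} → ∑ S f ≡ 0 → ∀ u → u ∈ S → f u ≡ 0
∑-≡0 {f = f} eq u u∈S = n≤0⇒n≡0 (subst (f u ≤_) eq (∑-∈ u∈S f))

∑-mono-at : (S : VSet n) {f g : Fin n → ℕ} {q : Fin n} (k : ℕ) → (∀ u → u ∈ S → f u ≤ g u) →
            q ∈ S → f q + k ≤ g q → ∑ S f + k ≤ ∑ S g
∑-mono-at S {f} {g} {q} k f≤g q∈S fq = subst₂ _≤_
  (trans (sym (+-assoc (∑ (S − q) f) (f q) k)) (cong (_+ k) (sym (∑-− q∈S f))))
  (sym (∑-− q∈S g))
  (+-mono-≤ (∑-mono (S − q) (λ u p → f≤g u (−-⊆ u p))) fq)

opaque
  unfolding ∑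

  ∑-pos : (S : VSet n) (f : Fin n → ℕ) → 1 ≤ ∑ S f → ∃[ u ] u ∈ S × 1 ≤ f u
  ∑-pos {suc n} S f p with S fzero in eq | f fzero in eqf
  ... | true | suc k = fzero , mem eq , subst (1 ≤_) (sym eqf) (s≤s z≤n)
  ... | true | zero = let u , mem q , r = ∑-pos (S ∘ fsuc) (f ∘ fsuc) p in fsuc u , mem q , r
  ... | false | _ = let u , mem q , r = ∑-pos (S ∘ fsuc) (f ∘ fsuc) p in fsuc u , mem q , r

card-0 : {S : VSet n} → card S ≡ 0 → ∀ u → u ∉ S
card-0 {S = S} eq u with ∈-or-∉ S u
... | inj₂ u∉S = u∉S
... | inj₁ u∈S = contradiction (∑-≡0 eq u u∈S) λ ()

full : VSet n
full _ = true

⊆-full : {S : VSet n} → S ⊆ full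
⊆-full u _ = mem refl

opaque
  unfolding ∑

  ∑-restrict : {S T : VSet n} → S ⊆ T → ∀ f → ∑ S f ≡ ∑ T (λ u → ⟦ S u ⟧ * f u)
  ∑-restrict {S = S} {T} S⊆T f = sum-cong-≗ pointwise
    where
    pointwise : ∀ u → ⟦ S u ⟧ * f u ≡ ⟦ T u ⟧ * (⟦ S u ⟧ * f u)
    pointwise u with S u in eq
    ... | true rewrite inside (S⊆T u (mem eq)) = sym (*-identityˡ _)
    ... | false = sym (*-zeroʳ ⟦ T u ⟧)

  ∑-full-suc : (f : Fin (suc n) → ℕ) → ∑ full f ≡ f fzero + ∑ full (f ∘ fsuc)
  ∑-full-suc {n} f = cong (_+ ∑ (full {n}) (f ∘ fsuc)) (*-identityˡ (f fzero))

∑-card-0 : {S : VSet n} → card S ≡ 0 → ∀ f → ∑ S f ≡ 0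
∑-card-0 {S = S} eq f = ∑-0 S (λ u u∈S → ⊥-elim (∈∉-⊥ u∈S (card-0 eq u)))

card-∈ : (S : VSet n) → 1 ≤ card S → ∃[ u ] u ∈ S
card-∈ S p = let u , q , _ = ∑-pos S (λ _ → 1) p in u , q

card-− : {S : VSet n} {v : Fin n} → v ∈ S → card S ≡ suc (card (S − v))
card-− v∈S = trans (∑-− v∈S (λ _ → 1)) (+-comm _ 1)

card-⊹ : {S : VSet n} {v : Fin n} → v ∉ S → card (S ⊹ v) ≡ suc (card S)
card-⊹ v∉S = trans (∑-⊹ v∉S (λ _ → 1)) (+-comm _ 1)

⊆-or-∃ : (A W : VSet n) → A ⊆ W ⊎ ∃[ u ] u ∈ A × u ∉ W
⊆-or-∃ A W with any? (λ u → (A ∖ W) u Bool.≟ true)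
... | yes (u , p) = inj₂ (u , ∖-⊆ {S = A} {W} u (mem p) , ∖-∉ {S = A} {W} (mem p))
... | no ¬p = inj₁ sub
  where
  sub : A ⊆ W
  sub u u∈A with ∈-or-∉ W u
  ... | inj₁ q = q
  ... | inj₂ q = ⊥-elim (¬p (u , inside (∖-∈ {S = A} {W} u∈A q)))

-- Multigraphs given by arc multiplicities

-- Every edge is one arc in an arbitrary direction, so the sum over ordered pairs in `edges` counts
-- it once; `mult` symmetrises.
record Graph (n : ℕ) : Set where
  field
    arcs : Fin n → Fin n → ℕ
    arcs-irr : ∀ u → arcs u u ≡ 0
open Graph public

mult : Graph n → Fin n → Fin n → ℕ
mult g v u = arcs g v u + arcs g u v

deg : Graph n → Fin n → VSet n → ℕ
deg g v S = ∑ S (mult g v)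

edges : Graph n → VSet n → ℕ
edges g S = ∑ S (λ u → ∑ S (arcs g u))

mult-sym : (g : Graph n) → ∀ u v → mult g u v ≡ mult g v u
mult-sym g u v = +-comm (arcs g u v) (arcs g v u)

mult-irr : (g : Graph n) → ∀ v → mult g v v ≡ 0
mult-irr g v = cong₂ _+_ (arcs-irr g v) (arcs-irr g v)

deg-∑-swap : (g : Graph n) (S T : VSet n) → ∑ S (λ u → deg g u T) ≡ ∑ T (λ u → deg g u S)
deg-∑-swap g S T = trans (∑-swap S T (mult g)) (∑-cong T (λ v _ → ∑-cong S (λ u _ → mult-sym g u v)))

deg-− : (g : Graph n) {S : VSet n} {v : Fin n} → deg g v S ≡ deg g v (S − v)
deg-− g {S} {v} with ∈-or-∉ S v
... | inj₁ v∈S = trans (∑-− v∈S (mult g v)) (trans (cong (deg g v (S − v) +_) (mult-irr g v)) (+-identityʳ _))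
... | inj₂ v∉S = ∑-≗ (mult g v) (⊆-− ⊆-refl v∉S) −-⊆

edges-part : (g : Graph n) {S S₁ S₂ : VSet n} → Part S S₁ S₂ →
             edges g S ≡ edges g S₁ + edges g S₂ + ∑ S₂ (λ v → deg g v S₁)
edges-part g {S} {S₁} {S₂} p = begin
  ∑ S (λ u → ∑ S (arcs g u))
    ≡⟨ ∑-part p _ ⟩
  ∑ S₁ (λ u → ∑ S (arcs g u)) + ∑ S₂ (λ u → ∑ S (arcs g u))
    ≡⟨ cong₂ _+_ (expand S₁) (expand S₂) ⟩
  (edges g S₁ + ∑ S₁ (λ u → ∑ S₂ (arcs g u))) + (∑ S₂ (λ u → ∑ S₁ (arcs g u)) + edges g S₂)
    ≡⟨ cong (λ x → (edges g S₁ + x) + (∑ S₂ (λ u → ∑ S₁ (arcs g u)) + edges g S₂)) (∑-swap S₁ S₂ (arcs g)) ⟩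
  (edges g S₁ + ∑ S₂ (λ v → ∑ S₁ (λ u → arcs g u v))) + (∑ S₂ (λ u → ∑ S₁ (arcs g u)) + edges g S₂)
    ≡⟨ rearrange (edges g S₁) _ _ (edges g S₂) ⟩
  edges g S₁ + edges g S₂ + (∑ S₂ (λ u → ∑ S₁ (arcs g u)) + ∑ S₂ (λ v → ∑ S₁ (λ u → arcs g u v)))
    ≡⟨ cong (edges g S₁ + edges g S₂ +_) (trans (sym (∑-+ S₂ _ _)) (∑-cong S₂ (λ v _ → sym (∑-+ S₁ _ _)))) ⟩
  edges g S₁ + edges g S₂ + ∑ S₂ (λ v → deg g v S₁) ∎
  where
  open ≡-Reasoning
  expand : ∀ T → ∑ T (λ u → ∑ S (arcs g u)) ≡ ∑ T (λ u → ∑ S₁ (arcs g u)) + ∑ T (λ u → ∑ S₂ (arcs g u))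
  expand T = trans (∑-cong T (λ u _ → ∑-part p (arcs g u))) (∑-+ T _ _)
  rearrange : ∀ a b c d → (a + b) + (c + d) ≡ a + d + (c + b)
  rearrange = solve-∀

edges-⊆ : (g : Graph n) {S T : VSet n} → S ⊆ T → edges g S ≤ edges g T
edges-⊆ g {S} {T} S⊆T = ≤-trans (∑-⊆ _ S⊆T) (∑-mono T (λ u _ → ∑-⊆ (arcs g u) S⊆T))

edges-≗ : (g : Graph n) {S T : VSet n} → S ⊆ T → T ⊆ S → edges g S ≡ edges g T
edges-≗ g p q = ≤-antisym (edges-⊆ g p) (edges-⊆ g q)

edges-⊹ : (g : Graph n) {S : VSet n} {v : Fin n} → v ∉ S → edges g (S ⊹ v) ≡ edges g S + deg g v S
edges-⊹ g {S} {v} v∉S = begin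
  edges g (S ⊹ v)
    ≡⟨ edges-part g (part-⊹ v∉S) ⟩
  edges g S + edges g ⁅ v ⁆ + ∑ ⁅ v ⁆ (λ u → deg g u S)
    ≡⟨ cong₂ (λ x y → edges g S + x + y)
         (trans (∑-⁅⁆ v _) (trans (∑-⁅⁆ v (arcs g v)) (arcs-irr g v))) (∑-⁅⁆ v _) ⟩
  edges g S + 0 + deg g v S
    ≡⟨ cong (_+ deg g v S) (+-identityʳ _) ⟩
  edges g S + deg g v S ∎
  where open ≡-Reasoning

edges-− : (g : Graph n) {S : VSet n} {v : Fin n} → v ∈ S → edges g S ≡ edges g (S − v) + deg g v (S − v)
edges-− g {S} {v} v∈S = trans (edges-≗ g (⊹-− S v) (⊹-⊆ −-⊆ v∈S)) (edges-⊹ g (−-∉ v))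

edges-card-0 : (g : Graph n) {S : VSet n} → card S ≡ 0 → edges g S ≡ 0
edges-card-0 g eq = ∑-card-0 eq _

handshake : (g : Graph n) (A : VSet n) → ∑ A (λ v → deg g v A) ≡ 2 * edges g A
handshake g A = begin
  ∑ A (λ v → deg g v A)
    ≡⟨ trans (∑-cong A (λ v _ → ∑-+ A _ _)) (∑-+ A _ _) ⟩
  edges g A + ∑ A (λ v → ∑ A (λ u → arcs g u v))
    ≡⟨ cong (edges g A +_) (∑-swap A A (λ v u → arcs g u v)) ⟩
  edges g A + edges g A
    ≡⟨ cong (edges g A +_) (+-identityʳ _) ⟨
  2 * edges g A ∎
  where open ≡-Reasoning

addEdge : (g : Graph n) (p q : Fin n) → p ≢ q → Graph n
addEdge g p q p≢q = record
  { arcs = λ u v → arcs g u v + ⟦ ⁅ p ⁆ u ⟧ * ⟦ ⁅ q ⁆ v ⟧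
  ; arcs-irr = irr }
  where
  irr : ∀ u → arcs g u u + ⟦ ⁅ p ⁆ u ⟧ * ⟦ ⁅ q ⁆ u ⟧ ≡ 0
  irr u with ≡-or-≢ u p
  ... | inj₁ refl = cong₂ _+_ (arcs-irr g u) (trans (cong (λ x → ⟦ ⁅ u ⁆ u ⟧ * ⟦ x ⟧) (outside (∉-⁅⁆ p≢q))) (*-zeroʳ ⟦ ⁅ u ⁆ u ⟧))
  ... | inj₂ u≢p = cong₂ _+_ (arcs-irr g u) (cong (λ x → ⟦ x ⟧ * ⟦ ⁅ q ⁆ u ⟧) (outside (∉-⁅⁆ u≢p)))

∑-indicator : (S : VSet n) (p : Fin n) → ∑ S (λ u → ⟦ ⁅ p ⁆ u ⟧) ≡ ⟦ S p ⟧
∑-indicator S p with ∈-or-∉ S p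
... | inj₁ p∈S = trans (∑-− p∈S _) (trans
  (cong₂ _+_ (∑-0 (S − p) (λ u q → cong ⟦_⟧ (outside (∉-⁅⁆ (−-≢ q))))) (cong ⟦_⟧ (inside (∈-⁅⁆ p))))
  (sym (cong ⟦_⟧ (inside p∈S))))
... | inj₂ p∉S = trans (∑-0 S (λ u q → cong ⟦_⟧ (outside (∉-⁅⁆ (∈-≢ q p∉S))))) (sym (cong ⟦_⟧ (outside p∉S)))

edges-addEdge : (g : Graph n) {p q : Fin n} (p≢q : p ≢ q) (S : VSet n) →
                edges (addEdge g p q p≢q) S ≡ edges g S + ⟦ S p ⟧ * ⟦ S q ⟧
edges-addEdge g {p} {q} p≢q S = begin
  ∑ S (λ u → ∑ S (λ v → arcs g u v + ⟦ ⁅ p ⁆ u ⟧ * ⟦ ⁅ q ⁆ v ⟧))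
    ≡⟨ trans (∑-cong S (λ u _ → ∑-+ S _ _)) (∑-+ S _ _) ⟩
  edges g S + ∑ S (λ u → ∑ S (λ v → ⟦ ⁅ p ⁆ u ⟧ * ⟦ ⁅ q ⁆ v ⟧))
    ≡⟨ cong (edges g S +_) (∑-cong S (λ u _ → trans (∑-* S ⟦ ⁅ p ⁆ u ⟧ _) (trans (cong (⟦ ⁅ p ⁆ u ⟧ *_) (∑-indicator S q)) (*-comm ⟦ ⁅ p ⁆ u ⟧ ⟦ S q ⟧)))) ⟩
  edges g S + ∑ S (λ u → ⟦ S q ⟧ * ⟦ ⁅ p ⁆ u ⟧)
    ≡⟨ cong (edges g S +_) (trans (∑-* S ⟦ S q ⟧ _) (trans (cong (⟦ S q ⟧ *_) (∑-indicator S p)) (*-comm ⟦ S q ⟧ ⟦ S p ⟧))) ⟩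
  edges g S + ⟦ S p ⟧ * ⟦ S q ⟧ ∎
  where open ≡-Reasoning

mult-addEdge : (g : Graph n) {q s : Fin n} (q≢s : q ≢ s) (u : Fin n) → mult (addEdge g q s q≢s) s u ≡ mult g s u + ⟦ ⁅ q ⁆ u ⟧
mult-addEdge g {q} {s} q≢s u
  rewrite outside (∉-⁅⁆ (≢-sym q≢s)) | inside (∈-⁅⁆ s) = rearrange (arcs g s u) (arcs g u s) ⟦ ⁅ q ⁆ u ⟧
  where
  rearrange : ∀ a b x → a + 0 + (b + x * 1) ≡ a + b + x
  rearrange = solve-∀

mult-addEdge-≢ : (g : Graph n) {q s : Fin n} (q≢s : q ≢ s) (u : Fin n) → u ≢ s → mult (addEdge g q s q≢s) q u ≡ mult g q u
mult-addEdge-≢ g {q} {s} q≢s u u≢s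
  rewrite outside (∉-⁅⁆ u≢s) | inside (∈-⁅⁆ q) | outside (∉-⁅⁆ q≢s) = rearrange (arcs g q u) (arcs g u q) ⟦ ⁅ q ⁆ u ⟧
  where
  rearrange : ∀ a b x → a + 0 + (b + x * 0) ≡ a + b
  rearrange = solve-∀

mult-addEdge-≥ : (g : Graph n) {q s : Fin n} (q≢s : q ≢ s) (u v : Fin n) → mult g u v ≤ mult (addEdge g q s q≢s) u v
mult-addEdge-≥ g q≢s u v = +-mono-≤ (m≤m+n (arcs g u v) _) (m≤m+n (arcs g v u) _)

edges-addEdge-≥ : (g : Graph n) {q s : Fin n} (q≢s : q ≢ s) (S : VSet n) → edges g S ≤ edges (addEdge g q s q≢s) S
edges-addEdge-≥ g q≢s S = ≤-trans (m≤m+n _ _) (≤-reflexive (sym (edges-addEdge g q≢s S)))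

edges-addEdge-∉ : (g : Graph n) {q s : Fin n} (q≢s : q ≢ s) {S : VSet n} → q ∉ S ⊎ s ∉ S → edges (addEdge g q s q≢s) S ≡ edges g S
edges-addEdge-∉ g {q} {s} q≢s {S} (inj₁ (nonmem p)) =
  trans (edges-addEdge g q≢s S) (trans (cong (λ x → edges g S + ⟦ x ⟧ * ⟦ S s ⟧) p) (+-identityʳ _))
edges-addEdge-∉ g {q} {s} q≢s {S} (inj₂ (nonmem p)) =
  trans (edges-addEdge g q≢s S) (trans (cong (λ x → edges g S + ⟦ S q ⟧ * ⟦ x ⟧) p) (trans (cong (edges g S +_) (*-zeroʳ ⟦ S q ⟧)) (+-identityʳ _)))

edges-addEdge-∈ : (g : Graph n) {q s : Fin n} (q≢s : q ≢ s) {S : VSet n} → q ∈ S → s ∈ S → edges (addEdge g q s q≢s) S ≡ edges g S + 1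
edges-addEdge-∈ g q≢s {S} (mem p) (mem q) = trans (edges-addEdge g q≢s S) (cong (edges g S +_) (cong₂ (λ x y → ⟦ x ⟧ * ⟦ y ⟧) p q))

-- For a vertex that subdivides an additional edge with ends `x` and `y`: inside any set, its edges
-- outnumber the additional edge by at most one, as `add-F` requires.
bool-sum : ∀ x y → ⟦ x ⟧ + ⟦ y ⟧ ≤ suc (⟦ x ⟧ * ⟦ y ⟧)
bool-sum true true = ≤-refl
bool-sum true false = ≤-refl
bool-sum false true = ≤-refl
bool-sum false false = z≤n

deg-−-∈ : (g : Graph n) (u : Fin n) {S : VSet n} {v : Fin n} → v ∈ S → deg g u S ≡ deg g u (S − v) + mult g u v
deg-−-∈ g u v∈S = ∑-− v∈S (mult g u)

-- Weighted colourings, with both colour classes described by edge counts: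
-- a set of vertices of a forest is connected iff it spans all but one edge.

two-trees : ∀ k₁ k₂ e₁ e₂ → suc k₁ + suc k₂ ≤ suc (e₁ + e₂) → e₁ ≤ k₁ → e₂ ≤ k₂ → ⊥
two-trees k₁ k₂ e₁ e₂ h₁ h₂ h₃ = ⊥-by 0 (h₁ ⊕ h₂ ⊕ h₃) (solve (k₁ ∷ k₂ ∷ e₁ ∷ e₂ ∷ []))

Weight : ℕ → Set
Weight n = Fin n → ℕ

weight : Weight n → VSet n → ℕ
weight w S = ∑ S (λ u → suc (w u))

Mono : VSet n → Bool → VSet n → Set
Mono c x S = ∀ u → u ∈ S → c u ≡ x

Mono-⊆ : {c S T : VSet n} {x : Bool} → S ⊆ T → Mono c x T → Mono c x S
Mono-⊆ S⊆T m u p = m u (S⊆T u p)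

Mono-F : {A c S : VSet n} → S ⊆ A → Mono c false S → S ⊆ A ∖ c
Mono-F S⊆A m u p = ∖-∈ (S⊆A u p) (nonmem (m u p))

Mono-M : {A c S : VSet n} → S ⊆ A → Mono c true S → S ⊆ A ∩ c
Mono-M S⊆A m u p = ∩-∈ (S⊆A u p) (mem (m u p))

recolor : VSet n → Fin n → Bool → VSet n
recolor c v x u = if ⁅ v ⁆ u then x else c u

recolor-≡ : (c : VSet n) (v : Fin n) (x : Bool) → recolor c v x v ≡ x
recolor-≡ c v x rewrite inside (∈-⁅⁆ v) = refl

recolor-≢ : (c : VSet n) {u v : Fin n} (x : Bool) → u ≢ v → recolor c v x u ≡ c u
recolor-≢ c x u≢v rewrite outside (∉-⁅⁆ u≢v) = refl

Mono-recolor : {c S : VSet n} {v : Fin n} {x y : Bool} → v ∉ S → Mono (recolor c v y) x S → Mono c x S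
Mono-recolor {c = c} {y = y} v∉S m u p = trans (sym (recolor-≢ c y (∈-≢ p v∉S))) (m u p)

recolor-M-⊆ : {S c : VSet n} {x : Fin n} → (S ⊹ x) ∖ recolor c x true ⊆ S ∖ c
recolor-M-⊆ {S = S} {c} {x} u r with ≡-or-≢ u x | ⊹-inv (∖-⊆ {S = S ⊹ x} u r)
... | inj₁ refl | _ = contradiction (trans (sym (recolor-≡ c u true)) (outside (∖-∉ {S = S ⊹ u} r))) λ ()
... | inj₂ u≢x | inj₂ u≡x = ⊥-elim (u≢x u≡x)
... | inj₂ u≢x | inj₁ t = ∖-∈ t (nonmem (trans (sym (recolor-≢ c true u≢x)) (outside (∖-∉ {S = S ⊹ x} r))))

recolor-F-⊆ : {S c : VSet n} {x : Fin n} → (S ⊹ x) ∖ recolor c x false ⊆ (S ∖ c) ⊹ x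
recolor-F-⊆ {S = S} {c} {x} u r with ≡-or-≢ u x | ⊹-inv (∖-⊆ {S = S ⊹ x} u r)
... | inj₁ refl | _ = ⊹-∈ _ u
... | inj₂ u≢x | inj₂ u≡x = ⊥-elim (u≢x u≡x)
... | inj₂ u≢x | inj₁ t = ⊹-⊇ u (∖-∈ t (nonmem (trans (sym (recolor-≢ c false u≢x)) (outside (∖-∉ {S = S ⊹ x} r)))))

⊹-⊆-inv : {A S : VSet n} {v : Fin n} → S ⊆ A ⊹ v → S − v ⊆ A
⊹-⊆-inv S⊆ u p with ⊹-inv (S⊆ u (−-⊆ u p))
... | inj₁ q = q
... | inj₂ q = ⊥-elim (−-≢ p q)

⊹-⊆-inv′ : {A S : VSet n} {v : Fin n} → v ∉ S → S ⊆ A ⊹ v → S ⊆ A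
⊹-⊆-inv′ v∉S S⊆ u p = ⊹-⊆-inv S⊆ u (−-∈ p (∈-≢ p v∉S))

insert-bound : (g : Graph n) {S : VSet n} {v : Fin n} {k : ℕ} → v ∈ S →
               edges g (S − v) + deg g v (S − v) ≤ suc k → k ≤ pred (card (S − v)) → edges g S ≤ pred (card S)
insert-bound g {S} {v} v∈S p q rewrite card-− v∈S | edges-− g v∈S with card (S − v) in eq
-- The bound `suc k` is too weak here: a single vertex must span no edge at all, and indeed nothing
-- is left for it to be joined to.
... | zero = ≤-reflexive (cong₂ _+_ (edges-card-0 g eq) (∑-card-0 eq _))
... | suc _ = ≤-trans p (s≤s q)

deg-split : (g : Graph n) (v : Fin n) (A c : VSet n) → deg g v A ≡ deg g v (A ∩ c) + deg g v (A ∖ c)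
deg-split g v A c = ∑-part (part-∩∖ A c) (mult g v)

module _ (K : ℕ) where

  -- Bounding all monochromatic subsets, instead of speaking of cycles and components, makes the
  -- notion pass to subsets at once; `pred` keeps the empty set from violating it.
  record Ok (g : Graph n) (w : Weight n) (A c : VSet n) : Set where
    field
      forest : ∀ x S → S ⊆ A → Mono c x S → edges g S ≤ pred (card S)
      small : ∀ S → S ⊆ A → Mono c true S → card S ≤ suc (edges g S) → weight w S ≤ K
  open Ok public

  Colorable : Graph n → Weight n → VSet n → Set
  Colorable g w A = ∃ (Ok g w A)

  -- Weights are compared on the class `M` only: a colouring that puts every raised vertex into `F`
  -- survives the raise.
  Ok-weaken : {g g′ : Graph n} {w w′ : Weight n} {A B c : VSet n} → B ⊆ A →
              (∀ S → S ⊆ B → edges g′ S ≤ edges g S) → (∀ u → u ∈ B → c u ≡ true → w′ u ≤ w u) →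
              Ok g w A c → Ok g′ w′ B c
  Ok-weaken B⊆A g′≤g w′≤w ok = record
    { forest = λ x S S⊆B m → ≤-trans (g′≤g S S⊆B) (forest ok x S (⊆-trans S⊆B B⊆A) m)
    ; small = λ S S⊆B m p → ≤-trans (∑-mono S (λ u q → s≤s (w′≤w u (S⊆B u q) (m u q))))
                (small ok S (⊆-trans S⊆B B⊆A) m (≤-trans p (s≤s (g′≤g S S⊆B)))) }

  Ok-⊆ : {g : Graph n} {w : Weight n} {A B c : VSet n} → B ⊆ A → Ok g w A c → Ok g w B c
  Ok-⊆ B⊆A = Ok-weaken B⊆A (λ _ _ → ≤-refl) (λ _ _ _ → ≤-refl)

  Colorable-⊆ : {g : Graph n} {w : Weight n} {A B : VSet n} → B ⊆ A → Colorable g w A → Colorable g w B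
  Colorable-⊆ B⊆A (c , ok) = c , Ok-⊆ B⊆A ok

  -- The graph g₁ is allowed to have additional edges, so that v may subdivide one of them.
  add-F : {g g₁ : Graph n} {w : Weight n} {A c : VSet n} {v : Fin n} → Ok g₁ w A c → v ∉ A →
          (∀ S → S ⊆ A → edges g S ≤ edges g₁ S) →
          (∀ S → S ⊆ A → Mono c false S → edges g S + deg g v S ≤ suc (edges g₁ S)) →
          Ok g w (A ⊹ v) (recolor c v false)
  add-F {g = g} {g₁} {w} {A} {c} {v} ok v∉A g≤g₁ bound = record { forest = forest′ ; small = small′ }
    where
    forest′ : ∀ x S → S ⊆ A ⊹ v → Mono (recolor c v false) x S → edges g S ≤ pred (card S)
    forest′ x S S⊆ m with ∈-or-∉ S v
    ... | inj₂ v∉S = ≤-trans (g≤g₁ S S⊆A) (forest ok x S S⊆A (Mono-recolor v∉S m))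
      where S⊆A = ⊹-⊆-inv′ v∉S S⊆
    ... | inj₁ v∈S with trans (sym (m v v∈S)) (recolor-≡ c v false)
    ...   | refl = insert-bound g v∈S (bound (S − v) S′⊆A m′) (forest ok false (S − v) S′⊆A m′)
      where
      S′⊆A = ⊹-⊆-inv S⊆
      m′ : Mono c false (S − v)
      m′ = Mono-recolor (−-∉ v) (Mono-⊆ −-⊆ m)
    small′ : ∀ S → S ⊆ A ⊹ v → Mono (recolor c v false) true S → card S ≤ suc (edges g S) → weight w S ≤ K
    small′ S S⊆ m p with ∈-or-∉ S v
    ... | inj₂ v∉S = small ok S S⊆A (Mono-recolor v∉S m) (≤-trans p (s≤s (g≤g₁ S S⊆A)))
      where S⊆A = ⊹-⊆-inv′ v∉S S⊆
    ... | inj₁ v∈S with trans (sym (m v v∈S)) (recolor-≡ c v false)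
    ...   | ()

  add-leaf-F : {g : Graph n} {w : Weight n} {A c : VSet n} {v : Fin n} → Ok g w A c → v ∉ A →
               deg g v (A ∖ c) ≤ 1 → Ok g w (A ⊹ v) (recolor c v false)
  add-leaf-F {g = g} {v = v} ok v∉A d≤1 = add-F ok v∉A (λ _ _ → ≤-refl)
    (λ S S⊆A m → subst (edges g S + deg g v S ≤_) (+-comm _ 1)
      (+-monoʳ-≤ (edges g S) (≤-trans (∑-⊆ _ (Mono-F S⊆A m)) d≤1)))

  -- The weights `w′` hold room in reserve. The vertex `v` joins at most one component of `M`, and
  -- the neighbour through which it does so carries an extra `suc (w v)` in `w′`, so the enlarged
  -- component counts for at most `K` in `w`.
  add-M : {g : Graph n} {w w′ : Weight n} {A c : VSet n} {v : Fin n} → Ok g w′ A c → v ∉ A →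
          deg g v (A ∩ c) ≤ 1 → suc (w v) ≤ K → (∀ u → u ∈ A → w u ≤ w′ u) →
          (∀ u → u ∈ A ∩ c → 1 ≤ mult g v u → w u + suc (w v) ≤ w′ u) →
          Ok g w (A ⊹ v) (recolor c v true)
  add-M {g = g} {w} {w′} {A} {c} {v} ok v∉A d≤1 wv≤K w≤w′ slack = record { forest = forest′ ; small = small′ }
    where
    m⁻ : ∀ {S} → Mono (recolor c v true) true S → Mono c true (S − v)
    m⁻ m = Mono-recolor (−-∉ v) (Mono-⊆ −-⊆ m)
    forest′ : ∀ x S → S ⊆ A ⊹ v → Mono (recolor c v true) x S → edges g S ≤ pred (card S)
    forest′ x S S⊆ m with ∈-or-∉ S v
    ... | inj₂ v∉S = forest ok x S (⊹-⊆-inv′ v∉S S⊆) (Mono-recolor v∉S m)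
    ... | inj₁ v∈S with trans (sym (m v v∈S)) (recolor-≡ c v true)
    ...   | refl = insert-bound g v∈S
      (subst (edges g (S − v) + deg g v (S − v) ≤_) (+-comm _ 1)
        (+-monoʳ-≤ (edges g (S − v)) (≤-trans (∑-⊆ _ (Mono-M (⊹-⊆-inv S⊆) (m⁻ m))) d≤1)))
      (forest ok true (S − v) (⊹-⊆-inv S⊆) (m⁻ m))
    small′ : ∀ S → S ⊆ A ⊹ v → Mono (recolor c v true) true S → card S ≤ suc (edges g S) → weight w S ≤ K
    small′ S S⊆ m p with ∈-or-∉ S v
    ... | inj₂ v∉S = ≤-trans (∑-mono S (λ u q → s≤s (w≤w′ u (S⊆A u q)))) (small ok S S⊆A (Mono-recolor v∉S m) p)
      where S⊆A = ⊹-⊆-inv′ v∉S S⊆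
    ... | inj₁ v∈S = subst (_≤ K) (sym (∑-− v∈S _)) (bound (card (S − v)) refl)
      where
      S′ = S − v
      S′⊆A = ⊹-⊆-inv S⊆
      p′ : card S′ ≤ edges g S′ + deg g v S′
      p′ = s≤s⁻¹ (subst₂ _≤_ (card-− v∈S) (cong suc (edges-− g v∈S)) p)
      fo : edges g S′ ≤ pred (card S′)
      fo = forest ok true S′ S′⊆A (m⁻ m)
      d′≤1 : deg g v S′ ≤ 1
      d′≤1 = ≤-trans (∑-⊆ _ (Mono-M S′⊆A (m⁻ m))) d≤1
      bound : ∀ k → card S′ ≡ k → weight w S′ + suc (w v) ≤ K
      bound zero eq = subst (λ x → x + suc (w v) ≤ K) (sym (∑-card-0 eq _)) wv≤K
      bound (suc k) eq = ≤-trans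
        (∑-mono-at S′ (suc (w v)) (λ u q → s≤s (w≤w′ u (S′⊆A u q))) u∈S′
          (s≤s (slack u (Mono-M S′⊆A (m⁻ m) u u∈S′) adj)))
        (small ok S′ S′⊆A (m⁻ m) (≤-trans p′ (subst (edges g S′ + deg g v S′ ≤_) (+-comm _ 1) (+-monoʳ-≤ (edges g S′) d′≤1))))
        where
        -- A forest on `suc k` vertices has at most `k` edges, so connectedness of `S` needs an edge
        -- at `v`; its other end is the vertex with the reserve.
        1≤d : 1 ≤ deg g v S′
        1≤d = +-cancelˡ-≤ k 1 _ (≤-trans (≤-reflexive (trans (+-comm k 1) (sym eq)))
                (≤-trans p′ (+-monoˡ-≤ _ (subst (λ x → edges g S′ ≤ pred x) eq fo))))
        found = ∑-pos S′ (mult g v) 1≤d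
        u = proj₁ found
        u∈S′ = proj₁ (proj₂ found)
        adj = proj₂ (proj₂ found)

  -- Three edges cannot go twice to each class: with at most one edge into `F` the vertex goes to
  -- `F`, otherwise at most one is left for `M`, where the reserve pays for it.
  add-vertex : {g : Graph n} {w w′ : Weight n} {A : VSet n} {v : Fin n} → Colorable g w′ A → v ∉ A →
               deg g v A ≤ 3 → suc (w v) ≤ K → (∀ u → u ∈ A → w u ≤ w′ u) →
               (∀ u → u ∈ A → 1 ≤ mult g v u → w u + suc (w v) ≤ w′ u) → Colorable g w (A ⊹ v)
  add-vertex {g = g} {A = A} {v} (c , ok) v∉A d≤3 wv≤K w≤w′ slack with deg g v (A ∖ c) ≤? 1
  ... | yes p = _ , add-leaf-F (Ok-weaken ⊆-refl (λ _ _ → ≤-refl) (λ u q _ → w≤w′ u q) ok) v∉A p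
  ... | no p = _ , add-M ok v∉A dM wv≤K w≤w′ (λ u q → slack u (∩-⊆ˡ u q))
    where
    dM : deg g v (A ∩ c) ≤ 1
    dM = +-cancelʳ-≤ 2 _ 1 (≤-trans (+-monoʳ-≤ (deg g v (A ∩ c)) (≰⇒> p)) (subst (_≤ 3) (deg-split g v A c) d≤3))

-- Decidability of colourability

-- Sets are functions, so the search runs over vectors; a set and the lookup in its table agree only
-- pointwise, hence the demand that `P` respect `≗`.
any-VSet? : {P : VSet n → Set} → (∀ {S T} → S ≗ T → P S → P T) → (∀ S → Dec (P S)) → Dec (∃ P)
any-VSet? resp P? = map′ (λ (s , p) → lookup s , p)
  (λ (S , p) → tabulate S , resp (λ u → sym (lookup∘tabulate S u)) p)
  (anySubset? (λ s → P? (lookup s)))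

all-VSet? : {P : VSet n → Set} → (∀ {S T} → S ≗ T → P S → P T) → (∀ S → Dec (P S)) → Dec (∀ S → P S)
all-VSet? {P = P} resp P? = map′ (λ ¬∃ S → decidable-stable (P? S) (λ ¬p → ¬∃ (S , ¬p))) (λ p (S , ¬p) → ¬p (p S))
  (¬? (any-VSet? (λ S≗T ¬p q → ¬p (resp (λ u → sym (S≗T u)) q)) (λ S → ¬? (P? S))))

⊆? : (S T : VSet n) → Dec (S ⊆ T)
⊆? S T with ⊆-or-∃ S T
... | inj₁ p = yes p
... | inj₂ (u , p , q) = no (λ S⊆T → ∈∉-⊥ (S⊆T u p) q)

Mono? : (c : VSet n) (x : Bool) (S : VSet n) → Dec (Mono c x S)
Mono? c x S = map′ (λ p u q → p u (inside q)) (λ p u q → p u (mem q))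
  (all? (λ u → (S u Bool.≟ true) →-dec (c u Bool.≟ x)))

≗-⊆ : {S T : VSet n} → S ≗ T → S ⊆ T
≗-⊆ S≗T u p = mem (trans (sym (S≗T u)) (inside p))

module _ (K : ℕ) where

  -- The conditions of `Ok` at a single set `S`, so that the quantifier over `S` comes first and
  -- `all-VSet?` applies.
  OkAt : Graph n → Weight n → VSet n → VSet n → VSet n → Set
  OkAt g w A c S = S ⊆ A →
    (Mono c false S → edges g S ≤ pred (card S)) ×
    (Mono c true S → edges g S ≤ pred (card S) × (card S ≤ suc (edges g S) → weight w S ≤ K))

  OkAt-resp : {g : Graph n} {w : Weight n} {A c c′ S T : VSet n} → c ≗ c′ → S ≗ T →
              OkAt g w A c S → OkAt g w A c′ T
  OkAt-resp {g = g} {w} {A} {c} {c′} {S} {T} c≗c′ S≗T ok T⊆A =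
    (λ m → subst₂ (λ x y → x ≤ pred y) eqE (eq∑ _) (proj₁ (ok S⊆A) (back m))) ,
    (λ m → let p , q = proj₂ (ok S⊆A) (back m) in
      subst₂ (λ x y → x ≤ pred y) eqE (eq∑ _) p ,
      (λ r → subst (_≤ K) (eq∑ _) (q (subst₂ (λ x y → x ≤ suc y) (sym (eq∑ _)) (sym eqE) r))))
    where
    S⊆T = ≗-⊆ S≗T
    T⊆S = ≗-⊆ (λ u → sym (S≗T u))
    S⊆A = ⊆-trans S⊆T T⊆A
    eqE = edges-≗ g S⊆T T⊆S
    eq∑ : ∀ f → ∑ S f ≡ ∑ T f
    eq∑ f = ∑-≗ f S⊆T T⊆S
    back : ∀ {x} → Mono c′ x T → Mono c x S
    back m u p = trans (c≗c′ u) (m u (S⊆T u p))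

  colorable? : (g : Graph n) (w : Weight n) (A : VSet n) → Dec (Colorable K g w A)
  colorable? g w A = map′ (λ (c , p) → c , toOk p) (λ (c , ok) → c , fromOk ok)
    (any-VSet? (λ {c} {c′} c≗c′ p S → OkAt-resp {g = g} {w} {A} {c} {c′} {S} c≗c′ (λ _ → refl) (p S))
      (λ c → all-VSet? (λ {S} {T} → OkAt-resp {g = g} {w} {A} {c} {c} {S} {T} (λ _ → refl))
        (λ S → ⊆? S A →-dec
          ((Mono? c false S →-dec (_ ≤? _)) ×-dec
           (Mono? c true S →-dec ((_ ≤? _) ×-dec ((_ ≤? _) →-dec (_ ≤? _))))))))
    where
    toOk : ∀ {c} → (∀ S → OkAt g w A c S) → Ok K g w A c
    toOk p = record
      { forest = λ { false S S⊆A m → proj₁ (p S S⊆A) m ; true S S⊆A m → proj₁ (proj₂ (p S S⊆A) m) }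
      ; small = λ S S⊆A m → proj₂ (proj₂ (p S S⊆A) m) }
    fromOk : ∀ {c} → Ok K g w A c → ∀ S → OkAt g w A c S
    fromOk ok S S⊆A = forest ok false S S⊆A , λ m → forest ok true S S⊆A m , small ok S S⊆A m

-- Potentials and the contraction of a coloured set

record Potential : Set where
  field
    K b : ℕ
    cost : ℕ → ℕ
    3≤b : 3 ≤ b
    cost-0 : cost 0 ≡ 0
    -- Makes the price of a raise independent of the weight that was there before.
    cost-sub : ∀ x y → cost (x + y) ≤ cost x + cost y
    cost-1 : cost 1 ≤ 2
    cost≤b : ∀ x → cost x ≤ b
    -- Leaves a vertex forced into `F` with worth `b - 1`; each `suc b` below arises as
    -- `2 + (b - 1)`.
    cost-top : ∀ x → K ≤ x → cost x ≡ b

module WithPotential (Π : Potential) where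
  open Potential Π public

  cost-suc : ∀ x → cost (suc x) ≤ 2 + cost x
  cost-suc x = ≤-trans (cost-sub 1 x) (+-monoˡ-≤ (cost x) cost-1)

  worth : Weight n → Fin n → ℕ
  worth w u = 2 * b ∸ suc (cost (w u))

  worth-eq : (w : Weight n) (u : Fin n) → worth w u + suc (cost (w u)) ≡ 2 * b
  worth-eq w u = m∸n+n≡m (≤-trans (s≤s (cost≤b (w u)))
    (subst (suc b ≤_) (cong (b +_) (sym (+-identityʳ b))) (+-monoˡ-≤ b (≤-trans (s≤s z≤n) 3≤b))))

  worth-≤ : (w w′ : Weight n) (u : Fin n) {k : ℕ} → cost (w′ u) ≤ cost (w u) + k → worth w u ≤ worth w′ u + k
  worth-≤ w w′ u {k} p = arith (worth w u) (worth w′ u) (cost (w u)) (cost (w′ u)) k b (worth-eq w u) (worth-eq w′ u) p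
    where
    arith : ∀ x x′ y y′ k b → x + suc y ≡ 2 * b → x′ + suc y′ ≡ 2 * b → y′ ≤ y + k → x ≤ x′ + k
    arith x x′ y y′ k b p q r = ≤-by 0 (≤-reflexive p ⊕ ≤-reflexive (sym q) ⊕ r)
      (solve (x ∷ x′ ∷ y ∷ y′ ∷ k ∷ b ∷ []))

  -- The potential ρ of S is P w S - Q g S; Drop g w k U W says that ρ U + k ≤ ρ W.
  P : Weight n → VSet n → ℕ
  P w S = ∑ S (worth w)

  Q : Graph n → VSet n → ℕ
  Q g S = b * edges g S

  Drop : Graph n → Weight n → ℕ → VSet n → VSet n → Set
  Drop g w k U W = P w U + k + Q g W ≤ P w W + Q g U

  -- Low potential is claimed for a subset `U`, since an uncolourable set stays uncolourable when
  -- vertices of large worth are added. Both `g` and `w` vary, because contractions and raises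
  -- change them.
  Extremal : (n N : ℕ) → Set
  Extremal n N = ∀ {g : Graph n} {w : Weight n} {A : VSet n} → card A < N → ¬ Colorable K g w A →
    ∃[ U ] U ⊆ A × ¬ Colorable K g w U × P w U + 2 ≤ Q g U

  forced-F : {g : Graph n} {w : Weight n} {A c : VSet n} {u : Fin n} → Ok K g w A c → u ∈ A → K ≤ w u → c u ≡ false
  forced-F {g = g} {w} {c = c} {u} ok u∈A K≤w with c u in eq
  ... | false = refl
  ... | true = ⊥-elim (<-irrefl refl (≤-trans (s≤s K≤w) (subst (_≤ K) (∑-⁅⁆ u _)
    (small ok ⁅ u ⁆ (λ v p → subst (_∈ _) (sym (⁅⁆-≡ p)) u∈A) (λ v p → subst (λ x → c x ≡ true) (sym (⁅⁆-≡ p)) eq)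
      (≤-trans (≤-reflexive (∑-⁅⁆ u _)) (s≤s z≤n))))))

  -- Contracting a coloured set W: its F-part becomes the single vertex r, which is forced into F,
  -- and the neighbours of its M-part are forced into F as well.
  module Contract (g : Graph n) (w : Weight n) (A W c : VSet n) (r : Fin n)
                  (W⊆A : W ⊆ A) (r∈W : r ∈ W) (okW : Ok K g w W c) where

    F M A′ : VSet n
    F = W ∖ c
    M = W ∩ c
    -- `r` is any vertex of `W`, reused as the name of the contracted vertex so that everything
    -- stays on `Fin n`; it stands for `F` even if it lies in `M`.
    A′ = (A ∖ W) ⊹ r

    arcs′ : Fin n → Fin n → ℕ
    arcs′ u v = if ⁅ r ⁆ u then (if ⁅ r ⁆ v then 0 else ∑ F (λ x → arcs g x v))
                           else (if ⁅ r ⁆ v then ∑ F (arcs g u) else arcs g u v)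

    g′ : Graph n
    g′ = record { arcs = arcs′ ; arcs-irr = irr }
      where
      irr : ∀ u → arcs′ u u ≡ 0
      irr u with ⁅ r ⁆ u
      ... | true = refl
      ... | false = arcs-irr g u

    -- `1 ⊓ deg g u M` indicates a neighbour in `M`; adding `K` then forces `u` into `F`, whatever
    -- its weight.
    w′ : Weight n
    w′ u = if ⁅ r ⁆ u then K else w u + K * (1 ⊓ deg g u M)

    w′-r : w′ r ≡ K
    w′-r rewrite inside (∈-⁅⁆ r) = refl

    w′-≢ : ∀ {u} → u ≢ r → w′ u ≡ w u + K * (1 ⊓ deg g u M)
    w′-≢ u≢r rewrite outside (∉-⁅⁆ u≢r) = refl

    arcs′-≢ : ∀ {u v} → u ≢ r → v ≢ r → arcs′ u v ≡ arcs g u v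
    arcs′-≢ u≢r v≢r rewrite outside (∉-⁅⁆ u≢r) | outside (∉-⁅⁆ v≢r) = refl

    mult′-r : ∀ {u} → u ≢ r → mult g′ r u ≡ deg g u F
    mult′-r {u} u≢r rewrite inside (∈-⁅⁆ r) | outside (∉-⁅⁆ u≢r) =
      trans (+-comm (∑ F (λ x → arcs g x u)) (∑ F (arcs g u))) (sym (∑-+ F _ _))

    edges′-≢ : ∀ {S} → r ∉ S → edges g′ S ≡ edges g S
    edges′-≢ {S} r∉S = ∑-cong S (λ u p → ∑-cong S (λ v q → arcs′-≢ (∈-≢ p r∉S) (∈-≢ q r∉S)))

    edges′-⊹ : ∀ {S} → r ∉ S → edges g′ (S ⊹ r) ≡ edges g S + ∑ S (λ u → deg g u F)
    edges′-⊹ {S} r∉S = trans (edges-⊹ g′ r∉S)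
      (cong₂ _+_ (edges′-≢ r∉S) (∑-cong S (λ u p → mult′-r (∈-≢ p r∉S))))

    r∉ : ∀ {S} → S ⊆ A ∖ W → r ∉ S
    r∉ {S} S⊆ with ∈-or-∉ S r
    ... | inj₁ p = ⊥-elim (∈∉-⊥ r∈W (∖-∉ {S = A} (S⊆ r p)))
    ... | inj₂ p = p

    glue : VSet n → VSet n
    glue c′ u = if W u then c u else c′ u

    glue-in : ∀ c′ {u} → u ∈ W → glue c′ u ≡ c u
    glue-in c′ (mem p) rewrite p = refl

    glue-out : ∀ c′ {u} → u ∉ W → glue c′ u ≡ c′ u
    glue-out c′ (nonmem p) rewrite p = refl

    -- Vertices outside `W` with a neighbour in `M` are forced into `F`, so no edge joins the two
    -- halves of a set coloured `M`. For a set coloured `F`, the half outside `W` together with `r`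
    -- already accounts for all edges across, and the half inside `W` is a forest of its own.
    glue-ok : ∀ {c′} → Ok K g′ w′ A′ c′ → Ok K g w A (glue c′)
    glue-ok {c′} ok′ = record { forest = forest′ ; small = small′ }
      where
      module Sets {x : Bool} (S : VSet n) (S⊆A : S ⊆ A) (m : Mono (glue c′) x S) where
        S₁ S₂ : VSet n
        S₁ = S ∩ W
        S₂ = S ∖ W
        S₁⊆W : S₁ ⊆ W
        S₁⊆W = ∩-⊆ʳ {S = S}
        S₂⊆ : S₂ ⊆ A ∖ W
        S₂⊆ u p = ∖-∈ (S⊆A u (∖-⊆ u p)) (∖-∉ {S = S} p)
        S₂⊆A′ : S₂ ⊆ A′
        S₂⊆A′ = ⊆-trans S₂⊆ ⊹-⊇
        m₁ : Mono c x S₁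
        m₁ u p = trans (sym (glue-in c′ (S₁⊆W u p))) (m u (∩-⊆ˡ u p))
        m₂ : Mono c′ x S₂
        m₂ u p = trans (sym (glue-out c′ (∖-∉ {S = S} p))) (m u (∖-⊆ u p))
        cross : ℕ
        cross = ∑ S₂ (λ u → deg g u S₁)
        edges-S : edges g S ≡ edges g S₁ + edges g S₂ + cross
        edges-S = edges-part g (part-∩∖ S W)
        card-S : card S ≡ card S₁ + card S₂
        card-S = ∑-part (part-∩∖ S W) _
        fo₁ : edges g S₁ ≤ pred (card S₁)
        fo₁ = forest okW x S₁ S₁⊆W m₁
        fo₂ : edges g S₂ ≤ pred (card S₂)
        fo₂ = subst (_≤ pred (card S₂)) (edges′-≢ (r∉ S₂⊆)) (forest ok′ x S₂ S₂⊆A′ m₂)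

      c′r : c′ r ≡ false
      c′r = forced-F ok′ (⊹-∈ _ r) (≤-reflexive (sym w′-r))

      no-cross : ∀ S (S⊆A : S ⊆ A) (m : Mono (glue c′) true S) → Sets.cross S S⊆A m ≡ 0
      no-cross S S⊆A m = ∑-0 S₂ (λ u p → n≤0⇒n≡0 (≤-trans (∑-⊆ _ (Mono-M S₁⊆W m₁)) (dM u p)))
        where
        open Sets S S⊆A m
        dM : ∀ u → u ∈ S₂ → deg g u M ≤ 0
        dM u p with deg g u M in eq
        ... | zero = z≤n
        ... | suc k = contradiction (trans (sym (m₂ u p)) (forced-F ok′ (S₂⊆A′ u p)
          (≤-trans (≤-reflexive (sym (*-identityʳ K))) (≤-trans (m≤n+m (K * 1) (w u))
            (≤-reflexive (sym (trans (w′-≢ (∈-≢ p (r∉ S₂⊆))) (cong (λ x → w u + K * (1 ⊓ x)) eq)))))))) λ ()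

      pred-+ : ∀ {e₁ e₂ c₁ c₂} → e₁ ≤ pred c₁ → e₂ ≤ pred c₂ → e₁ + e₂ ≤ pred (c₁ + c₂)
      pred-+ {c₁ = zero} z≤n q = q
      pred-+ {c₁ = suc c₁} p q = +-mono-≤ p (≤-trans q pred[n]≤n)

      forest′ : ∀ x S → S ⊆ A → Mono (glue c′) x S → edges g S ≤ pred (card S)
      forest′ true S S⊆A m = subst₂ (λ e k → e ≤ pred k)
        (sym (trans edges-S (trans (cong (edges g S₁ + edges g S₂ +_) (no-cross S S⊆A m)) (+-identityʳ _))))
        (sym card-S) (pred-+ {c₁ = card S₁} {card S₂} fo₁ fo₂)
        where open Sets S S⊆A m
      forest′ false S S⊆A m = subst₂ (λ e k → e ≤ pred k) (sym edges-S) (sym card-S) (bound (card S₁) refl)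
        where
        open Sets S S⊆A m
        cross≤ : cross ≤ ∑ S₂ (λ u → deg g u F)
        cross≤ = ∑-mono S₂ (λ u _ → ∑-⊆ _ (Mono-F S₁⊆W m₁))
        m₂r : Mono c′ false (S₂ ⊹ r)
        m₂r u p with ⊹-inv p
        ... | inj₁ q = m₂ u q
        ... | inj₂ refl = c′r
        fo₂r : edges g S₂ + ∑ S₂ (λ u → deg g u F) ≤ card S₂
        fo₂r = subst₂ (λ e k → e ≤ pred k) (edges′-⊹ (r∉ S₂⊆)) (card-⊹ (r∉ S₂⊆))
          (forest ok′ false (S₂ ⊹ r) (⊹-⊆ S₂⊆A′ (⊹-∈ _ r)) m₂r)
        bound : ∀ k → card S₁ ≡ k → edges g S₁ + edges g S₂ + cross ≤ pred (card S₁ + card S₂)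
        bound zero eq = subst₂ (λ e k → e ≤ pred (k + card S₂))
          (sym (trans (cong₂ (λ x y → x + edges g S₂ + y) (edges-card-0 g eq) (∑-0 S₂ (λ u _ → ∑-card-0 eq _))) (+-identityʳ _)))
          (sym eq) fo₂
        bound (suc k) eq = begin
          edges g S₁ + edges g S₂ + cross
            ≡⟨ +-assoc (edges g S₁) _ _ ⟩
          edges g S₁ + (edges g S₂ + cross)
            ≤⟨ +-mono-≤ fo₁ (≤-trans (+-monoʳ-≤ (edges g S₂) cross≤) fo₂r) ⟩
          pred (card S₁) + card S₂
            ≡⟨ cong (λ x → pred x + card S₂) eq ⟩
          k + card S₂
            ≡⟨ cong (λ x → pred (x + card S₂)) eq ⟨
          pred (card S₁ + card S₂) ∎
          where open ≤-Reasoning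

      small′ : ∀ S → S ⊆ A → Mono (glue c′) true S → card S ≤ suc (edges g S) → weight w S ≤ K
      small′ S S⊆A m p = subst (_≤ K) (sym (∑-part (part-∩∖ S W) _)) (bound (card S₁) (card S₂) refl refl)
        where
        open Sets S S⊆A m
        p′ : card S₁ + card S₂ ≤ suc (edges g S₁ + edges g S₂)
        p′ = subst₂ _≤_ card-S (cong suc (trans edges-S (trans (cong (edges g S₁ + edges g S₂ +_) (no-cross S S⊆A m)) (+-identityʳ _)))) p
        bound : ∀ k₁ k₂ → card S₁ ≡ k₁ → card S₂ ≡ k₂ → weight w S₁ + weight w S₂ ≤ K
        bound zero k₂ eq₁ eq₂ = subst (λ x → x + weight w S₂ ≤ K) (sym (∑-card-0 eq₁ _))
          (≤-trans (∑-mono S₂ (λ u q → s≤s (≤-trans (m≤m+n (w u) _) (≤-reflexive (sym (w′-≢ (∈-≢ q (r∉ S₂⊆))))))))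
            (small ok′ S₂ S₂⊆A′ m₂ (subst₂ (λ x y → x + card S₂ ≤ suc y) eq₁
              (trans (cong (_+ edges g S₂) (edges-card-0 g eq₁)) (sym (edges′-≢ (r∉ S₂⊆)))) p′)))
        bound (suc k₁) zero eq₁ eq₂ = subst (_≤ K) (sym (trans (cong (weight w S₁ +_) (∑-card-0 eq₂ _)) (+-identityʳ _)))
          (small okW S₁ S₁⊆W m₁ (subst₂ (λ x y → x ≤ suc y)
            (trans (cong (card S₁ +_) eq₂) (+-identityʳ _))
            (trans (cong (edges g S₁ +_) (edges-card-0 g eq₂)) (+-identityʳ _)) p′))
        -- Without edges across, a connected set cannot meet both sides: the edges of two nonempty
        -- forests fall short of the vertices by at least two.
        bound (suc k₁) (suc k₂) eq₁ eq₂ = ⊥-elim (two-trees k₁ k₂ (edges g S₁) (edges g S₂)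
          (subst₂ (λ x y → x + y ≤ suc (edges g S₁ + edges g S₂)) eq₁ eq₂ p′)
          (subst (λ x → edges g S₁ ≤ pred x) eq₁ fo₁) (subst (λ x → edges g S₂ ≤ pred x) eq₂ fo₂))

    -- A vertex that becomes forced loses at most `b`, since no cost exceeds `b`.
    P′ : ∀ {S} → S ⊆ A ∖ W → P w S ≤ P w′ S + b * ∑ S (λ u → 1 ⊓ deg g u M)
    P′ {S} S⊆ = subst (P w S ≤_) (trans (∑-+ S _ _) (cong (P w′ S +_) (∑-* S b _)))
      (∑-mono S (λ u p → worth-≤ w w′ u (bound u p)))
      where
      bound : ∀ u → u ∈ S → cost (w′ u) ≤ cost (w u) + b * (1 ⊓ deg g u M)
      bound u p rewrite w′-≢ (∈-≢ p (r∉ S⊆)) with deg g u M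
      ... | zero = ≤-reflexive (trans (cong cost (trans (cong (w u +_) (*-zeroʳ K)) (+-identityʳ _)))
                     (sym (trans (cong (cost (w u) +_) (*-zeroʳ b)) (+-identityʳ _))))
      ... | suc _ = ≤-trans (cost≤b _) (≤-trans (≤-reflexive (sym (*-identityʳ b))) (m≤n+m (b * 1) _))

    module Potentials (W″ : VSet n) (W″⊆ : W″ ⊆ A ∖ W) where
      U : VSet n
      U = W ∪ W″

      part-U : Part U W W″
      part-U = part-∪ disjoint
        where
        disjoint : ∀ u → u ∈ W → u ∉ W″
        disjoint u p with ∈-or-∉ W″ u
        ... | inj₁ q = ⊥-elim (∈∉-⊥ p (∖-∉ {S = A} (W″⊆ u q)))
        ... | inj₂ q = q

      α dM dF : ℕ
      α = ∑ W″ (λ u → 1 ⊓ deg g u M)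
      dM = ∑ W″ (λ u → deg g u M)
      dF = ∑ W″ (λ u → deg g u F)

      P-U : P w U ≡ P w W + P w W″
      P-U = ∑-part part-U _

      Q-U : Q g U ≡ b * (edges g W + edges g W″ + (dM + dF))
      Q-U = cong (b *_) (trans (edges-part g part-U) (cong (edges g W + edges g W″ +_)
        (trans (∑-cong W″ (λ u _ → deg-split g u W c)) (∑-+ W″ _ _))))

      α≤dM : α ≤ dM
      α≤dM = ∑-mono W″ (λ u _ → m⊓n≤n 1 _)

      -- The low set of the contracted graph has potential at most -2 including the `b - 1` of `r`,
      -- so the rest brings at most `-(b + 1)`. The worth regained by a vertex that is no longer
      -- forced is at most `b` and is paid by its edge to `M`.
      drop-with-r : P w′ W″ + worth w′ r + 2 ≤ b * (edges g W″ + dF) → Drop g w (suc b) U W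
      drop-with-r h = subst₂ (λ x y → x + suc b + Q g W ≤ P w W + y) (sym P-U) (sym Q-U)
        (arith (P w W) (P w W″) (P w′ W″) (worth w′ r) b (edges g W) (edges g W″) α dM dF (P′ W″⊆) h
          (trans (cong (λ x → worth w′ r + suc x) (sym (trans (cong cost w′-r) (cost-top K ≤-refl)))) (worth-eq w′ r)) α≤dM)
        where
        arith : ∀ pW pW″ p′ pr b eW e″ α dM dF → pW″ ≤ p′ + b * α → p′ + pr + 2 ≤ b * (e″ + dF) →
          pr + suc b ≡ 2 * b → α ≤ dM → pW + pW″ + suc b + b * eW ≤ pW + b * (eW + e″ + (dM + dF))
        arith pW pW″ p′ pr b eW e″ α dM dF h₁ h₂ h₃ h₄ =
          ≤-by 0 (h₁ ⊕ h₂ ⊕ ≤-reflexive (sym h₃) ⊕ scale b h₄)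
            (solve (pW ∷ pW″ ∷ p′ ∷ pr ∷ b ∷ eW ∷ e″ ∷ α ∷ dM ∷ dF ∷ []))

      -- Each vertex that was forced pays with one edge for the worth it regains; `k` counts edges
      -- to `W` beyond these, each of which lowers the potential by a further `b`.
      drop-without-r : ∀ k → P w′ W″ + 2 ≤ b * edges g W″ → α + k ≤ dM + dF → Drop g w (2 + b * k) U W
      drop-without-r k h₁ h₂ = subst₂ (λ x y → x + (2 + b * k) + Q g W ≤ P w W + y) (sym P-U) (sym Q-U)
        (arith (P w W) (P w W″) (P w′ W″) b (edges g W) (edges g W″) α dM dF k (P′ W″⊆) h₁ h₂)
        where
        arith : ∀ pW pW″ p′ b eW e″ α dM dF k → pW″ ≤ p′ + b * α → p′ + 2 ≤ b * e″ →
          α + k ≤ dM + dF → pW + pW″ + (2 + b * k) + b * eW ≤ pW + b * (eW + e″ + (dM + dF))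
        arith pW pW″ p′ b eW e″ α dM dF k h₁ h₂ h₃ =
          ≤-by 0 (h₁ ⊕ h₂ ⊕ scale b h₃) (solve (pW ∷ pW″ ∷ p′ ∷ b ∷ eW ∷ e″ ∷ α ∷ dM ∷ dF ∷ k ∷ []))

      Clean : Set
      Clean = ∀ u → u ∈ U → u ∉ W → deg g u F ≡ 0 × deg g u W ≤ 1

      -- Without a surplus edge, every edge from `W″` to `W` is the single edge that a forced vertex
      -- has to `M`.
      clean : dM + dF ≤ α → Clean
      clean h u p u∉W with ∪-inv p
      ... | inj₁ q = ⊥-elim (∈∉-⊥ q u∉W)
      ... | inj₂ q = dF≡0 , subst (_≤ 1) (sym (trans (deg-split g u W c) (trans (cong (deg g u M +_) dF≡0) (+-identityʳ _)))) dM≤1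
        where
        dF≡0 : deg g u F ≡ 0
        dF≡0 = ∑-≡0 {S = W″} (n≤0⇒n≡0 (+-cancelˡ-≤ dM dF 0 (≤-trans h (≤-trans α≤dM (≤-reflexive (sym (+-identityʳ dM))))))) u q
        dM≤1 : deg g u M ≤ 1
        dM≤1 with deg g u M ≤? 1
        ... | yes le = le
        ... | no gt = ⊥-elim (<-irrefl refl (≤-trans (subst (_≤ dM) (+-comm α 1)
          (∑-mono-at W″ 1 (λ v _ → m⊓n≤n 1 (deg g v M)) q
            (≤-trans (+-monoˡ-≤ 1 (m⊓n≤m 1 (deg g u M))) (≰⇒> gt)))) (≤-trans (m≤m+n dM dF) h)))

  record Enlargement (g : Graph n) (w : Weight n) (A W c : VSet n) : Set where
    field
      U : VSet n
      W⊆U : W ⊆ U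
      U⊆A : U ⊆ A
      drop : Drop g w 2 U W
      dichotomy : Drop g w (suc b) U W ⊎ (∀ u → u ∈ U → u ∉ W → deg g u (W ∖ c) ≡ 0 × deg g u W ≤ 1)

  Drop-weaken : (g : Graph n) (w : Weight n) {k l : ℕ} {U W : VSet n} → l ≤ k → Drop g w k U W → Drop g w l U W
  Drop-weaken g w {U = U} {W} l≤k = ≤-trans (+-monoˡ-≤ (Q g W) (+-monoʳ-≤ (P w U) l≤k))

  -- As `c` does not extend to `A`, the contracted graph is uncolourable, and `2 ≤ card W` makes it
  -- smaller; undoing the contraction in its low subset gives `U`. Only extensions of the given `c`
  -- are to be excluded, which matters later in a graph with an additional edge.
  enlarge : {g : Graph n} {w : Weight n} {A W c : VSet n} → Extremal n (card A) → W ⊆ A → 2 ≤ card W → Ok K g w W c →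
            (∀ c′ → (∀ u → u ∈ W → c′ u ≡ c u) → ¬ Ok K g w A c′) → Enlargement g w A W c
  enlarge {n = n} {g} {w} {A} {W} {c} ih W⊆A 2≤W okW noext = record
    { U = U ; W⊆U = ∪-⊆ˡ ; U⊆A = U⊆A ; drop = drop ; dichotomy = dichotomy }
    where
    r = proj₁ (card-∈ W (≤-trans (s≤s z≤n) 2≤W))
    r∈W = proj₂ (card-∈ W (≤-trans (s≤s z≤n) 2≤W))
    open Contract g w A W c r W⊆A r∈W okW
    card-A′ : card A′ < card A
    card-A′ = subst₂ _≤_ (cong suc (sym (card-⊹ (r∉ ⊆-refl)))) (sym card-A) (+-monoˡ-≤ (card (A ∖ W)) 2≤W)
      where
      card-A : card A ≡ card W + card (A ∖ W)
      card-A = ∑-part (part-⊆ W⊆A) _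
    found = ih card-A′ (λ (c′ , ok) → noext (glue c′) (λ u → glue-in c′) (glue-ok ok))
    U′ : VSet n
    U′ = proj₁ found
    U′⊆A′ : U′ ⊆ A′
    U′⊆A′ = proj₁ (proj₂ found)
    low : P w′ U′ + 2 ≤ Q g′ U′
    low = proj₂ (proj₂ (proj₂ found))
    W″ : VSet n
    W″ = U′ − r
    W″⊆ : W″ ⊆ A ∖ W
    W″⊆ = ⊹-⊆-inv U′⊆A′
    open Potentials W″ W″⊆
    U⊆A : U ⊆ A
    U⊆A u p with ∪-inv p
    ... | inj₁ q = W⊆A u q
    ... | inj₂ q = ∖-⊆ u (W″⊆ u q)
    both : Drop g w (suc b) U W ⊎ (Drop g w 2 U W × Clean)
    both with ∈-or-∉ U′ r
    ... | inj₁ r∈U′ = inj₁ (drop-with-r (subst₂ (λ x y → x + 2 ≤ b * y) (∑-− r∈U′ _)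
      (trans (edges-≗ g′ (⊹-− U′ r) (⊹-⊆ −-⊆ r∈U′)) (edges′-⊹ (−-∉ r))) low))
    ... | inj₂ r∉U′ with suc α ≤? dM + dF
    ...   | yes p = inj₁ (Drop-weaken g w {U = U} (≤-trans (n≤1+n _) (≤-reflexive (cong (2 +_) (sym (*-identityʳ b)))))
      (drop-without-r 1 low″ (subst (_≤ dM + dF) (+-comm 1 α) p)))
      where
      low″ : P w′ W″ + 2 ≤ b * edges g W″
      low″ = subst₂ (λ x y → x + 2 ≤ b * y) (∑-≗ _ (⊆-− ⊆-refl r∉U′) −-⊆)
        (trans (edges-≗ g′ (⊆-− ⊆-refl r∉U′) −-⊆) (edges′-≢ (−-∉ r))) low
    ...   | no p = inj₂ (subst (λ k → Drop g w (2 + k) U W) (*-zeroʳ b)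
        (drop-without-r 0 low″ (≤-trans (≤-reflexive (+-identityʳ α)) (≤-trans α≤dM (m≤m+n dM dF)))) ,
      clean (s≤s⁻¹ (≰⇒> p)))
      where
      low″ : P w′ W″ + 2 ≤ b * edges g W″
      low″ = subst₂ (λ x y → x + 2 ≤ b * y) (∑-≗ _ (⊆-− ⊆-refl r∉U′) −-⊆)
        (trans (edges-≗ g′ (⊆-− ⊆-refl r∉U′) −-⊆) (edges′-≢ (−-∉ r))) low
    drop : Drop g w 2 U W
    drop with both
    ... | inj₁ p = Drop-weaken g w {U = U} (≤-trans (≤-trans (n≤1+n 2) 3≤b) (n≤1+n b)) p
    ... | inj₂ (p , _) = p
    dichotomy : Drop g w (suc b) U W ⊎ Clean
    dichotomy with both
    ... | inj₁ p = inj₁ p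
    ... | inj₂ (_ , p) = inj₂ p

-- Minimal uncolourable sets

module Minimality (Π : Potential) where
  open WithPotential Π

  record Minimal (g : Graph n) (w : Weight n) (A : VSet n) : Set where
    field
      nc : ¬ Colorable K g w A
      del : ∀ u → u ∈ A → Colorable K g w (A − u)
  open Minimal public

  P-≗ : (w : Weight n) {S T : VSet n} → S ⊆ T → T ⊆ S → P w S ≡ P w T
  P-≗ w = ∑-≗ (worth w)

  Q-≗ : (g : Graph n) {S T : VSet n} → S ⊆ T → T ⊆ S → Q g S ≡ Q g T
  Q-≗ g p q = cong (b *_) (edges-≗ g p q)

  P-⊹ : (w : Weight n) {S : VSet n} {v : Fin n} → v ∉ S → P w (S ⊹ v) ≡ P w S + worth w v
  P-⊹ w v∉S = ∑-⊹ v∉S (worth w)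

  Q-⊹ : (g : Graph n) {S : VSet n} {v : Fin n} → v ∉ S → Q g (S ⊹ v) ≡ Q g S + b * deg g v S
  Q-⊹ g {S} {v} v∉S = trans (cong (b *_) (edges-⊹ g v∉S)) (*-distribˡ-+ b (edges g S) (deg g v S))

  edges-card-1 : (g : Graph n) {S : VSet n} → card S ≤ 1 → edges g S ≡ 0
  edges-card-1 g {S} p with card S in eq
  ... | zero = edges-card-0 g eq
  ... | suc zero = let v , v∈S = card-∈ S (≤-reflexive (sym eq))
                       eq′ = suc-injective (trans (sym (card-− v∈S)) eq)
                   in trans (edges-− g v∈S) (cong₂ _+_ (edges-card-0 g eq′) (∑-card-0 eq′ _))
  edges-card-1 g (s≤s ()) | suc (suc _)

  all-F : {g : Graph n} {w : Weight n} {A : VSet n} → card A ≤ 1 → Ok K g w A (λ _ → false)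
  all-F {g = g} p = record
    { forest = λ _ S S⊆A _ → ≤-trans (≤-reflexive (edges-card-1 g (≤-trans (∑-⊆ _ S⊆A) p))) z≤n
    ; small = λ S _ m _ → ≤-trans (≤-reflexive (∑-0 S (λ u q → contradiction (m u q) λ ()))) z≤n }

  nc-card : {g : Graph n} {w : Weight n} {A : VSet n} → ¬ Colorable K g w A → 2 ≤ card A
  nc-card {g = g} {A = A} ¬col with 2 ≤? card A
  ... | yes p = p
  ... | no p = ⊥-elim (¬col (_ , all-F (s≤s⁻¹ (≰⇒> p))))

  worth-≥ : (w : Weight n) (u : Fin n) → 2 ≤ worth w u
  worth-≥ w u = arith (worth w u) (cost (w u)) b (worth-eq w u) (cost≤b (w u)) 3≤b
    where
    arith : ∀ x y b → x + suc y ≡ 2 * b → y ≤ b → 3 ≤ b → 2 ≤ x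
    arith x y b h₁ h₂ h₃ = ≤-by 0 (≤-reflexive (sym h₁) ⊕ h₂ ⊕ h₃) (solve (x ∷ y ∷ b ∷ []))

  Drop-strict : {g : Graph n} {w : Weight n} {U W : VSet n} → W ⊆ U → Drop g w 2 U W → ∃[ u ] u ∈ U × u ∉ W
  Drop-strict {g = g} {w} {U} {W} W⊆U drop with ⊆-or-∃ U W
  ... | inj₂ p = p
  ... | inj₁ U⊆W = ⊥-elim (arith (P w W) (Q g W)
    (subst₂ (λ x y → x + 2 + Q g W ≤ P w W + y) (P-≗ w U⊆W W⊆U) (Q-≗ g U⊆W W⊆U) drop))
    where
    arith : ∀ p q → p + 2 + q ≤ p + q → ⊥
    arith p q h = ⊥-by 1 h (solve (p ∷ q ∷ []))

  card-< : {W U : VSet n} {u : Fin n} → W ⊆ U → u ∈ U → u ∉ W → suc (card W) ≤ card U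
  card-< {W = W} {U} W⊆U u∈U u∉W = subst (_≤ card U) (+-comm (card W) 1) (∑-∉ W⊆U u∈U u∉W (λ _ → 1))

  -- `1 ⊓ mult g v u` ignores multiplicity: a neighbour is raised once, however many parallel edges
  -- there are.
  bump : Graph n → Fin n → ℕ → Weight n → Weight n
  bump g v k w u = w u + (1 ⊓ mult g v u) * k

  bump-adj : {g : Graph n} {w : Weight n} {v : Fin n} {k : ℕ} (u : Fin n) → 1 ≤ mult g v u → bump g v k w u ≡ w u + k
  bump-adj {w = w} {k = k} u p = cong (w u +_) (trans (cong (_* k) (m≤n⇒m⊓n≡m p)) (*-identityˡ k))

  bump-nonadj : {g : Graph n} {w : Weight n} {v : Fin n} {k : ℕ} (u : Fin n) → mult g v u ≡ 0 → bump g v k w u ≡ w u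
  bump-nonadj {w = w} {k = k} u p = trans (cong (λ x → w u + (1 ⊓ x) * k) p) (+-identityʳ _)

  ⊓-cost : ∀ (x k : ℕ) → cost ((1 ⊓ x) * k) ≤ cost k * (1 ⊓ x)
  ⊓-cost zero k = ≤-trans (≤-reflexive cost-0) z≤n
  ⊓-cost (suc x) k = ≤-reflexive (trans (cong cost (*-identityˡ k)) (sym (*-identityʳ (cost k))))

  bump-P : (g : Graph n) (w : Weight n) (v : Fin n) (k : ℕ) (S : VSet n) →
           P w S ≤ P (bump g v k w) S + cost k * ∑ S (λ u → 1 ⊓ mult g v u)
  bump-P g w v k S = subst (P w S ≤_) (trans (∑-+ S _ _) (cong (P (bump g v k w) S +_) (∑-* S (cost k) _)))
    (∑-mono S (λ u p → worth-≤ w (bump g v k w) u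
      (≤-trans (cost-sub (w u) _) (+-monoʳ-≤ (cost (w u)) (⊓-cost (mult g v u) k)))))

  ∑⊓≤deg : (g : Graph n) (v : Fin n) (S : VSet n) → ∑ S (λ u → 1 ⊓ mult g v u) ≤ deg g v S
  ∑⊓≤deg g v S = ∑-mono S (λ u _ → m⊓n≤n 1 (mult g v u))

  uncolorable-bump : {g : Graph n} {w : Weight n} {A : VSet n} {v : Fin n} → ¬ Colorable K g w A → v ∈ A →
                     deg g v A ≤ 3 → suc (w v) ≤ K → ¬ Colorable K g (bump g v (suc (w v)) w) (A − v)
  uncolorable-bump {g = g} {w} {A} {v} ¬col v∈A d≤3 wv≤K col = ¬col (Colorable-⊆ K (⊹-− A v)
    (add-vertex K col (−-∉ v) (≤-trans (∑-⊆ _ −-⊆) d≤3) wv≤K (λ u _ → m≤m+n _ _)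
      (λ u _ p → ≤-reflexive (sym (bump-adj {g = g} {w} {v} u p)))))

  bump-colorable : {g : Graph n} {w : Weight n} {W : VSet n} {v : Fin n} {k : ℕ} → deg g v W ≡ 0 → Colorable K g w W →
                   Colorable K g (bump g v k w) W
  bump-colorable {g = g} {w} {W} {v} d≡0 (c , ok) = c , Ok-weaken K ⊆-refl (λ _ _ → ≤-refl)
    (λ u p _ → ≤-reflexive (bump-nonadj {g = g} {w} {v} u (∑-≡0 d≡0 u p))) ok

  -- `high` says that the potential of `A` is at least `-τ`. A counterexample has `τ` equal to 1;
  -- larger values belong to sets that remain after deletions.
  module MinimalSet {g : Graph n} {w : Weight n} {A : VSet n} {τ : ℕ} (minimal : Minimal g w A)
                  (high : Q g A ≤ P w A + τ) (ih : Extremal n (card A)) where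

    color-proper : ∀ {W u} → W ⊆ A → u ∈ A → u ∉ W → Colorable K g w W
    color-proper W⊆A u∈A u∉W = Colorable-⊆ K (⊆-− W⊆A u∉W) (del minimal _ u∈A)

    grow : ∀ {W c} → W ⊆ A → 2 ≤ card W → Ok K g w W c → Enlargement g w A W c
    grow W⊆A 2≤W ok = enlarge ih W⊆A 2≤W ok (λ c′ _ ok′ → nc minimal (c′ , ok′))

    private
      gap-fuel : ∀ k {W u} → card A ≤ card W + k → W ⊆ A → u ∈ A → u ∉ W → 1 ≤ card W → Q g W + 2 ≤ P w W + τ
      gap-fuel zero {W} fuel W⊆A u∈A u∉W _ =
        ⊥-elim (<-irrefl refl (≤-trans (card-< W⊆A u∈A u∉W) (subst (card A ≤_) (+-identityʳ (card W)) fuel)))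
      gap-fuel (suc k) {W} fuel W⊆A u∈A u∉W 1≤W with 2 ≤? card W
      ... | no p = let v , v∈W = card-∈ W 1≤W in
        subst (λ x → x + 2 ≤ P w W + τ) (sym (trans (cong (b *_) (edges-card-1 g (s≤s⁻¹ (≰⇒> p)))) (*-zeroʳ b)))
          (≤-trans (worth-≥ w v) (≤-trans (∑-∈ v∈W (worth w)) (m≤m+n _ τ)))
      ... | yes p = finish (⊆-or-∃ A U)
        where
        open Enlargement (grow W⊆A p (proj₂ (color-proper W⊆A u∈A u∉W)))
        arith : ∀ pU qU pW qW τ → pU + 2 + qW ≤ pW + qU → qU ≤ pU + τ → qW + 2 ≤ pW + τ
        arith pU qU pW qW τ h₁ h₂ = ≤-by 0 (h₁ ⊕ h₂) (solve (pU ∷ qU ∷ pW ∷ qW ∷ τ ∷ []))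
        finish : A ⊆ U ⊎ ∃[ u ] u ∈ A × u ∉ U → Q g W + 2 ≤ P w W + τ
        finish (inj₁ A⊆U) = arith (P w U) (Q g U) (P w W) (Q g W) τ drop
          (subst₂ (λ x y → x ≤ y + τ) (Q-≗ g A⊆U U⊆A) (P-≗ w A⊆U U⊆A) high)
        finish (inj₂ (u′ , p , q)) = let _ , r , s = Drop-strict {g = g} W⊆U drop in
          arith (P w U) (Q g U) (P w W) (Q g W) τ drop
            (≤-trans (m≤m+n (Q g U) 2) (gap-fuel k
              (≤-trans fuel (≤-trans (≤-reflexive (+-suc (card W) k)) (+-monoˡ-≤ k (card-< W⊆U r s))))
              U⊆A p q (≤-trans 1≤W (∑-⊆ _ W⊆U))))

    -- Every enlargement strictly grows and loses at least 2, so a chain of them leads from `W` to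
    -- `A`, where `high` applies. The fuel bounds the number of vertices still missing.
    gap : ∀ {W u} → W ⊆ A → u ∈ A → u ∉ W → 1 ≤ card W → Q g W + 2 ≤ P w W + τ
    gap {W} = gap-fuel (card A) (m≤n+m (card A) (card W))

    floor : ∀ {W} → W ⊆ A → 1 ≤ card W → Q g W ≤ P w W + τ
    floor {W} W⊆A 1≤W with ⊆-or-∃ A W
    ... | inj₁ A⊆W = subst₂ (λ x y → x ≤ y + τ) (Q-≗ g A⊆W W⊆A) (P-≗ w A⊆W W⊆A) high
    ... | inj₂ (_ , p , q) = ≤-trans (m≤m+n _ 2) (gap W⊆A p q 1≤W)

    private
      big : ∀ {U W} → Drop g w (suc b) U W → Q g U ≤ P w U + τ → Q g W + suc b ≤ P w W + τ
      big {U} {W} = arith (P w U) (Q g U) (P w W) (Q g W) b τ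
        where
        arith : ∀ pU qU pW qW b τ → pU + suc b + qW ≤ pW + qU → qU ≤ pU + τ → qW + suc b ≤ pW + τ
        arith pU qU pW qW b τ h₁ h₂ = ≤-by 0 (h₁ ⊕ h₂) (solve (pU ∷ qU ∷ pW ∷ qW ∷ b ∷ τ ∷ []))

      descend : ∀ {U W} → Drop g w 2 U W → Q g U + suc b ≤ P w U + τ → Q g W + suc b ≤ P w W + τ
      descend {U} {W} = arith (P w U) (Q g U) (P w W) (Q g W) b τ
        where
        arith : ∀ pU qU pW qW b τ → pU + 2 + qW ≤ pW + qU → qU + suc b ≤ pU + τ → qW + suc b ≤ pW + τ
        arith pU qU pW qW b τ h₁ h₂ = ≤-by 2 (h₁ ⊕ h₂) (solve (pU ∷ qU ∷ pW ∷ qW ∷ b ∷ τ ∷ []))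

      step-fuel : ∀ {k} {W U : VSet n} → card A ≤ card W + suc k → suc (card W) ≤ card U → card A ≤ card U + k
      step-fuel {k} {W} fuel lt = ≤-trans fuel (≤-trans (≤-reflexive (+-suc (card W) k)) (+-monoˡ-≤ k lt))

      pendant-fuel : ∀ k {W v} → card A ≤ card W + k → W ⊆ A → v ∈ A → v ∉ W → 1 ≤ card W → deg g v W ≤ 1 →
                     2 ≤ deg g v A → Q g (W ⊹ v) + suc b ≤ P w (W ⊹ v) + τ
      pendant-fuel zero {W} fuel W⊆A v∈A v∉W _ _ _ =
        ⊥-elim (<-irrefl refl (≤-trans (card-< W⊆A v∈A v∉W) (subst (card A ≤_) (+-identityʳ (card W)) fuel)))
      pendant-fuel (suc k) {W} {v} fuel W⊆A v∈A v∉W 1≤W d≤1 2≤d = finish dichotomy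
        where
        c₀ = proj₁ (color-proper W⊆A v∈A v∉W)
        c = recolor c₀ v false
        Wv⊆A : W ⊹ v ⊆ A
        Wv⊆A = ⊹-⊆ W⊆A v∈A
        open Enlargement (grow Wv⊆A (≤-trans (s≤s 1≤W) (≤-reflexive (sym (card-⊹ v∉W))))
          (add-leaf-F K (proj₂ (color-proper W⊆A v∈A v∉W)) v∉W (≤-trans (∑-⊆ _ ∖-⊆) d≤1)))
        finish : Drop g w (suc b) U (W ⊹ v) ⊎ (∀ u → u ∈ U → u ∉ W ⊹ v → deg g u ((W ⊹ v) ∖ c) ≡ 0 × deg g u (W ⊹ v) ≤ 1) →
                 Q g (W ⊹ v) + suc b ≤ P w (W ⊹ v) + τ
        finish (inj₁ p) = big {U} p (floor U⊆A (≤-trans 1≤W (∑-⊆ _ (⊆-trans ⊹-⊇ W⊆U))))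
        -- `v` lies in the `F`-part of the colouring, so in the clean case the new vertices have no
        -- edge to `v`; hence `W₂` still sends at most one edge to `v`, and the argument repeats.
        finish (inj₂ cl) = descend {U} drop (subst₂ (λ x y → x + suc b ≤ y + τ)
            (Q-≗ g W₂v⊆U (⊹-− U v)) (P-≗ w W₂v⊆U (⊹-− U v))
            (pendant-fuel k (step-fuel {k} {W} {W₂} fuel (card-< W⊆W₂ u∈W₂ (∉-⊆ ⊹-⊇ u∉Wv)))
              (⊆-trans −-⊆ U⊆A) v∈A (−-∉ v) (≤-trans 1≤W (∑-⊆ _ W⊆W₂)) d₂≤1 2≤d))
          where
          W₂ = U − v
          W⊆W₂ : W ⊆ W₂
          W⊆W₂ = ⊆-− (⊆-trans ⊹-⊇ W⊆U) v∉W
          W₂v⊆U : W₂ ⊹ v ⊆ U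
          W₂v⊆U = ⊹-⊆ −-⊆ (W⊆U v (⊹-∈ W v))
          new = Drop-strict {g = g} W⊆U drop
          u∉Wv = proj₂ (proj₂ new)
          u∈W₂ = −-∈ (proj₁ (proj₂ new)) (≢-sym (∈-≢ (⊹-∈ W v) u∉Wv))
          isolated : ∀ u → u ∈ W₂ ∖ W → mult g v u ≡ 0
          isolated u p = trans (mult-sym g v u) (∑-≡0 (proj₁ (cl u (−-⊆ u (∖-⊆ u p))
            (⊹-∉ (∖-∉ {S = W₂} p) (−-≢ (∖-⊆ {S = W₂} u p))))) v
            (∖-∈ (⊹-∈ W v) (nonmem (recolor-≡ c₀ v false))))
          d₂≤1 : deg g v W₂ ≤ 1
          d₂≤1 = ≤-trans (≤-reflexive (trans (∑-part (part-∩∖ W₂ W) _)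
            (trans (cong (deg g v (W₂ ∩ W) +_) (∑-0 (W₂ ∖ W) isolated)) (+-identityʳ _))))
            (≤-trans (∑-⊆ _ (∩-⊆ʳ {S = W₂})) d≤1)

      doubled-fuel : ∀ k {W v} → card A ≤ card W + k → W ⊆ A → v ∈ A → v ∉ W → 2 ≤ card W → 2 ≤ deg g v W →
                     Q g W + suc b ≤ P w W + τ
      doubled-fuel zero {W} fuel W⊆A v∈A v∉W _ _ =
        ⊥-elim (<-irrefl refl (≤-trans (card-< W⊆A v∈A v∉W) (subst (card A ≤_) (+-identityʳ (card W)) fuel)))
      doubled-fuel (suc k) {W} {v} fuel W⊆A v∈A v∉W 2≤W 2≤d = finish dichotomy
        where
        c = proj₁ (color-proper W⊆A v∈A v∉W)
        open Enlargement (grow W⊆A 2≤W (proj₂ (color-proper W⊆A v∈A v∉W)))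
        finish : Drop g w (suc b) U W ⊎ (∀ u → u ∈ U → u ∉ W → deg g u (W ∖ c) ≡ 0 × deg g u W ≤ 1) →
                 Q g W + suc b ≤ P w W + τ
        finish (inj₁ p) = big {U} p (floor U⊆A (≤-trans (≤-trans (s≤s z≤n) 2≤W) (∑-⊆ _ W⊆U)))
        finish (inj₂ cl) with ∈-or-∉ U v
        ... | inj₁ v∈U = ⊥-elim (<-irrefl refl (≤-trans 2≤d (proj₂ (cl v v∈U v∉W))))
        ... | inj₂ v∉U = let _ , p , q = Drop-strict {g = g} W⊆U drop in
          descend {U} drop (doubled-fuel k (step-fuel {k} {W} {U} fuel (card-< W⊆U p q)) U⊆A v∈A v∉U
            (≤-trans 2≤W (∑-⊆ _ W⊆U)) (≤-trans 2≤d (∑-⊆ _ W⊆U)))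

    -- A colouring of W extends to W ⊹ v with v in F, so the contraction sees the other edges at v.
    pendant : ∀ {W v} → W ⊆ A → v ∈ A → v ∉ W → 1 ≤ card W → deg g v W ≤ 1 → 2 ≤ deg g v A →
              Q g (W ⊹ v) + suc b ≤ P w (W ⊹ v) + τ
    pendant {W} = pendant-fuel (card A) (m≤n+m (card A) (card W))

    -- A clean enlargement cannot swallow `v`, which has two edges into `W`; so `v` stays outside,
    -- and enlarging goes on until some step loses `b + 1`.
    doubled : ∀ {W v} → W ⊆ A → v ∈ A → v ∉ W → 2 ≤ card W → 2 ≤ deg g v W → Q g W + suc b ≤ P w W + τ
    doubled {W} = doubled-fuel (card A) (m≤n+m (card A) (card W))

    min-degree : ∀ {v} → v ∈ A → 2 ≤ deg g v A
    min-degree {v} v∈A with 2 ≤? deg g v A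
    ... | yes p = p
    ... | no p = let c , ok = del minimal v v∈A in
      ⊥-elim (nc minimal (Colorable-⊆ K (⊹-− A v)
        (_ , add-leaf-F K ok (−-∉ v) (≤-trans (∑-⊆ _ (⊆-trans ∖-⊆ −-⊆)) (s≤s⁻¹ (≰⇒> p))))))

    -- With two edges, either at most one goes to `F`, or both do and the vertex becomes a component
    -- of `M` by itself.
    min-degree-light : ∀ {v} → v ∈ A → suc (w v) ≤ K → 3 ≤ deg g v A
    min-degree-light {v} v∈A wv≤K with 3 ≤? deg g v A
    ... | yes p = p
    ... | no p = ⊥-elim (nc minimal (Colorable-⊆ K (⊹-− A v) extended))
      where
      c = proj₁ (del minimal v v∈A)
      ok = proj₂ (del minimal v v∈A)
      d≤2 : deg g v ((A − v) ∩ c) + deg g v ((A − v) ∖ c) ≤ 2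
      d≤2 = subst (_≤ 2) (deg-split g v (A − v) c) (≤-trans (∑-⊆ _ −-⊆) (s≤s⁻¹ (≰⇒> p)))
      extended : Colorable K g w ((A − v) ⊹ v)
      extended with deg g v ((A − v) ∖ c) ≤? 1
      ... | yes q = _ , add-leaf-F K ok (−-∉ v) q
      ... | no q = _ , add-M K ok (−-∉ v) (≤-trans (≤-reflexive dM≡0) z≤n) wv≤K (λ _ _ → ≤-refl)
        (λ u r s → ⊥-elim (<-irrefl refl (≤-trans s (≤-reflexive (∑-≡0 dM≡0 u r)))))
        where
        dM≡0 : deg g v ((A − v) ∩ c) ≡ 0
        dM≡0 = n≤0⇒n≡0 (+-cancelʳ-≤ 2 _ 0 (≤-trans (+-monoʳ-≤ _ (≰⇒> q)) d≤2))

    -- Charges are doubled to avoid halves; a forced vertex is worth `b - 1` and has at least two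
    -- edges.
    heavy-charge : ∀ {v} → v ∈ A → K ≤ w v → 2 * worth w v + 2 ≤ b * deg g v A
    heavy-charge {v} v∈A K≤w = ≤-trans
      (≤-reflexive (arith (worth w v) b (trans (cong (λ x → worth w v + suc x) (sym (cost-top (w v) K≤w))) (worth-eq w v))))
      (*-monoʳ-≤ b (min-degree v∈A))
      where
      arith : ∀ x b → x + suc b ≡ 2 * b → 2 * x + 2 ≡ b * 2
      arith x b h = +-cancelʳ-≡ (2 * b) _ _ (trans (eq₁ x b) (trans (cong (2 *_) h) (eq₂ b)))
        where
        eq₁ : ∀ x b → 2 * x + 2 + 2 * b ≡ 2 * (x + suc b)
        eq₁ = solve-∀
        eq₂ : ∀ b → 2 * (2 * b) ≡ b * 2 + 2 * b
        eq₂ = solve-∀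

    -- Otherwise the light vertex in `M` and the remaining one in `F` form a colouring.
    light-card : ∀ {v} → v ∈ A → suc (w v) ≤ K → 3 ≤ card A
    light-card {v} v∈A wv≤K with 3 ≤? card A
    ... | yes p = p
    ... | no p = ⊥-elim (nc minimal (Colorable-⊆ K (⊹-− A v) (_ , add-M K
      (all-F {g = g} {w} {A − v} (s≤s⁻¹ (subst (_≤ 2) (card-− v∈A) (s≤s⁻¹ (≰⇒> p)))))
      (−-∉ v) (≤-trans (≤-reflexive (∑-0 ((A − v) ∩ (λ _ → false)) (λ u q → ⊥-elim (absurd u q)))) z≤n) wv≤K (λ _ _ → ≤-refl)
      (λ u q → ⊥-elim (absurd u q)))))
      where
      absurd : ∀ u → u ∈ (A − v) ∩ (λ _ → false) → ⊥
      absurd u q with ∩-⊆ʳ {S = A − v} u q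
      ... | mem ()

  module Reduction {g : Graph n} {w : Weight n} {A : VSet n} (minimal : Minimal g w A)
                   (high : Q g A ≤ P w A + 1) (ih : Extremal n (card A)) where
    open MinimalSet {τ = 1} minimal high ih

    -- With no edge from `v` the weights on `W` are the old ones, and `W` is colourable. One edge
    -- contradicts `pendant`. Two edges contradict `doubled`, because two raises cost at most
    -- `suc b`.
    low-subset-degree : ∀ {v W} → v ∈ A → deg g v A ≡ 3 → 2 * cost (suc (w v)) ≤ suc b → W ⊆ A − v →
      ¬ Colorable K g (bump g v (suc (w v)) w) W → P (bump g v (suc (w v)) w) W + 2 ≤ Q g W → deg g v W ≡ 3
    low-subset-degree {v} {W} v∈A d≡3 2c≤ W⊆ ¬col low = go (deg g v W) refl
      where
      C = cost (suc (w v))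
      W⊆A = ⊆-trans W⊆ −-⊆
      v∉W : v ∉ W
      v∉W = ∉-⊆ W⊆ (−-∉ v)
      pW : ∀ {t} → deg g v W ≡ t → P w W ≤ P (bump g v (suc (w v)) w) W + C * t
      pW eq = ≤-trans (bump-P g w v (suc (w v)) W) (+-monoʳ-≤ _ (*-monoʳ-≤ C (≤-trans (∑⊓≤deg g v W) (≤-reflexive eq))))
      go : ∀ t → deg g v W ≡ t → t ≡ 3
      go 0 eq = ⊥-elim (¬col (bump-colorable {v = v} eq (color-proper W⊆A v∈A v∉W)))
      go 1 eq = ⊥-elim (arith (P w W) (P (bump g v (suc (w v)) w) W) (Q g W) (worth w v) (cost (w v)) C b
          (subst₂ (λ x y → x + suc b ≤ y + 1) (trans (Q-⊹ g v∉W) (cong (λ x → Q g W + b * x) eq)) (P-⊹ w v∉W)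
            (pendant W⊆A v∈A v∉W (≤-trans (s≤s z≤n) (nc-card ¬col)) (≤-reflexive eq) (≤-trans (s≤s (s≤s z≤n)) (≤-reflexive (sym d≡3)))))
          (pW eq) low (worth-eq w v) (cost-suc (w v)))
        where
        arith : ∀ p p⁺ q x c C b → q + b * 1 + suc b ≤ p + x + 1 → p ≤ p⁺ + C * 1 → p⁺ + 2 ≤ q →
                x + suc c ≡ 2 * b → C ≤ 2 + c → ⊥
        arith p p⁺ q x c C b h₁ h₂ h₃ h₄ h₅ = ⊥-by 0 (h₁ ⊕ h₂ ⊕ h₃ ⊕ ≤-reflexive h₄ ⊕ h₅)
          (solve (p ∷ p⁺ ∷ q ∷ x ∷ c ∷ C ∷ b ∷ []))
      go 2 eq = ⊥-elim (arith (P w W) (P (bump g v (suc (w v)) w) W) (Q g W) C b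
          (doubled W⊆A v∈A v∉W (nc-card ¬col) (≤-reflexive (sym eq))) (pW eq) low 2c≤)
        where
        arith : ∀ p p⁺ q C b → q + suc b ≤ p + 1 → p ≤ p⁺ + C * 2 → p⁺ + 2 ≤ q → 2 * C ≤ suc b → ⊥
        arith p p⁺ q C b h₁ h₂ h₃ h₄ = ⊥-by 0 (h₁ ⊕ h₂ ⊕ h₃ ⊕ h₄) (solve (p ∷ p⁺ ∷ q ∷ C ∷ b ∷ []))
      go 3 eq = refl
      go (suc (suc (suc (suc t)))) eq = ⊥-elim (<-irrefl refl (≤-trans (s≤s (s≤s (s≤s (s≤s z≤n))))
        (≤-trans (≤-reflexive (sym eq)) (≤-trans (∑-⊆ _ W⊆A) (≤-reflexive d≡3)))))

    -- Compares the potential of `W ⊹ v`, at least -1, with the raised potential of `W`, at most -2: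
    -- the price of the raises has to cover the difference made by `v` and its three edges. The sum
    -- counts distinct neighbours, so parallel edges make the inequality harder to satisfy.
    cubic-cost : ∀ {v} → v ∈ A → deg g v A ≡ 3 → suc (w v) ≤ K → 2 * cost (suc (w v)) ≤ suc b →
      ∃[ W ] W ⊆ A − v × deg g v W ≡ 3 × b + 2 + cost (w v) ≤ cost (suc (w v)) * ∑ W (λ u → 1 ⊓ mult g v u)
    cubic-cost {v} v∈A d≡3 wv≤K 2c≤ = W , W⊆ , d ,
      arith (P w W) (P (bump g v (suc (w v)) w) W) (Q g W) (worth w v) (cost (w v))
        (cost (suc (w v)) * ∑ W (λ u → 1 ⊓ mult g v u)) b
        (subst₂ (λ x y → x ≤ y + 1) (trans (Q-⊹ g v∉W) (cong (λ x → Q g W + b * x) d)) (P-⊹ w v∉W)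
          (floor (⊹-⊆ (⊆-trans W⊆ −-⊆) v∈A) (≤-trans (s≤s z≤n) (≤-reflexive (sym (card-⊹ v∉W))))))
        (bump-P g w v (suc (w v)) W) low (worth-eq w v)
      where
      found = ih (≤-reflexive (sym (card-− v∈A))) (uncolorable-bump (nc minimal) v∈A (≤-reflexive d≡3) wv≤K)
      W = proj₁ found
      W⊆ = proj₁ (proj₂ found)
      low = proj₂ (proj₂ (proj₂ found))
      d = low-subset-degree v∈A d≡3 2c≤ W⊆ (proj₁ (proj₂ (proj₂ found))) low
      v∉W : v ∉ W
      v∉W = ∉-⊆ W⊆ (−-∉ v)
      arith : ∀ p p⁺ q x c Cn b → q + b * 3 ≤ p + x + 1 → p ≤ p⁺ + Cn → p⁺ + 2 ≤ q →
              x + suc c ≡ 2 * b → b + 2 + c ≤ Cn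
      arith p p⁺ q x c Cn b h₁ h₂ h₃ h₄ = ≤-by 0 (h₁ ⊕ h₂ ⊕ h₃ ⊕ ≤-reflexive h₄) (solve (p ∷ p⁺ ∷ q ∷ x ∷ c ∷ Cn ∷ b ∷ []))

  Refutes : Set
  Refutes = ∀ {n} {g : Graph n} {w : Weight n} {A : VSet n} → Minimal g w A → Q g A ≤ P w A + 1 → Extremal n (card A) → ⊥

  -- Vertices are deleted while the set stays uncolourable; what remains in the end is minimal, and
  -- `refute` is needed only if its potential is at least -1.
  extremal : Refutes → ∀ n N → Extremal n N
  extremal refute n (suc N) {g} {w} {A} lt ¬col
    with any? (λ u → (A u Bool.≟ true) ×-dec ¬? (colorable? K g w (A − u)))
  ... | yes (u , p , ¬col′) =
    let U , U⊆ , rest = extremal refute n N (≤-trans (≤-reflexive (sym (card-− (mem p)))) (s≤s⁻¹ lt)) ¬col′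
    in U , ⊆-trans U⊆ −-⊆ , rest
  ... | no none with P w A + 2 ≤? Q g A
  ...   | yes p = A , ⊆-refl , ¬col , p
  ...   | no p = ⊥-elim (refute minimal
      (s≤s⁻¹ (subst (suc (Q g A) ≤_) (+-suc (P w A) 1) (≰⇒> p)))
      (λ lt′ → extremal refute n N (≤-trans lt′ (s≤s⁻¹ lt))))
    where
    minimal : Minimal g w A
    minimal = record { nc = ¬col ; del = λ u u∈A → decidable-stable (colorable? K g w (A − u)) (λ ¬c → none (u , inside u∈A , ¬c)) }

-- Even `D`

module Even (t : ℕ) where

  half : ℕ
  half = suc t

  b₀ : ℕ
  b₀ = 4 * half + 1

  -- `b₀` is one less than twice the maximal count, so the cost has to fall behind `2 * x` by one
  -- somewhere. Just above `half` this does no harm to subadditivity: two such weights together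
  -- already cost more than `b₀`.
  cost₀ : ℕ → ℕ
  cost₀ x with x ≤? half
  ... | yes _ = 2 * x
  ... | no _ = (2 * x ∸ 1) ⊓ b₀

  cost-low : ∀ {x} → x ≤ half → cost₀ x ≡ 2 * x
  cost-low {x} p with x ≤? half
  ... | yes _ = refl
  ... | no q = ⊥-elim (q p)

  cost-high : ∀ {x} → half < x → cost₀ x ≡ (2 * x ∸ 1) ⊓ b₀
  cost-high {x} p with x ≤? half
  ... | yes q = ⊥-elim (<-irrefl refl (≤-trans p q))
  ... | no _ = refl

  2half≤b : 2 * half + 1 ≤ b₀
  2half≤b = +-monoˡ-≤ 1 (*-monoˡ-≤ half {2} {4} (s≤s (s≤s z≤n)))

  2half≤ : ∀ {x} → half < x → 2 * half + 1 ≤ 2 * x ∸ 1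
  2half≤ {suc x} (s≤s p) = ≤-trans (+-monoˡ-≤ 1 (*-monoʳ-≤ 2 p)) (≤-reflexive (eq x))
    where
    eq : ∀ x → 2 * x + 1 ≡ x + suc (x + 0)
    eq = solve-∀

  cost-high-≥ : ∀ {x} → half < x → 2 * half + 1 ≤ cost₀ x
  cost-high-≥ p = ≤-trans (⊓-glb (2half≤ p) 2half≤b) (≤-reflexive (sym (cost-high p)))

  cost-≤b : ∀ x → cost₀ x ≤ b₀
  cost-≤b x with x ≤? half
  ... | yes p = ≤-trans (*-mono-≤ {2} {4} (s≤s (s≤s z≤n)) p) (m≤m+n _ 1)
  ... | no _ = m⊓n≤n _ _

  cost-≤2x : ∀ x → cost₀ x ≤ 2 * x
  cost-≤2x x with x ≤? half
  ... | yes p = ≤-refl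
  ... | no _ = ≤-trans (m⊓n≤m _ _) (m∸n≤m (2 * x) 1)

  sub : ∀ x y → cost₀ (x + y) ≤ cost₀ x + cost₀ y
  sub x y = go (x ≤? half) (y ≤? half)
    where
    mixed : ∀ x y → x ≤ half → half < y → cost₀ (x + y) ≤ cost₀ x + cost₀ y
    mixed x y p q = subst₂ _≤_ (sym (cost-high (≤-trans q (m≤n+m y x))))
      (cong₂ _+_ (sym (cost-low p)) (sym (cost-high q)))
      (≤-trans (⊓-monoˡ-≤ b₀ (≤-reflexive (trans (cong (_∸ 1) (*-distribˡ-+ 2 x y)) (+-∸-assoc (2 * x) (≤-trans (≤-trans (s≤s z≤n) q) (m≤m+n y (y + 0)))))))
        (≤-trans (⊓-monoʳ-≤ (2 * x + (2 * y ∸ 1)) (m≤n+m b₀ (2 * x)))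
          (≤-reflexive (sym (+-distribˡ-⊓ (2 * x) (2 * y ∸ 1) b₀)))))
    go : Dec (x ≤ half) → Dec (y ≤ half) → cost₀ (x + y) ≤ cost₀ x + cost₀ y
    go (yes p) (yes q) = ≤-trans (cost-≤2x (x + y)) (≤-reflexive (trans (*-distribˡ-+ 2 x y) (cong₂ _+_ (sym (cost-low p)) (sym (cost-low q)))))
    go (yes p) (no q) = mixed x y p (≰⇒> q)
    go (no p) (yes q) = subst₂ _≤_ (cong cost₀ (+-comm y x)) (+-comm (cost₀ y) (cost₀ x)) (mixed y x q (≰⇒> p))
    go (no p) (no q) = ≤-trans (cost-≤b (x + y)) (≤-trans (arith half) (+-mono-≤ (cost-high-≥ (≰⇒> p)) (cost-high-≥ (≰⇒> q))))
      where
      arith : ∀ h → 4 * h + 1 ≤ 2 * h + 1 + (2 * h + 1)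
      arith h = ≤-by 1 (z≤n {0}) (solve (h ∷ []))

  top : ∀ x → 2 * half + 1 ≤ x → cost₀ x ≡ b₀
  top x p = trans (cost-high (≤-trans (arith half) p))
    (m≥n⇒m⊓n≡n (≤-trans (≤-reflexive (arith′ half)) (∸-monoˡ-≤ 1 (*-monoʳ-≤ 2 p))))
    where
    arith : ∀ h → suc h ≤ 2 * h + 1
    arith h = ≤-by h (z≤n {0}) (solve (h ∷ []))
    arith′ : ∀ h → 4 * h + 1 ≡ 2 * (2 * h + 1) ∸ 1
    arith′ h = sym (trans (cong (_∸ 1) (eq h)) (m+n∸n≡m (4 * h + 1) 1))
      where
      eq : ∀ h → 2 * (2 * h + 1) ≡ 4 * h + 1 + 1
      eq = solve-∀

  potential : Potential
  potential = record
    { K = 2 * half + 1 ; b = b₀ ; cost = cost₀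
    ; 3≤b = ≤-trans (s≤s (s≤s (s≤s z≤n))) (≤-trans (*-monoʳ-≤ 4 (s≤s (z≤n {t}))) (m≤m+n (4 * half) 1))
    ; cost-0 = refl
    ; cost-sub = sub
    ; cost-1 = cost-≤2x 1
    ; cost≤b = cost-≤b
    ; cost-top = top }

  open WithPotential potential
  open Minimality potential

  module _ {g : Graph n} {w : Weight n} {A : VSet n} (minimal : Minimal g w A)
           (high : Q g A ≤ P w A + 1) (ih : Extremal n (card A)) where
    open MinimalSet {τ = 1} minimal high ih
    open Reduction minimal high ih

    -- Below `half` three raises cost at most `6 * suc (w v)`, too little for `cubic-cost`.
    cubic-heavy : ∀ {v} → v ∈ A → deg g v A ≡ 3 → suc (w v) ≤ K → half ≤ w v
    cubic-heavy {v} v∈A d≡3 wv≤K with half ≤? w v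
    ... | yes p = p
    ... | no p = let W , W⊆ , d , h = cubic-cost v∈A d≡3 wv≤K (subst (λ x → 2 * x ≤ suc b) (sym C≡) (arith₁ half (w v) lt)) in
      ⊥-elim (arith₂ half (w v) lt (subst₂ (λ c C → b + 2 + c ≤ C * 3) c≡ C≡
        (≤-trans h (*-monoʳ-≤ (cost (suc (w v))) (≤-trans (∑⊓≤deg g v W) (≤-reflexive d))))))
      where
      lt : suc (w v) ≤ half
      lt = ≰⇒> p
      C≡ : cost (suc (w v)) ≡ 2 * suc (w v)
      C≡ = cost-low lt
      c≡ : cost (w v) ≡ 2 * w v
      c≡ = cost-low (≤-trans (n≤1+n _) lt)
      arith₁ : ∀ h x → suc x ≤ h → 2 * (2 * suc x) ≤ suc (4 * h + 1)
      arith₁ h x p = ≤-by 2 (scale 4 p) (solve (h ∷ x ∷ []))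
      arith₂ : ∀ h x → suc x ≤ h → 4 * h + 1 + 2 + 2 * x ≤ 2 * suc x * 3 → ⊥
      arith₂ h x p q = ⊥-by 0 (scale 4 p ⊕ q) (solve (h ∷ x ∷ []))

    cost-half-≥ : ∀ {x} → half ≤ x → 2 * half ≤ cost x
    cost-half-≥ {x} p with x ≤? half
    ... | yes _ = *-monoʳ-≤ 2 p
    ... | no q = ⊓-glb (≤-trans (m≤m+n _ 1) (2half≤ (≰⇒> q))) (≤-trans (m≤m+n _ 1) 2half≤b)

    charge : ∀ v → v ∈ A → 2 * worth w v + 1 ≤ b * deg g v A
    charge v v∈A with K ≤? w v
    ... | yes p = ≤-trans (+-monoʳ-≤ (2 * worth w v) (n≤1+n 1)) (heavy-charge v∈A p)
    ... | no p with 4 ≤? deg g v A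
    ...   | yes q = ≤-trans (arith (worth w v) (cost (w v)) b (worth-eq w v)) (*-monoʳ-≤ b q)
      where
      arith : ∀ x c b → x + suc c ≡ 2 * b → 2 * x + 1 ≤ b * 4
      arith x c b h = ≤-by (2 * c + 1) (scale 2 (≤-reflexive h)) (solve (x ∷ c ∷ b ∷ []))
    ...   | no q = subst (λ d → 2 * worth w v + 1 ≤ b * d) (sym d≡3)
        (arith (worth w v) (cost (w v)) half (worth-eq w v) (cost-half-≥ (cubic-heavy v∈A d≡3 (≰⇒> p))))
      where
      d≡3 : deg g v A ≡ 3
      d≡3 = ≤-antisym (s≤s⁻¹ (≰⇒> q)) (min-degree-light v∈A (≰⇒> p))
      arith : ∀ x c h → x + suc c ≡ 2 * (4 * h + 1) → 2 * h ≤ c → 2 * x + 1 ≤ (4 * h + 1) * 3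
      arith x c h p q = ≤-by 0 (scale 2 (≤-reflexive p) ⊕ scale 2 q) (solve (x ∷ c ∷ h ∷ []))

    sum-charges : ∀ k → (∀ v → v ∈ A → 2 * worth w v + k ≤ b * deg g v A) → 2 * P w A + k * card A ≤ 2 * Q g A
    sum-charges k h = subst₂ _≤_
      (trans (∑-+ A _ _) (cong₂ _+_ (∑-* A 2 _) (trans (∑-cong A (λ _ _ → sym (*-identityʳ k))) (∑-* A k _))))
      (trans (∑-* A b _) (trans (cong (b *_) (handshake g A)) (*-swap b 2 (edges g A))))
      (∑-mono A h)

    -- By `handshake` the doubled charges sum to twice the potential, at least -2. Being at most -1
    -- each, they leave room for two vertices only; but then every vertex is heavy and has doubled
    -- charge at most -2.
    impossible : ⊥
    impossible with 3 ≤? card A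
    ... | yes p = arith (P w A) (Q g A) (card A) (sum-charges 1 charge) high p
      where
      arith : ∀ x y k → 2 * x + 1 * k ≤ 2 * y → y ≤ x + 1 → 3 ≤ k → ⊥
      arith x y k h₁ h₂ h₃ = ⊥-by 0 (h₁ ⊕ scale 2 h₂ ⊕ h₃) (solve (x ∷ y ∷ k ∷ []))
    ... | no p = arith (P w A) (Q g A) (card A) (sum-charges 2 charge₂) high (nc-card (nc minimal))
      where
      charge₂ : ∀ v → v ∈ A → 2 * worth w v + 2 ≤ b * deg g v A
      charge₂ v v∈A with K ≤? w v
      ... | yes q = heavy-charge v∈A q
      ... | no q = ⊥-elim (p (light-card v∈A (≰⇒> q)))
      arith : ∀ x y k → 2 * x + 2 * k ≤ 2 * y → y ≤ x + 1 → 2 ≤ k → ⊥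
      arith x y k h₁ h₂ h₃ = ⊥-by 1 (h₁ ⊕ scale 2 h₂ ⊕ scale 2 h₃) (solve (x ∷ y ∷ k ∷ []))

  theorem : ∀ n N → Extremal n N
  theorem = extremal impossible

-- Vertices with three simple neighbours

record Cubic {n} (g : Graph n) (A : VSet n) (s : Fin n) : Set where
  field
    x₁ x₂ x₃ : Fin n
    x₁∈ : x₁ ∈ A
    x₂∈ : x₂ ∈ A
    x₃∈ : x₃ ∈ A
    x₁≢x₂ : x₁ ≢ x₂
    x₂≢x₃ : x₂ ≢ x₃
    x₃≢x₁ : x₃ ≢ x₁
    mult-≡ : ∀ u → u ∈ A → mult g s u ≡ ⟦ ⁅ x₁ ⁆ u ⟧ + ⟦ ⁅ x₂ ⁆ u ⟧ + ⟦ ⁅ x₃ ⁆ u ⟧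

  deg-≡ : ∀ {S} → S ⊆ A → deg g s S ≡ ⟦ S x₁ ⟧ + ⟦ S x₂ ⟧ + ⟦ S x₃ ⟧
  deg-≡ {S} S⊆A = begin
    deg g s S
      ≡⟨ ∑-cong S (λ u p → mult-≡ u (S⊆A u p)) ⟩
    ∑ S (λ u → ⟦ ⁅ x₁ ⁆ u ⟧ + ⟦ ⁅ x₂ ⁆ u ⟧ + ⟦ ⁅ x₃ ⁆ u ⟧)
      ≡⟨ trans (∑-+ S _ _) (cong (_+ ∑ S (λ u → ⟦ ⁅ x₃ ⁆ u ⟧)) (∑-+ S _ _)) ⟩
    ∑ S (λ u → ⟦ ⁅ x₁ ⁆ u ⟧) + ∑ S (λ u → ⟦ ⁅ x₂ ⁆ u ⟧) + ∑ S (λ u → ⟦ ⁅ x₃ ⁆ u ⟧)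
      ≡⟨ cong₂ _+_ (cong₂ _+_ (∑-indicator S x₁) (∑-indicator S x₂)) (∑-indicator S x₃) ⟩
    ⟦ S x₁ ⟧ + ⟦ S x₂ ⟧ + ⟦ S x₃ ⟧ ∎
    where open ≡-Reasoning

  deg-3 : ∀ {S} → S ⊆ A → x₁ ∈ S → x₂ ∈ S → x₃ ∈ S → deg g s S ≡ 3
  deg-3 S⊆A (mem p) (mem q) (mem r) = trans (deg-≡ S⊆A) (cong₂ _+_ (cong₂ _+_ (cong ⟦_⟧ p) (cong ⟦_⟧ q)) (cong ⟦_⟧ r))

rotate : {g : Graph n} {A : VSet n} {s : Fin n} → Cubic g A s → Cubic g A s
rotate cu = record
  { x₁ = x₂ ; x₂ = x₃ ; x₃ = x₁ ; x₁∈ = x₂∈ ; x₂∈ = x₃∈ ; x₃∈ = x₁∈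
  ; x₁≢x₂ = x₂≢x₃ ; x₂≢x₃ = x₃≢x₁ ; x₃≢x₁ = x₁≢x₂
  ; mult-≡ = λ u p → trans (mult-≡ u p) (rot ⟦ ⁅ x₁ ⁆ u ⟧ ⟦ ⁅ x₂ ⁆ u ⟧ ⟦ ⁅ x₃ ⁆ u ⟧) }
  where
  open Cubic cu
  rot : ∀ a b c → a + b + c ≡ b + c + a
  rot = solve-∀

cubic : (g : Graph n) {A : VSet n} {v : Fin n} → deg g v A ≡ 3 → (∀ u → u ∈ A → mult g v u ≤ 1) → Cubic g A v
cubic g {A} {v} d≡3 simple =
  let x₁ , x₁∈ , f₁ , d₁ = take ⊆-refl d≡3
      x₂ , x₂∈ , f₂ , d₂ = take −-⊆ d₁
      x₃ , x₃∈ , f₃ , d₃ = take (⊆-trans −-⊆ −-⊆) d₂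
  in assemble x₁ x₂ x₃ x₁∈ x₂∈ x₃∈ f₁ f₂ f₃ d₃
  where
  f : _ → ℕ
  f = mult g v
  take : ∀ {S k} → S ⊆ A → ∑ S f ≡ suc k → ∃[ x ] x ∈ S × f x ≡ 1 × ∑ (S − x) f ≡ k
  take {S} {k} S⊆A eq =
    let x , x∈S , p = ∑-pos S f (≤-trans (s≤s z≤n) (≤-reflexive (sym eq)))
        fx = ≤-antisym (simple x (S⊆A x x∈S)) p
    in x , x∈S , fx , +-cancelʳ-≡ 1 _ k (trans (sym (trans (∑-− x∈S f) (cong (∑ (S − x) f +_) fx))) (trans eq (+-comm 1 k)))
  assemble : ∀ x₁ x₂ x₃ → x₁ ∈ A → x₂ ∈ A − x₁ → x₃ ∈ (A − x₁) − x₂ → f x₁ ≡ 1 → f x₂ ≡ 1 → f x₃ ≡ 1 →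
             ∑ (((A − x₁) − x₂) − x₃) f ≡ 0 → Cubic g A v
  assemble x₁ x₂ x₃ x₁∈ x₂∈ x₃∈ f₁ f₂ f₃ d₃ = record
    { x₁ = x₁ ; x₂ = x₂ ; x₃ = x₃ ; x₁∈ = x₁∈ ; x₂∈ = −-⊆ x₂ x₂∈ ; x₃∈ = −-⊆ x₃ (−-⊆ x₃ x₃∈)
    ; x₁≢x₂ = x₁≢x₂ ; x₂≢x₃ = x₂≢x₃ ; x₃≢x₁ = x₃≢x₁ ; mult-≡ = spec }
    where
    x₁≢x₂ : x₁ ≢ x₂
    x₁≢x₂ = ≢-sym (−-≢ x₂∈)
    x₂≢x₃ : x₂ ≢ x₃
    x₂≢x₃ = ≢-sym (−-≢ x₃∈)
    x₃≢x₁ : x₃ ≢ x₁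
    x₃≢x₁ = −-≢ (−-⊆ x₃ x₃∈)
    values : ∀ u {p q r} → ⁅ x₁ ⁆ u ≡ p → ⁅ x₂ ⁆ u ≡ q → ⁅ x₃ ⁆ u ≡ r →
             ⟦ p ⟧ + ⟦ q ⟧ + ⟦ r ⟧ ≡ ⟦ ⁅ x₁ ⁆ u ⟧ + ⟦ ⁅ x₂ ⁆ u ⟧ + ⟦ ⁅ x₃ ⁆ u ⟧
    values _ refl refl refl = refl
    spec : ∀ u → u ∈ A → f u ≡ ⟦ ⁅ x₁ ⁆ u ⟧ + ⟦ ⁅ x₂ ⁆ u ⟧ + ⟦ ⁅ x₃ ⁆ u ⟧
    spec u u∈A with ≡-or-≢ u x₁ | ≡-or-≢ u x₂ | ≡-or-≢ u x₃
    ... | inj₁ refl | _ | _ = trans f₁ (values u (inside (∈-⁅⁆ u)) (outside (∉-⁅⁆ x₁≢x₂)) (outside (∉-⁅⁆ (≢-sym x₃≢x₁))))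
    ... | inj₂ q₁ | inj₁ refl | _ = trans f₂ (values u (outside (∉-⁅⁆ q₁)) (inside (∈-⁅⁆ u)) (outside (∉-⁅⁆ x₂≢x₃)))
    ... | inj₂ q₁ | inj₂ q₂ | inj₁ refl = trans f₃ (values u (outside (∉-⁅⁆ q₁)) (outside (∉-⁅⁆ q₂)) (inside (∈-⁅⁆ u)))
    ... | inj₂ q₁ | inj₂ q₂ | inj₂ q₃ = trans (∑-≡0 d₃ u (−-∈ (−-∈ (−-∈ u∈A q₁) q₂) q₃))
      (values u (outside (∉-⁅⁆ q₁)) (outside (∉-⁅⁆ q₂)) (outside (∉-⁅⁆ q₃)))

-- Odd `D`: deleting a vertex of degree 3 and weight `h`

module Odd (h : ℕ) where

  b₀ : ℕ
  b₀ = 4 * h + 4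

  cost₀ : ℕ → ℕ
  cost₀ x = (2 * x) ⊓ b₀

  potential : Potential
  potential = record
    { K = 2 * h + 2 ; b = b₀ ; cost = cost₀
    ; 3≤b = ≤-trans (s≤s (s≤s (s≤s z≤n))) (m≤n+m 4 (4 * h))
    ; cost-0 = refl
    ; cost-sub = sub
    ; cost-1 = m⊓n≤m 2 b₀
    ; cost≤b = λ x → m⊓n≤n (2 * x) b₀
    ; cost-top = λ x p → m≥n⇒m⊓n≡n (≤-trans (≤-reflexive (eq h)) (*-monoʳ-≤ 2 p)) }
    where
    eq : ∀ h → 4 * h + 4 ≡ 2 * (2 * h + 2)
    eq = solve-∀
    sub : ∀ x y → cost₀ (x + y) ≤ cost₀ x + cost₀ y
    sub x y with ≤-total (2 * x) b₀ | ≤-total (2 * y) b₀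
    ... | inj₁ p | inj₁ q rewrite m≤n⇒m⊓n≡m p | m≤n⇒m⊓n≡m q = ≤-trans (m⊓n≤m (2 * (x + y)) b₀) (≤-reflexive (*-distribˡ-+ 2 x y))
    ... | inj₂ p | _ rewrite m≥n⇒m⊓n≡n p = ≤-trans (m⊓n≤n (2 * (x + y)) b₀) (m≤m+n b₀ _)
    ... | inj₁ _ | inj₂ q rewrite m≥n⇒m⊓n≡n q = ≤-trans (m⊓n≤n (2 * (x + y)) b₀) (m≤n+m b₀ (cost₀ x))

  open WithPotential potential
  open Minimality potential

  cost-h : cost h ≡ 2 * h
  cost-h = m≤n⇒m⊓n≡m (arith h)
    where
    arith : ∀ h → 2 * h ≤ 4 * h + 4
    arith h = ≤-by (2 * h + 4) (z≤n {0}) (solve (h ∷ []))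

  cost-suc-h : cost (suc h) ≡ 2 * h + 2
  cost-suc-h = trans (m≤n⇒m⊓n≡m (arith h)) (eq h)
    where
    arith : ∀ h → 2 * suc h ≤ 4 * h + 4
    arith h = ≤-by (2 * h + 2) (z≤n {0}) (solve (h ∷ []))
    eq : ∀ h → 2 * suc h ≡ 2 * h + 2
    eq = solve-∀

  suc-h≤K : suc h ≤ K
  suc-h≤K = arith h
    where
    arith : ∀ h → suc h ≤ 2 * h + 2
    arith h = ≤-by (h + 1) (z≤n {0}) (solve (h ∷ []))

  half-worth : (w : Weight n) {s : Fin n} → w s ≡ h → worth w s + suc (2 * h) ≡ 2 * b
  half-worth w {s} ws = trans (cong (λ x → worth w s + suc x) (sym (trans (cong cost ws) cost-h))) (worth-eq w s)

  raise : Graph n → Fin n → Weight n → Weight n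
  raise g s = bump g s (suc h)

  raise-P : (g : Graph n) (w : Weight n) (s : Fin n) {S : VSet n} {t : ℕ} → deg g s S ≤ t →
            P w S ≤ P (raise g s w) S + (2 * h + 2) * t
  raise-P g w s {S} {t} d≤t = subst (λ C → P w S ≤ P (raise g s w) S + C * t) cost-suc-h
    (≤-trans (bump-P g w s (suc h) S) (+-monoʳ-≤ _ (*-monoʳ-≤ (cost (suc h)) (≤-trans (∑⊓≤deg g s S) d≤t))))

  -- The balance is `3 * b - (2 * b - 1 - 2 * h) - 3 * (2 * h + 2)`, which is -1 for `b = 4 * h +
  -- 4`.
  raise-high : (g : Graph n) (w : Weight n) {A : VSet n} {s : Fin n} {τ : ℕ} → s ∈ A → w s ≡ h → deg g s A ≡ 3 →
               Q g A ≤ P w A + τ → Q g (A − s) ≤ P (raise g s w) (A − s) + suc τ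
  raise-high g w {A} {s} {τ} s∈A ws d≡3 high = arith (P w (A − s)) (P (raise g s w) (A − s)) (Q g (A − s)) (worth w s) h τ
    (subst₂ (λ x y → x ≤ y + τ)
      (trans (cong (b *_) (edges-− g s∈A)) (trans (*-distribˡ-+ b (edges g (A − s)) _) (cong (λ d → Q g (A − s) + b * d) d′≡3)))
      (∑-− s∈A _) high)
    (raise-P g w s (≤-reflexive d′≡3)) (half-worth w ws)
    where
    d′≡3 : deg g s (A − s) ≡ 3
    d′≡3 = trans (sym (deg-− g)) d≡3
    arith : ∀ p p⁺ q x h τ → q + (4 * h + 4) * 3 ≤ p + x + τ → p ≤ p⁺ + (2 * h + 2) * 3 →
            x + suc (2 * h) ≡ 2 * (4 * h + 4) → q ≤ p⁺ + suc τ
    arith p p⁺ q x h τ h₁ h₂ h₃ = ≤-by 0 (h₁ ⊕ h₂ ⊕ ≤-reflexive h₃) (solve (p ∷ p⁺ ∷ q ∷ x ∷ h ∷ τ ∷ []))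

  -- `τ` is 2 so that the result applies once more after one such vertex has been deleted. The aim
  -- is that deleting `s` and raising its neighbours leaves a minimal set.
  module Tight {g : Graph n} {w : Weight n} {A : VSet n} (minimal : Minimal g w A)
               (high : Q g A ≤ P w A + 2) (ih : Extremal n (card A)) {s : Fin n} (s∈A : s ∈ A) (ws : w s ≡ h) where
    open MinimalSet {τ = 2} minimal high ih

    w⁺ : Weight n
    w⁺ = raise g s w

    module _ {W : VSet n} (W⊆ : W ⊆ A − s) (¬col : ¬ Colorable K g w⁺ W) (low : P w⁺ W + 2 ≤ Q g W) where

      private
        W⊆A : W ⊆ A
        W⊆A = ⊆-trans W⊆ −-⊆

        s∉W : s ∉ W
        s∉W = ∉-⊆ W⊆ (−-∉ s)

      -- If W contains only the neighbour x₁ of s, colour W and replace s, which then may be put into F,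
      -- by an edge joining x₂ and x₃.
      not-one : (cu : Cubic g A s) (let open Cubic cu) → x₁ ∈ W → x₂ ∉ W → x₃ ∉ W → ⊥
      not-one cu p₁ p₂ p₃ = finish (∈-or-∉ U x₂) (∈-or-∉ U x₃)
        where
        open Cubic cu
        c : VSet n
        c = proj₁ (color-proper W⊆A s∈A s∉W)
        ok : Ok K g w W c
        ok = proj₂ (color-proper W⊆A s∈A s∉W)
        -- If `x₁` were in `F`, the raise would not touch the class `M` within `W`, and `c` would be
        -- a colouring for `w⁺` too.
        cx₁ : c x₁ ≡ true
        cx₁ with c x₁ in eq
        ... | true = refl
        ... | false = ⊥-elim (¬col (c , Ok-weaken K ⊆-refl (λ _ _ → ≤-refl) (λ u p q → ≤-reflexive (bump-nonadj {g = g} {w} {s} u (no-adj u p q))) ok))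
          where
          no-adj : ∀ u → u ∈ W → c u ≡ true → mult g s u ≡ 0
          no-adj u p q = trans (mult-≡ u (W⊆A u p)) (cong₂ _+_ (cong₂ _+_
            (cong ⟦_⟧ (outside (∉-⁅⁆ {v = x₁} (λ u≡x₁ → contradiction (trans (sym q) (trans (cong c u≡x₁) eq)) λ ()))))
            (cong ⟦_⟧ (outside (∉-⁅⁆ (∈-≢ p p₂))))) (cong ⟦_⟧ (outside (∉-⁅⁆ (∈-≢ p p₃)))))
        gᵐ : Graph n
        gᵐ = addEdge g x₂ x₃ x₂≢x₃
        edges-W : ∀ S → S ⊆ W → edges gᵐ S ≡ edges g S
        edges-W S S⊆W = edges-addEdge-∉ g x₂≢x₃ (inj₁ (∉-⊆ S⊆W p₂))
        d≤1 : deg g s W ≤ 1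
        d≤1 = ≤-reflexive (trans (deg-≡ W⊆A) (cong₂ _+_ (cong₂ _+_ (cong ⟦_⟧ (inside p₁)) (cong ⟦_⟧ (outside p₂))) (cong ⟦_⟧ (outside p₃))))
        -- `x₁` is kept in `M`, so the only possible neighbours of `s` in `F` are the ends of the
        -- additional edge, which `s` subdivides.
        noext : ∀ c′ → (∀ u → u ∈ W → c′ u ≡ c u) → ¬ Ok K gᵐ w (A − s) c′
        noext c′ agree ok′ = nc minimal (Colorable-⊆ K (⊹-− A s) (_ , add-F K ok′ (−-∉ s)
          (λ S _ → edges-addEdge-≥ g x₂≢x₃ S) bound))
          where
          bound : ∀ S → S ⊆ A − s → Mono c′ false S → edges g S + deg g s S ≤ suc (edges gᵐ S)
          bound S S⊆ m = subst₂ (λ x y → edges g S + x ≤ suc y)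
            (sym (trans (deg-≡ (⊆-trans S⊆ −-⊆)) (cong (λ x → ⟦ x ⟧ + ⟦ S x₂ ⟧ + ⟦ S x₃ ⟧) x₁∉S)))
            (sym (edges-addEdge g x₂≢x₃ S))
            (≤-trans (+-monoʳ-≤ (edges g S) (bool-sum (S x₂) (S x₃))) (≤-reflexive (+-suc (edges g S) _)))
            where
            x₁∉S : S x₁ ≡ false
            x₁∉S with S x₁ in eq
            ... | false = refl
            ... | true = contradiction (trans (sym (trans (agree x₁ p₁) cx₁)) (m x₁ (mem eq))) λ ()
        open Enlargement (enlarge {g = gᵐ} (λ lt → ih (≤-trans lt (∑-⊆ _ −-⊆))) W⊆ (nc-card ¬col)
          (Ok-weaken K ⊆-refl (λ S p → ≤-reflexive (edges-W S p)) (λ _ _ _ → ≤-refl) ok) noext)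
        s∉U : s ∉ U
        s∉U = ∉-⊆ U⊆A (−-∉ s)
        U⊆ : U ⊆ A
        U⊆ = ⊆-trans U⊆A −-⊆
        2≤U : 2 ≤ card U
        2≤U = ≤-trans (nc-card ¬col) (∑-⊆ _ W⊆U)
        degU : ∀ {x y} → U x₂ ≡ x → U x₃ ≡ y → deg g s U ≡ 1 + ⟦ x ⟧ + ⟦ y ⟧
        degU p q = trans (deg-≡ U⊆) (cong₂ _+_ (cong₂ _+_ (cong ⟦_⟧ (inside (W⊆U x₁ p₁))) (cong ⟦_⟧ p)) (cong ⟦_⟧ q))
        drop′ : ∀ {x y} → U x₂ ≡ x → U x₃ ≡ y → P w U + 2 + Q g W ≤ P w W + b * (edges g U + ⟦ x ⟧ * ⟦ y ⟧)
        drop′ refl refl = subst₂ (λ x y → P w U + 2 + b * x ≤ P w W + b * y) (edges-W W ⊆-refl) (edges-addEdge g x₂≢x₃ U) drop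
        pW = raise-P g w s d≤1
        two : deg g s U ≡ 2 → P w U + 2 + Q g W ≤ P w W + b * (edges g U + 0) → ⊥
        two d dr = arith (P w U) (edges g U) (P w W) (P w⁺ W) (Q g W) h dr pW low (doubled U⊆ s∈A s∉U 2≤U (≤-reflexive (sym d)))
          where
          arith : ∀ pU eU pW p⁺ qW h → pU + 2 + qW ≤ pW + (4 * h + 4) * (eU + 0) → pW ≤ p⁺ + (2 * h + 2) * 1 → p⁺ + 2 ≤ qW →
                  (4 * h + 4) * eU + suc (4 * h + 4) ≤ pU + 2 → ⊥
          arith pU eU pW p⁺ qW h h₁ h₂ h₃ h₄ = ⊥-by (2 * h + 4) (h₁ ⊕ h₂ ⊕ h₃ ⊕ h₄) (solve (pU ∷ eU ∷ pW ∷ p⁺ ∷ qW ∷ h ∷ []))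
        -- Each case violates a lower bound: `floor` at `U ⊹ s` if both ends of the additional edge
        -- are present, `doubled` if one is, `pendant` if none is.
        finish : x₂ ∈ U ⊎ x₂ ∉ U → x₃ ∈ U ⊎ x₃ ∉ U → ⊥
        finish (inj₁ (mem q₂)) (inj₁ (mem q₃)) = arith (P w U) (edges g U) (P w W) (P w⁺ W) (Q g W) (worth w s) h (drop′ q₂ q₃) pW low
          (subst₂ (λ x y → x ≤ y + 2) (trans (Q-⊹ g s∉U) (cong (λ d → Q g U + b * d) (degU q₂ q₃))) (P-⊹ w s∉U)
            (floor (⊹-⊆ U⊆ s∈A) (≤-trans (≤-trans (s≤s z≤n) 2≤U) (∑-⊆ _ ⊹-⊇))))
          (half-worth w ws)
          where
          arith : ∀ pU eU pW p⁺ qW x h → pU + 2 + qW ≤ pW + (4 * h + 4) * (eU + 1) → pW ≤ p⁺ + (2 * h + 2) * 1 → p⁺ + 2 ≤ qW →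
                  (4 * h + 4) * eU + (4 * h + 4) * 3 ≤ pU + x + 2 → x + suc (2 * h) ≡ 2 * (4 * h + 4) → ⊥
          arith pU eU pW p⁺ qW x h h₁ h₂ h₃ h₄ h₅ = ⊥-by 0 (h₁ ⊕ h₂ ⊕ h₃ ⊕ h₄ ⊕ ≤-reflexive h₅)
            (solve (pU ∷ eU ∷ pW ∷ p⁺ ∷ qW ∷ x ∷ h ∷ []))
        finish (inj₁ (mem q₂)) (inj₂ (nonmem q₃)) = two (degU q₂ q₃) (drop′ q₂ q₃)
        finish (inj₂ (nonmem q₂)) (inj₁ (mem q₃)) = two (degU q₂ q₃) (drop′ q₂ q₃)
        finish (inj₂ (nonmem q₂)) (inj₂ (nonmem q₃)) = arith (P w U) (edges g U) (P w W) (P w⁺ W) (Q g W) (worth w s) h (drop′ q₂ q₃) pW low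
          (subst₂ (λ x y → x + suc b ≤ y + 2) (trans (Q-⊹ g s∉U) (cong (λ d → Q g U + b * d) (degU q₂ q₃))) (P-⊹ w s∉U)
            (pendant U⊆ s∈A s∉U (≤-trans (s≤s z≤n) 2≤U) (≤-reflexive (degU q₂ q₃)) (min-degree s∈A)))
          (half-worth w ws)
          where
          arith : ∀ pU eU pW p⁺ qW x h → pU + 2 + qW ≤ pW + (4 * h + 4) * (eU + 0) → pW ≤ p⁺ + (2 * h + 2) * 1 → p⁺ + 2 ≤ qW →
                  (4 * h + 4) * eU + (4 * h + 4) * 1 + suc (4 * h + 4) ≤ pU + x + 2 → x + suc (2 * h) ≡ 2 * (4 * h + 4) → ⊥
          arith pU eU pW p⁺ qW x h h₁ h₂ h₃ h₄ h₅ = ⊥-by 1 (h₁ ⊕ h₂ ⊕ h₃ ⊕ h₄ ⊕ ≤-reflexive h₅)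
            (solve (pU ∷ eU ∷ pW ∷ p⁺ ∷ qW ∷ x ∷ h ∷ []))

      not-zero : deg g s W ≢ 0
      not-zero d≡0 = ¬col (bump-colorable {v = s} d≡0 (color-proper W⊆A s∈A s∉W))

      not-two : deg g s W ≢ 2
      not-two d≡2 = arith (P w W) (P w⁺ W) (Q g W) h (raise-P g w s (≤-reflexive d≡2)) low
        (doubled W⊆A s∈A s∉W (nc-card ¬col) (≤-reflexive (sym d≡2)))
        where
        arith : ∀ p p⁺ q h → p ≤ p⁺ + (2 * h + 2) * 2 → p⁺ + 2 ≤ q → q + suc (4 * h + 4) ≤ p + 2 → ⊥
        arith p p⁺ q h h₁ h₂ h₃ = ⊥-by 0 (h₁ ⊕ h₂ ⊕ h₃) (solve (p ∷ p⁺ ∷ q ∷ h ∷ []))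

      -- If a vertex were missing, `gap` would give `W ⊹ s` potential at least 0, and deleting `s`
      -- loses only 1.
      three-all : deg g s W ≡ 3 → A − s ⊆ W
      three-all d≡3 with ⊆-or-∃ (A − s) W
      ... | inj₁ p = p
      ... | inj₂ (u , u∈ , u∉W) = ⊥-elim (arith (P w W) (P w⁺ W) (Q g W) (worth w s) h (raise-P g w s (≤-reflexive d≡3)) low
        (subst₂ (λ x y → x + 2 ≤ y + 2) (trans (Q-⊹ g s∉W) (cong (λ d → Q g W + b * d) d≡3)) (P-⊹ w s∉W)
          (gap (⊹-⊆ W⊆A s∈A) (−-⊆ u u∈) (⊹-∉ u∉W (−-≢ u∈)) (≤-trans (s≤s z≤n) (≤-reflexive (sym (card-⊹ s∉W))))))
        (half-worth w ws))
        where
        arith : ∀ p p⁺ q x h → p ≤ p⁺ + (2 * h + 2) * 3 → p⁺ + 2 ≤ q → q + (4 * h + 4) * 3 + 2 ≤ p + x + 2 →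
                x + suc (2 * h) ≡ 2 * (4 * h + 4) → ⊥
        arith p p⁺ q x h h₁ h₂ h₃ h₄ = ⊥-by 0 (h₁ ⊕ h₂ ⊕ h₃ ⊕ ≤-reflexive h₄) (solve (p ∷ p⁺ ∷ q ∷ x ∷ h ∷ []))

      low-is-all : Cubic g A s → A − s ⊆ W
      low-is-all cu = go (∈-or-∉ W x₁) (∈-or-∉ W x₂) (∈-or-∉ W x₃)
        where
        open Cubic cu
        degW : ∀ {x y z} → W x₁ ≡ x → W x₂ ≡ y → W x₃ ≡ z → deg g s W ≡ ⟦ x ⟧ + ⟦ y ⟧ + ⟦ z ⟧
        degW p q r = trans (deg-≡ W⊆A) (cong₂ _+_ (cong₂ _+_ (cong ⟦_⟧ p) (cong ⟦_⟧ q)) (cong ⟦_⟧ r))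
        go : x₁ ∈ W ⊎ x₁ ∉ W → x₂ ∈ W ⊎ x₂ ∉ W → x₃ ∈ W ⊎ x₃ ∉ W → A − s ⊆ W
        go (inj₁ (mem p)) (inj₁ (mem q)) (inj₁ (mem r)) = three-all (degW p q r)
        go (inj₁ (mem p)) (inj₁ (mem q)) (inj₂ (nonmem r)) = ⊥-elim (not-two (degW p q r))
        go (inj₁ (mem p)) (inj₂ (nonmem q)) (inj₁ (mem r)) = ⊥-elim (not-two (degW p q r))
        go (inj₂ (nonmem p)) (inj₁ (mem q)) (inj₁ (mem r)) = ⊥-elim (not-two (degW p q r))
        go (inj₁ p) (inj₂ q) (inj₂ r) = ⊥-elim (not-one cu p q r)
        go (inj₂ p) (inj₁ q) (inj₂ r) = ⊥-elim (not-one (rotate cu) q r p)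
        go (inj₂ p) (inj₂ q) (inj₁ r) = ⊥-elim (not-one (rotate (rotate cu)) r p q)
        go (inj₂ (nonmem p)) (inj₂ (nonmem q)) (inj₂ (nonmem r)) = ⊥-elim (not-zero (degW p q r))

    -- If deleting `u` left an uncolourable set, `ih` would find a low uncolourable subset avoiding
    -- `u`; but the only such subset of `A − s` is `A − s` itself.
    raise-minimal : Cubic g A s → Minimal g w⁺ (A − s)
    raise-minimal cu = record { nc = nc⁺ ; del = del⁺ }
      where
      nc⁺ : ¬ Colorable K g w⁺ (A − s)
      nc⁺ = subst (λ k → ¬ Colorable K g (bump g s (suc k) w) (A − s)) ws
        (uncolorable-bump (nc minimal) s∈A (≤-reflexive (Cubic.deg-3 cu ⊆-refl (Cubic.x₁∈ cu) (Cubic.x₂∈ cu) (Cubic.x₃∈ cu)))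
          (subst (λ k → suc k ≤ K) (sym ws) suc-h≤K))
      del⁺ : ∀ u → u ∈ A − s → Colorable K g w⁺ ((A − s) − u)
      del⁺ u u∈ = decidable-stable (colorable? K g w⁺ _) (λ ¬col →
        let W , W⊆ , ¬colW , low = ih (≤-trans (card-< {W = (A − s) − u} {A − s} −-⊆ u∈ (−-∉ u)) (∑-⊆ _ −-⊆)) ¬col
        in ∈∉-⊥ (W⊆ u (low-is-all (⊆-trans W⊆ −-⊆) ¬colW low cu u u∈)) (−-∉ u))

-- Odd `D`: structure around vertices of degree 3 and weight `h`

module OddMain (h : ℕ) where
  open Odd h
  open WithPotential potential
  open Minimality potential

  raise-≥ : (g : Graph n) (s : Fin n) (w : Weight n) (u : Fin n) → w u ≤ raise g s w u
  raise-≥ g s w u = m≤m+n (w u) _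

  record Situation (g : Graph n) (w : Weight n) (A : VSet n) (τ : ℕ) : Set where
    field
      minimal : Minimal g w A
      high : Q g A ≤ P w A + τ
      ih : Extremal n (card A)

  -- A minimal uncolourable set is itself the set promised by the induction hypothesis.
  low-minimal : {g : Graph n} {w : Weight n} {A : VSet n} {N : ℕ} → Minimal g w A → Extremal n N → card A < N → P w A + 2 ≤ Q g A
  low-minimal {g = g} {w} {A} minimal ih lt with ih lt (nc minimal)
  ... | U , U⊆A , ¬col , low with ⊆-or-∃ A U
  ...   | inj₁ A⊆U = subst₂ (λ x y → x + 2 ≤ y) (P-≗ w U⊆A A⊆U) (Q-≗ g U⊆A A⊆U) low
  ...   | inj₂ (u , p , q) = ⊥-elim (¬col (Colorable-⊆ K (⊆-− U⊆A q) (del minimal u p)))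

  -- Each deletion is paid for with one unit of `τ`; starting from 1, two deletions are possible.
  reduce : {g : Graph n} {w : Weight n} {A : VSet n} {τ : ℕ} → Situation g w A τ → τ ≤ 2 → ∀ {s} → s ∈ A → w s ≡ h →
           Cubic g A s → Situation g (raise g s w) (A − s) (suc τ)
  reduce {g = g} {w} {A} {τ} sit τ≤2 {s} s∈A ws cu = record
    { minimal = Tight.raise-minimal minimal (≤-trans high (+-monoʳ-≤ (P w A) τ≤2)) ih s∈A ws cu
    ; high = raise-high g w s∈A ws (Cubic.deg-3 cu ⊆-refl (Cubic.x₁∈ cu) (Cubic.x₂∈ cu) (Cubic.x₃∈ cu)) high
    ; ih = λ lt → ih (≤-trans lt (∑-⊆ _ −-⊆)) }
    where open Situation sit

  module Main {g : Graph n} {w : Weight n} {A : VSet n} (sit : Situation g w A 1) where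
    open Situation sit
    open MinimalSet {τ = 1} minimal high ih
    open Reduction minimal high ih

    record Bad (v : Fin n) : Set where
      constructor bad
      field
        in-A : v ∈ A
        degree : deg g v A ≡ 3
        half : w v ≡ h
    open Bad

    bad-light : ∀ {v} → Bad v → suc (w v) ≤ K
    bad-light bv = subst (λ k → suc k ≤ K) (sym (half bv)) suc-h≤K

    bad-cost : ∀ {v} → Bad v → 2 * cost (suc (w v)) ≤ suc b
    bad-cost bv = subst (λ k → 2 * cost (suc k) ≤ suc b) (sym (half bv)) (subst (λ C → 2 * C ≤ suc b) (sym cost-suc-h) (arith h))
      where
      arith : ∀ h → 2 * (2 * h + 2) ≤ suc (4 * h + 4)
      arith h = ≤-by 1 (z≤n {0}) (solve (h ∷ []))

    -- At a bad vertex `cubic-cost` reads `6 * h + 6 ≤ (2 * h + 2) * k`, which forces the number `k`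
    -- of distinct neighbours to be 3.
    simple : ∀ {v} → Bad v → ∀ u → u ∈ A → mult g v u ≤ 1
    simple {v} bv u u∈A = go (cubic-cost (in-A bv) (degree bv) (bad-light bv) (bad-cost bv))
      where
      go : ∃[ W ] W ⊆ A − v × deg g v W ≡ 3 × b + 2 + cost (w v) ≤ cost (suc (w v)) * ∑ W (λ u → 1 ⊓ mult g v u) → mult g v u ≤ 1
      go (W , W⊆ , d , c) with ∈-or-∉ W u
      ... | inj₂ u∉W = ≤-trans (+-cancelˡ-≤ 3 _ 0 (subst₂ (λ x y → x + mult g v u ≤ y) d (degree bv)
              (∑-∉ (⊆-trans W⊆ −-⊆) u∈A u∉W (mult g v)))) z≤n
      ... | inj₁ u∈W with mult g v u ≤? 1
      ...   | yes p = p
      ...   | no p = ⊥-elim (arith h k k≤2 c′)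
        where
        k = ∑ W (λ u → 1 ⊓ mult g v u)
        k≤2 : k ≤ 2
        k≤2 = +-cancelʳ-≤ 1 k 2 (≤-trans (∑-mono-at W 1 (λ x _ → m⊓n≤n 1 (mult g v x)) u∈W
                (≤-trans (+-monoˡ-≤ 1 (m⊓n≤m 1 (mult g v u))) (≰⇒> p))) (≤-reflexive d))
        c′ : 4 * h + 4 + 2 + 2 * h ≤ (2 * h + 2) * k
        c′ = subst₂ (λ x y → b + 2 + x ≤ y * k) (trans (cong cost (half bv)) cost-h) (trans (cong (λ x → cost (suc x)) (half bv)) cost-suc-h) c
        arith : ∀ h k → k ≤ 2 → 4 * h + 4 + 2 + 2 * h ≤ (2 * h + 2) * k → ⊥
        arith h k p q = ⊥-by (2 * h + 1) (scale (2 * h + 2) p ⊕ q) (solve (h ∷ k ∷ []))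

    cubic-bad : ∀ {v} → Bad v → Cubic g A v
    cubic-bad bv = cubic g (degree bv) (simple bv)

    mult-1 : ∀ {v u} → Bad v → u ∈ A → 1 ≤ mult g v u → mult g v u ≡ 1
    mult-1 bv u∈A p = ≤-antisym (simple bv _ u∈A) p

    -- After raising weights around v only, p can always be coloured, and v after it.
    independent : ∀ {v p} → Bad v → Bad p → mult g v p ≡ 0
    independent {v} {p} bv bp with mult g v p in eq
    ... | zero = refl
    ... | suc k = ⊥-elim (contra (ih (≤-trans (s≤s (∑-⊆ _ −-⊆)) (≤-reflexive (sym (card-− (in-A bv))))) ¬col))
      where
      p≢v : p ≢ v
      p≢v refl = contradiction (trans (sym eq) (mult-irr g v)) λ ()
      p∈ : p ∈ A − v
      p∈ = −-∈ (in-A bp) p≢v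
      k₁ = suc (w v)
      w₁ : Weight n
      w₁ = bump g v k₁ w
      A₀ : VSet n
      A₀ = (A − v) − p
      adj : 1 ≤ mult g v p
      adj = subst (1 ≤_) (sym eq) (s≤s z≤n)
      d≤2 : deg g p A₀ ≤ 2
      d≤2 = +-cancelʳ-≤ 1 _ 2 (≤-trans (+-mono-≤ (∑-⊆ (mult g p) (−-⊆ {S = A − v} {p})) (subst (1 ≤_) (mult-sym g v p) adj))
        (≤-reflexive (trans (sym (deg-−-∈ g p (in-A bv))) (degree bp))))
      ¬col : ¬ Colorable K g w₁ A₀
      ¬col (c , ok) = uncolorable-bump (nc minimal) (in-A bv) (≤-reflexive (degree bv)) (bad-light bv)
        (Colorable-⊆ K (⊹-− (A − v) p) extended)
        where
        extended : Colorable K g w₁ (A₀ ⊹ p)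
        extended with deg g p (A₀ ∖ c) ≤? 1
        ... | yes q = _ , add-leaf-F K ok (−-∉ p) q
        ... | no q = _ , add-M K ok (−-∉ p) (≤-trans (≤-reflexive dM≡0) z≤n) weight-p (λ _ _ → ≤-refl)
          (λ u r s → ⊥-elim (<-irrefl refl (≤-trans s (≤-reflexive (∑-≡0 dM≡0 u r)))))
          where
          dM≡0 : deg g p (A₀ ∩ c) ≡ 0
          dM≡0 = n≤0⇒n≡0 (+-cancelʳ-≤ 2 _ 0 (≤-trans (+-monoʳ-≤ _ (≰⇒> q)) (subst (_≤ 2) (deg-split g p A₀ c) d≤2)))
          -- The raised weight of `p` is `h + suc h`, one less than `K`: alone in its component, `p`
          -- just fits.
          weight-p : suc (w₁ p) ≤ K
          weight-p = ≤-reflexive (trans (cong suc (trans (bump-adj {g = g} {w} {v} p adj) (cong₂ (λ x y → x + suc y) (half bp) (half bv)))) (eq′ h))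
            where
            eq′ : ∀ h → suc (h + suc h) ≡ 2 * h + 2
            eq′ = solve-∀
      contra : (∃[ W ] W ⊆ A₀ × ¬ Colorable K g w₁ W × P w₁ W + 2 ≤ Q g W) → ⊥
      contra (W , W⊆ , ¬colW , low) = <-irrefl refl (≤-trans
        (≤-reflexive (cong suc (sym (low-subset-degree (in-A bv) (degree bv) (bad-cost bv) (⊆-trans W⊆ −-⊆) ¬colW low))))
        (≤-trans (≤-reflexive (+-comm 1 (deg g v W))) (≤-trans (+-monoʳ-≤ (deg g v W) adj)
          (≤-trans (∑-∉ (⊆-trans W⊆ (⊆-trans −-⊆ −-⊆)) (in-A bp) (∉-⊆ W⊆ (−-∉ p)) (mult g v)) (≤-reflexive (degree bv))))))

    module Pair {v p : Fin n} (bv : Bad v) (bp : Bad p) (v≢p : v ≢ p) where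
      w₁ w₂ : Weight n
      w₁ = raise g v w
      w₂ = raise g p w₁
      A₁ A₂ : VSet n
      A₁ = A − v
      A₂ = A₁ − p

      p∈A₁ : p ∈ A₁
      p∈A₁ = −-∈ (in-A bp) (≢-sym v≢p)

      A₂⊆A : A₂ ⊆ A
      A₂⊆A = ⊆-trans −-⊆ −-⊆

      w₁p : w₁ p ≡ h
      w₁p = trans (bump-nonadj {g = g} {w} {v} p (independent bv bp)) (half bp)

      cubic-p : Cubic g A₁ p
      cubic-p = cubic g (trans (sym (trans (deg-−-∈ g p (in-A bv)) (trans (cong (deg g p A₁ +_) (independent bp bv)) (+-identityʳ _)))) (degree bp))
        (λ u q → simple bp u (−-⊆ u q))

      sit₂ : Situation g w₂ A₂ 3
      sit₂ = reduce (reduce sit (s≤s z≤n) (in-A bv) (half bv) (cubic-bad bv)) ≤-refl p∈A₁ w₁p cubic-p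

      module S₂ = Situation sit₂
      module C₂ = MinimalSet {τ = 3} S₂.minimal S₂.high S₂.ih

      deg-A₂ : ∀ u → deg g u A ≡ deg g u A₂ + mult g u p + mult g u v
      deg-A₂ u = trans (deg-−-∈ g u (in-A bv)) (cong (_+ mult g u v) (deg-−-∈ g u p∈A₁))

      card-A₂ : card A₂ < card A
      card-A₂ = ≤-trans (s≤s (∑-⊆ _ −-⊆)) (≤-reflexive (sym (card-− (in-A bv))))

      module Common {z : Fin n} (z∈A : z ∈ A) (vz : 1 ≤ mult g v z) (pz : 1 ≤ mult g p z) where

        ≢-of : ∀ {x y} → mult g x y ≡ 0 → 1 ≤ mult g x z → z ≢ y
        ≢-of eq q refl = <-irrefl refl (≤-trans q (≤-reflexive eq))

        z∈A₂ : z ∈ A₂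
        z∈A₂ = −-∈ (−-∈ z∈A (≢-of (mult-irr g v) vz)) (≢-of (mult-irr g p) pz)

        zv : mult g z v ≡ 1
        zv = trans (mult-sym g z v) (mult-1 bv z∈A vz)

        zp : mult g z p ≡ 1
        zp = trans (mult-sym g z p) (mult-1 bp z∈A pz)

        deg-z : deg g z A ≡ deg g z A₂ + 2
        deg-z = trans (deg-A₂ z) (trans (cong₂ (λ x y → deg g z A₂ + x + y) zp zv) (+-assoc (deg g z A₂) 1 1))

        -- Besides its edges to `v` and `p`, `z` keeps degree at least 2 in the minimal set `A₂`.
        deg≥4 : 4 ≤ deg g z A
        deg≥4 = subst (4 ≤_) (sym deg-z) (+-monoˡ-≤ 2 (C₂.min-degree z∈A₂))

        w₂z : K ≤ w₂ z
        w₂z = ≤-trans (≤-reflexive (eq h)) (≤-trans (+-monoˡ-≤ (suc h) (m≤n+m (suc h) (w z)))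
          (≤-reflexive (sym (trans (bump-adj {g = g} {w₁} {p} z pz) (cong (_+ suc h) (bump-adj {g = g} {w} {v} z vz))))))
          where
          eq : ∀ h → 2 * h + 2 ≡ suc h + suc h
          eq = solve-∀

        worth₂z : worth w₂ z + suc b ≡ 2 * b
        worth₂z = trans (cong (λ x → worth w₂ z + suc x) (sym (cost-top (w₂ z) w₂z))) (worth-eq w₂ z)

        -- The two raises of `z` are accounted for with `2 * (2 * h + 2) = b`, but its cost is
        -- capped at `b`. A positive weight would make them cheaper by at least 2, and `A₂` would
        -- have potential at least -1, against `low-minimal`.
        unweighted : w z ≡ 0
        unweighted with w z in eq
        ... | zero = refl
        ... | suc k = ⊥-elim (arith (P w A₂) (P w₂ A₂) (edges g A₂) (worth w v) (worth w p) h total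
            (subst₂ (λ x y → x ≤ y + 1) QA PA high) (low-minimal S₂.minimal ih card-A₂) (half-worth w (half bv)) (half-worth w (half bp)))
          where
          C = 2 * h + 2
          f : Fin n → ℕ
          f u = worth w₂ u + C * (mult g v u + mult g p u)
          ⊓≤ : ∀ x → C * (1 ⊓ x) ≤ C * x
          ⊓≤ x = *-monoʳ-≤ C (m⊓n≤n 1 x)
          step : ∀ x (w : Weight n) u → worth w u ≤ worth (raise g x w) u + C * mult g x u
          step x w u = worth-≤ w (raise g x w) u (≤-trans (cost-sub (w u) _) (+-monoʳ-≤ (cost (w u))
            (≤-trans (⊓-cost (mult g x u) (suc h)) (≤-trans (≤-reflexive (cong (_* (1 ⊓ mult g x u)) cost-suc-h)) (⊓≤ (mult g x u))))))
          pointwise : ∀ u → u ∈ A₂ → worth w u ≤ f u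
          pointwise u _ = ≤-trans (step v w u) (≤-trans (+-monoˡ-≤ _ (step p w₁ u)) (≤-reflexive (rearr (worth w₂ u) C (mult g v u) (mult g p u))))
            where
            rearr : ∀ x C m₁ m₂ → x + C * m₂ + C * m₁ ≡ x + C * (m₁ + m₂)
            rearr = solve-∀
          at-z : worth w z + 2 ≤ f z
          at-z = arith₁ (worth w z) (worth w₂ z) (cost (w z)) (mult g v z) (mult g p z) h (worth-eq w z) worth₂z cost≥2 vz pz
            where
            cost≥2 : 2 ≤ cost (w z)
            cost≥2 = subst (λ x → 2 ≤ cost x) (sym eq) (⊓-glb (*-monoʳ-≤ 2 (s≤s (z≤n {k}))) (≤-trans (n≤1+n 2) 3≤b))
            arith₁ : ∀ x x₂ c m₁ m₂ h → x + suc c ≡ 2 * (4 * h + 4) → x₂ + suc (4 * h + 4) ≡ 2 * (4 * h + 4) → 2 ≤ c →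
                     1 ≤ m₁ → 1 ≤ m₂ → x + 2 ≤ x₂ + (2 * h + 2) * (m₁ + m₂)
            arith₁ x x₂ c m₁ m₂ h h₁ h₂ h₃ h₄ h₅ = ≤-by 0
              (≤-reflexive h₁ ⊕ ≤-reflexive (sym h₂) ⊕ h₃ ⊕ scale (2 * h + 2) h₄ ⊕ scale (2 * h + 2) h₅)
              (solve (x ∷ x₂ ∷ c ∷ m₁ ∷ m₂ ∷ h ∷ []))
          total : P w A₂ + 2 ≤ P w₂ A₂ + C * 6
          total = ≤-trans (∑-mono-at A₂ 2 pointwise z∈A₂ at-z) (≤-trans (≤-reflexive
            (trans (∑-+ A₂ _ _) (cong (P w₂ A₂ +_) (trans (∑-* A₂ C _) (cong (C *_) (∑-+ A₂ _ _))))))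
            (+-monoʳ-≤ (P w₂ A₂) (*-monoʳ-≤ C (+-mono-≤ (≤-trans (∑-⊆ _ A₂⊆A) (≤-reflexive (degree bv)))
                                                        (≤-trans (∑-⊆ _ A₂⊆A) (≤-reflexive (degree bp)))))))
          PA : P w A ≡ P w A₂ + worth w p + worth w v
          PA = trans (∑-− (in-A bv) _) (cong (_+ worth w v) (∑-− p∈A₁ _))
          dv : deg g v A₁ ≡ 3
          dv = trans (sym (deg-− g)) (degree bv)
          dp : deg g p A₂ ≡ 3
          dp = trans (sym (deg-− g)) (Cubic.deg-3 cubic-p ⊆-refl (Cubic.x₁∈ cubic-p) (Cubic.x₂∈ cubic-p) (Cubic.x₃∈ cubic-p))
          QA : Q g A ≡ b * (edges g A₂ + 3 + 3)
          QA = cong (b *_) (trans (edges-− g (in-A bv)) (cong₂ _+_ (trans (edges-− g p∈A₁) (cong (edges g A₂ +_) dp)) dv))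
          arith : ∀ p p₂ e x y h → p + 2 ≤ p₂ + (2 * h + 2) * 6 → (4 * h + 4) * (e + 3 + 3) ≤ p + y + x + 1 →
                  p₂ + 2 ≤ (4 * h + 4) * e → x + suc (2 * h) ≡ 2 * (4 * h + 4) → y + suc (2 * h) ≡ 2 * (4 * h + 4) → ⊥
          arith p p₂ e x y h h₁ h₂ h₃ h₄ h₅ = ⊥-by 0 (h₁ ⊕ h₂ ⊕ h₃ ⊕ ≤-reflexive h₄ ⊕ ≤-reflexive h₅)
            (solve (p ∷ p₂ ∷ e ∷ x ∷ y ∷ h ∷ []))

    -- z has degree 4 and at least three bad neighbours v, p, s; q is its fourth neighbour.
    record Quad (z v p s q : Fin n) : Set where
      field
        bv : Bad v
        bp : Bad p
        bs : Bad s
        v≢p : v ≢ p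
        p≢s : p ≢ s
        s≢v : s ≢ v
        z∈A : z ∈ A
        q∈A : q ∈ A
        q≢v : q ≢ v
        q≢p : q ≢ p
        q≢s : q ≢ s
        mult-z : ∀ u → u ∈ A → mult g z u ≡ ⟦ ⁅ v ⁆ u ⟧ + ⟦ ⁅ p ⁆ u ⟧ + ⟦ ⁅ s ⁆ u ⟧ + ⟦ ⁅ q ⁆ u ⟧

    turn : ∀ {z v p s q} → Quad z v p s q → Quad z p s v q
    turn {z} {v} {p} {s} {q} qd = record
      { bv = bp ; bp = bs ; bs = bv ; v≢p = p≢s ; p≢s = s≢v ; s≢v = v≢p ; z∈A = z∈A ; q∈A = q∈A
      ; q≢v = q≢p ; q≢p = q≢s ; q≢s = q≢v
      ; mult-z = λ u u∈A → trans (mult-z u u∈A) (rot ⟦ ⁅ v ⁆ u ⟧ ⟦ ⁅ p ⁆ u ⟧ ⟦ ⁅ s ⁆ u ⟧ ⟦ ⁅ q ⁆ u ⟧) }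
      where
      open Quad qd
      rot : ∀ a b c d → a + b + c + d ≡ b + c + a + d
      rot = solve-∀

    module Quadruple {z v p s q : Fin n} (qd : Quad z v p s q) where
      open Quad qd

      deg-z-≡ : ∀ {S} → S ⊆ A → deg g z S ≡ ⟦ S v ⟧ + ⟦ S p ⟧ + ⟦ S s ⟧ + ⟦ S q ⟧
      deg-z-≡ {S} S⊆A = begin
        deg g z S
          ≡⟨ ∑-cong S (λ u r → mult-z u (S⊆A u r)) ⟩
        ∑ S (λ u → ⟦ ⁅ v ⁆ u ⟧ + ⟦ ⁅ p ⁆ u ⟧ + ⟦ ⁅ s ⁆ u ⟧ + ⟦ ⁅ q ⁆ u ⟧)
          ≡⟨ trans (∑-+ S _ _) (cong (_+ ∑ S (λ u → ⟦ ⁅ q ⁆ u ⟧)) (trans (∑-+ S _ _) (cong (_+ ∑ S (λ u → ⟦ ⁅ s ⁆ u ⟧)) (∑-+ S _ _)))) ⟩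
        ∑ S (λ u → ⟦ ⁅ v ⁆ u ⟧) + ∑ S (λ u → ⟦ ⁅ p ⁆ u ⟧) + ∑ S (λ u → ⟦ ⁅ s ⁆ u ⟧) + ∑ S (λ u → ⟦ ⁅ q ⁆ u ⟧)
          ≡⟨ cong₂ _+_ (cong₂ _+_ (cong₂ _+_ (∑-indicator S v) (∑-indicator S p)) (∑-indicator S s)) (∑-indicator S q) ⟩
        ⟦ S v ⟧ + ⟦ S p ⟧ + ⟦ S s ⟧ + ⟦ S q ⟧ ∎
        where open ≡-Reasoning

      adjacent : ∀ {u} → u ∈ A → 1 ≤ ⟦ ⁅ v ⁆ u ⟧ + ⟦ ⁅ p ⁆ u ⟧ + ⟦ ⁅ s ⁆ u ⟧ + ⟦ ⁅ q ⁆ u ⟧ → 1 ≤ mult g u z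
      adjacent {u} u∈A r = ≤-trans r (≤-reflexive (trans (sym (mult-z u u∈A)) (mult-sym g z u)))

      self : ∀ (u : Fin n) → 1 ≤ ⟦ ⁅ u ⁆ u ⟧
      self u = ≤-reflexive (cong ⟦_⟧ (sym (inside (∈-⁅⁆ u))))

      vz : 1 ≤ mult g v z
      vz = adjacent (in-A bv) (arith ⟦ ⁅ v ⁆ v ⟧ ⟦ ⁅ p ⁆ v ⟧ ⟦ ⁅ s ⁆ v ⟧ ⟦ ⁅ q ⁆ v ⟧ (self v))
        where
        arith : ∀ x y z t → 1 ≤ x → 1 ≤ x + y + z + t
        arith x y z t r = ≤-by (y + z + t) r (solve (x ∷ y ∷ z ∷ t ∷ []))

      pz : 1 ≤ mult g p z
      pz = adjacent (in-A bp) (arith ⟦ ⁅ v ⁆ p ⟧ ⟦ ⁅ p ⁆ p ⟧ ⟦ ⁅ s ⁆ p ⟧ ⟦ ⁅ q ⁆ p ⟧ (self p))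
        where
        arith : ∀ x y z t → 1 ≤ y → 1 ≤ x + y + z + t
        arith x y z t r = ≤-by (x + z + t) r (solve (x ∷ y ∷ z ∷ t ∷ []))

      sz : 1 ≤ mult g s z
      sz = adjacent (in-A bs) (arith ⟦ ⁅ v ⁆ s ⟧ ⟦ ⁅ p ⁆ s ⟧ ⟦ ⁅ s ⁆ s ⟧ ⟦ ⁅ q ⁆ s ⟧ (self s))
        where
        arith : ∀ x y z t → 1 ≤ z → 1 ≤ x + y + z + t
        arith x y z t r = ≤-by (x + y + t) r (solve (x ∷ y ∷ z ∷ t ∷ []))

      qz : 1 ≤ mult g q z
      qz = adjacent q∈A (arith ⟦ ⁅ v ⁆ q ⟧ ⟦ ⁅ p ⁆ q ⟧ ⟦ ⁅ s ⁆ q ⟧ ⟦ ⁅ q ⁆ q ⟧ (self q))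
        where
        arith : ∀ x y z t → 1 ≤ t → 1 ≤ x + y + z + t
        arith x y z t r = ≤-by (x + y + z) r (solve (x ∷ y ∷ z ∷ t ∷ []))

      open Pair bv bp v≢p
      open Common z∈A vz pz

      z≢s : z ≢ s
      z≢s = ≢-of (mult-irr g s) sz

      z≢q : z ≢ q
      z≢q = ≢-of (mult-irr g q) qz

      A₃ A₄ : VSet n
      A₃ = A₂ − z
      A₄ = A₃ − s

      s∈A₂ : s ∈ A₂
      s∈A₂ = −-∈ (−-∈ (in-A bs) s≢v) (≢-sym p≢s)

      s∈A₃ : s ∈ A₃
      s∈A₃ = −-∈ s∈A₂ (≢-sym z≢s)

      q∈A₃ : q ∈ A₃
      q∈A₃ = −-∈ (−-∈ (−-∈ q∈A q≢v) q≢p) (≢-sym z≢q)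

      A₃⊆A : A₃ ⊆ A
      A₃⊆A = ⊆-trans −-⊆ A₂⊆A

      A₄⊆A : A₄ ⊆ A
      A₄⊆A = ⊆-trans −-⊆ A₃⊆A

      v∉A₂ : v ∉ A₂
      v∉A₂ = ∉-⊆ −-⊆ (−-∉ v)

      deg-z-A₂ : ∀ {S} → S ⊆ A₂ → deg g z S ≡ ⟦ S q ⟧ + ⟦ S s ⟧
      deg-z-A₂ {S} S⊆ = trans (deg-z-≡ (⊆-trans S⊆ A₂⊆A)) (trans
        (cong₂ (λ x y → ⟦ x ⟧ + ⟦ y ⟧ + ⟦ S s ⟧ + ⟦ S q ⟧) (outside (∉-⊆ S⊆ v∉A₂)) (outside (∉-⊆ S⊆ (−-∉ p)))) (+-comm ⟦ S s ⟧ ⟦ S q ⟧))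

      w₂s : w₂ s ≡ h
      w₂s = trans (bump-nonadj {g = g} {w₁} {p} s (independent bp bs)) (trans (bump-nonadj {g = g} {w} {v} s (independent bv bs)) (half bs))

      -- In `A₂` the vertex `z` is forced into `F` and joined only to `q` and `s`; an edge between
      -- these two takes its place.
      H : Graph n
      H = addEdge g q s q≢s

      -- z subdivides the additional edge of H.
      nc-H : ¬ Colorable K H w₂ A₃
      nc-H (c , ok) = nc S₂.minimal (Colorable-⊆ K (⊹-− A₂ z) (_ , add-F K ok (−-∉ z) (λ S _ → edges-addEdge-≥ g q≢s S)
        (λ S S⊆ _ → subst₂ (λ x y → edges g S + x ≤ suc y) (sym (deg-z-A₂ (⊆-trans S⊆ −-⊆))) (sym (edges-addEdge g q≢s S))
          (≤-trans (+-monoʳ-≤ (edges g S) (bool-sum (S q) (S s))) (≤-reflexive (+-suc (edges g S) _))))))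

      -- Replacing `z`, worth `b - 1`, and its two edges by one edge raises the potential by 1, so
      -- `τ` returns from 3 to 2 and a third bad vertex may be deleted.
      sit-H : Situation H w₂ A₃ 2
      sit-H = record { minimal = record { nc = nc-H ; del = del-H } ; high = high-H ; ih = λ lt → S₂.ih (≤-trans lt (∑-⊆ _ −-⊆)) }
        where
        high-H : Q H A₃ ≤ P w₂ A₃ + 2
        high-H = subst (λ x → b * x ≤ P w₂ A₃ + 2) (sym (edges-addEdge-∈ g q≢s q∈A₃ s∈A₃))
          (arith (P w₂ A₃) (edges g A₃) (worth w₂ z) b (subst₂ (λ x y → x ≤ y + 3)
            (cong (b *_) (trans (edges-− g z∈A₂) (cong (edges g A₃ +_) (trans (deg-z-A₂ −-⊆) (cong₂ (λ x y → ⟦ x ⟧ + ⟦ y ⟧) (inside q∈A₃) (inside s∈A₃))))))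
            (∑-− z∈A₂ _) S₂.high) worth₂z)
          where
          arith : ∀ p e x b → b * (e + 2) ≤ p + x + 3 → x + suc b ≡ 2 * b → b * (e + 1) ≤ p + 2
          arith p e x b h₁ h₂ = ≤-by 0 (h₁ ⊕ ≤-reflexive h₂) (solve (p ∷ e ∷ x ∷ b ∷ []))
        del-H : ∀ u → u ∈ A₃ → Colorable K H w₂ (A₃ − u)
        del-H u u∈ = decidable-stable (colorable? K H w₂ _) (λ ¬col →
          contra (S₂.ih (≤-trans (s≤s (∑-⊆ _ (−-⊆ {v = u}))) (≤-reflexive (sym (card-− z∈A₂)))) ¬col))
          where
          module _ {W : VSet n} (W⊆ : W ⊆ A₃ − u) (¬col : ¬ Colorable K H w₂ W) (low : P w₂ W + 2 ≤ Q H W) where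
            W⊆A₃ : W ⊆ A₃
            W⊆A₃ = ⊆-trans W⊆ −-⊆
            W⊆A₂ : W ⊆ A₂
            W⊆A₂ = ⊆-trans W⊆A₃ −-⊆
            u∉W : u ∉ W
            u∉W = ∉-⊆ W⊆ (−-∉ u)
            -- `H` and `g` agree on sets that miss an end of the additional edge, and proper subsets
            -- of `A₂` are colourable.
            missing : q ∉ W ⊎ s ∉ W → ⊥
            missing m = ¬col (let c , ok = C₂.color-proper W⊆A₂ (−-⊆ u u∈) u∉W in
              c , Ok-weaken K ⊆-refl (λ S S⊆ → ≤-reflexive (edges-addEdge-∉ g q≢s (mono S⊆ m))) (λ _ _ _ → ≤-refl) ok)
              where
              mono : ∀ {S} → S ⊆ W → q ∉ W ⊎ s ∉ W → q ∉ S ⊎ s ∉ S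
              mono S⊆ (inj₁ r) = inj₁ (∉-⊆ S⊆ r)
              mono S⊆ (inj₂ r) = inj₂ (∉-⊆ S⊆ r)
            z∉W : z ∉ W
            z∉W = ∉-⊆ W⊆A₃ (−-∉ z)
            both : q ∈ W → s ∈ W → ⊥
            both q∈W s∈W = arith (P w₂ W) (edges g W) (worth w₂ z) b
              (subst₂ (λ x y → x + 2 ≤ y + 3)
                (cong (b *_) (trans (edges-⊹ g z∉W) (cong (edges g W +_) (trans (deg-z-A₂ W⊆A₂) (cong₂ (λ x y → ⟦ x ⟧ + ⟦ y ⟧) (inside q∈W) (inside s∈W))))))
                (P-⊹ w₂ z∉W) (C₂.gap (⊹-⊆ W⊆A₂ z∈A₂) (−-⊆ u u∈) (⊹-∉ u∉W (−-≢ u∈)) (≤-trans (s≤s z≤n) (≤-reflexive (sym (card-⊹ z∉W))))))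
              (subst (λ x → P w₂ W + 2 ≤ b * x) (edges-addEdge-∈ g q≢s q∈W s∈W) low) worth₂z
              where
              arith : ∀ p e x b → b * (e + 2) + 2 ≤ p + x + 3 → p + 2 ≤ b * (e + 1) → x + suc b ≡ 2 * b → ⊥
              arith p e x b h₁ h₂ h₃ = ⊥-by 1 (h₁ ⊕ h₂ ⊕ ≤-reflexive h₃) (solve (p ∷ e ∷ x ∷ b ∷ []))
          contra : (∃[ W ] W ⊆ A₃ − u × ¬ Colorable K H w₂ W × P w₂ W + 2 ≤ Q H W) → ⊥
          contra (W , W⊆ , ¬col , low) with ∈-or-∉ W q | ∈-or-∉ W s
          ... | inj₁ r | inj₁ t = both W⊆ ¬col low r t
          ... | inj₂ r | _ = missing W⊆ ¬col low (inj₁ r)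
          ... | inj₁ _ | inj₂ t = missing W⊆ ¬col low (inj₂ t)

      module SH = Situation sit-H
      module CH = MinimalSet {τ = 2} SH.minimal SH.high SH.ih

      w₃ : Weight n
      w₃ = raise g s w₂

      deg-s : ∀ {S} → S ⊆ A₄ → deg g s S ≤ 2
      deg-s {S} S⊆ = +-cancelʳ-≤ 1 _ 2 (≤-trans (+-monoʳ-≤ (deg g s S) sz)
        (≤-trans (∑-∉ (⊆-trans S⊆ A₄⊆A) z∈A (∉-⊆ (⊆-trans S⊆ −-⊆) (−-∉ z)) (mult g s)) (≤-reflexive (degree bs))))

      -- Once `s` is gone, `z` has only `q` left and can go into `F`; then `s` comes last, using the
      -- reserve in `w₃`.
      nc₃ : ¬ Colorable K g w₃ A₄
      nc₃ (c , ok) = nc S₂.minimal (Colorable-⊆ K cover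
        (add-vertex K (_ , add-leaf-F K ok (∉-⊆ −-⊆ (−-∉ z)) (≤-trans (∑-⊆ _ ∖-⊆) dz≤1))
          (⊹-∉ (−-∉ s) (≢-sym z≢s)) (≤-trans (∑-⊆ _ (⊹-⊆ A₄⊆A z∈A)) (≤-reflexive (degree bs)))
          (subst (λ k → suc k ≤ K) (sym w₂s) suc-h≤K) (λ u _ → raise-≥ g s w₂ u)
          (λ u _ r → ≤-reflexive (trans (cong (λ k → w₂ u + suc k) w₂s) (sym (bump-adj {g = g} {w₂} {s} u r))))))
        where
        dz≤1 : deg g z A₄ ≤ 1
        dz≤1 = ≤-trans (≤-reflexive (trans (deg-z-A₂ (⊆-trans −-⊆ −-⊆)) (cong (λ x → ⟦ A₄ q ⟧ + ⟦ x ⟧) (outside (−-∉ {S = A₃} s)))))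
          (≤-trans (≤-reflexive (+-identityʳ _)) (⟦⟧≤1 (A₄ q)))
          where
          ⟦⟧≤1 : ∀ x → ⟦ x ⟧ ≤ 1
          ⟦⟧≤1 true = ≤-refl
          ⟦⟧≤1 false = z≤n
        cover : A₂ ⊆ (A₄ ⊹ z) ⊹ s
        cover u u∈ with ≡-or-≢ u s | ≡-or-≢ u z
        ... | inj₁ refl | _ = ⊹-∈ _ s
        ... | inj₂ _ | inj₁ refl = ⊹-⊇ u (⊹-∈ A₄ z)
        ... | inj₂ a | inj₂ c = ⊹-⊇ u (⊹-⊇ u (−-∈ (−-∈ u∈ c) a))

      low₃ : ∃[ W ] W ⊆ A₄ × ¬ Colorable K g w₃ W × P w₃ W + 2 ≤ Q g W
      low₃ = SH.ih (≤-reflexive (sym (card-− s∈A₃))) nc₃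

      deg-s-A₃ : deg g s A₃ ≡ 2
      deg-s-A₃ = +-cancelʳ-≡ 1 _ 2 (begin
        deg g s A₃ + 1                        ≡⟨ cong (deg g s A₃ +_) (mult-1 bs z∈A sz) ⟨
        deg g s A₃ + mult g s z               ≡⟨ deg-−-∈ g s z∈A₂ ⟨
        deg g s A₂                            ≡⟨ trans (+-identityʳ _) (+-identityʳ _) ⟨
        deg g s A₂ + 0 + 0                    ≡⟨ cong₂ (λ x y → deg g s A₂ + x + y) (independent bs bp) (independent bs bv) ⟨
        deg g s A₂ + mult g s p + mult g s v  ≡⟨ deg-A₂ s ⟨
        deg g s A                             ≡⟨ degree bs ⟩
        3 ∎)
        where open ≡-Reasoning

      deg-H-s : ∀ S → deg H s S ≡ deg g s S + ⟦ S q ⟧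
      deg-H-s S = trans (∑-cong S (λ u _ → mult-addEdge g q≢s u)) (trans (∑-+ S _ _) (cong (deg g s S +_) (∑-indicator S q)))

      -- Otherwise `s` has three simple neighbours in `H`, and deleting it there leaves `A₄` minimal
      -- with `q` raised as well. In `g`, where `q` is not raised, a proper low subset of `A₄` would
      -- be colourable, while `A₄` itself has paid for only two raises and is not low.
      q-adjacent : 1 ≤ mult g s q
      q-adjacent with mult g s q in eq
      ... | suc _ = s≤s z≤n
      ... | zero = ⊥-elim (contra low₃)
        where
        simple-H : ∀ u → u ∈ A₃ → mult H s u ≤ 1
        simple-H u u∈ with ≡-or-≢ u q
        ... | inj₁ refl = ≤-reflexive (trans (mult-addEdge g q≢s u) (cong₂ _+_ eq (cong ⟦_⟧ (inside (∈-⁅⁆ u)))))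
        ... | inj₂ u≢q = ≤-trans (≤-reflexive (trans (mult-addEdge g q≢s u) (trans (cong (λ x → mult g s u + ⟦ x ⟧) (outside (∉-⁅⁆ u≢q))) (+-identityʳ _))))
                           (simple bs u (A₃⊆A u u∈))
        module S₃ = Situation (reduce sit-H ≤-refl s∈A₃ w₂s
          (cubic H (trans (deg-H-s A₃) (cong₂ _+_ deg-s-A₃ (cong ⟦_⟧ (inside q∈A₃)))) simple-H))
        contra : (∃[ W ] W ⊆ A₄ × ¬ Colorable K g w₃ W × P w₃ W + 2 ≤ Q g W) → ⊥
        contra (W , W⊆ , ¬col , low) with ⊆-or-∃ A₄ W
        ... | inj₂ (u , u∈ , u∉W) = ¬col (let c , ok = del S₃.minimal u u∈ in
          c , Ok-weaken K (⊆-− W⊆ u∉W) (λ S _ → edges-addEdge-≥ g q≢s S)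
            (λ x _ _ → +-monoʳ-≤ (w₂ x) (*-monoˡ-≤ (suc h) (⊓-monoʳ-≤ 1 (mult-addEdge-≥ g q≢s s x)))) ok)
        ... | inj₁ A₄⊆W = arith (P w₂ A₄) (P w₃ A₄) (edges g A₄) (worth w₂ s) h
          (subst₂ (λ x y → b * x ≤ y + 2)
            (trans (edges-addEdge-∈ g q≢s q∈A₃ s∈A₃) (cong (_+ 1) (trans (edges-− g s∈A₃) (cong (edges g A₄ +_) d₄))))
            (∑-− s∈A₃ _) SH.high)
          (raise-P g w₂ s (≤-reflexive d₄))
          (subst₂ (λ x y → x + 2 ≤ y) (P-≗ w₃ W⊆ A₄⊆W) (Q-≗ g W⊆ A₄⊆W) low) (half-worth w₂ w₂s)
          where
          d₄ : deg g s A₄ ≡ 2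
          d₄ = trans (sym (deg-− g)) deg-s-A₃
          arith : ∀ p₂ p₃ e x h → (4 * h + 4) * (e + 2 + 1) ≤ p₂ + x + 2 → p₂ ≤ p₃ + (2 * h + 2) * 2 →
                  p₃ + 2 ≤ (4 * h + 4) * e → x + suc (2 * h) ≡ 2 * (4 * h + 4) → ⊥
          arith p₂ p₃ e x h h₁ h₂ h₃ h₄ = ⊥-by (2 * h) (h₁ ⊕ h₂ ⊕ h₃ ⊕ ≤-reflexive h₄) (solve (p₂ ∷ p₃ ∷ e ∷ x ∷ h ∷ []))

      -- `q` is now joined to all three bad neighbours of `z`, and the edge between `q` and `s` is
      -- doubled in `H`. The cases distinguish how a low subset of `A₄` meets the neighbourhood of
      -- `s`.
      module Special (vq : 1 ≤ mult g v q) (pq : 1 ≤ mult g p q) (sq : 1 ≤ mult g s q) where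

        module Cq = Common q∈A vq pq

        module _ {W : VSet n} (W⊆ : W ⊆ A₄) (¬col : ¬ Colorable K g w₃ W) (low : P w₃ W + 2 ≤ Q g W) where
          W⊆A₃ : W ⊆ A₃
          W⊆A₃ = ⊆-trans W⊆ −-⊆
          W⊆A₂ : W ⊆ A₂
          W⊆A₂ = ⊆-trans W⊆A₃ −-⊆
          W⊆A : W ⊆ A
          W⊆A = ⊆-trans W⊆A₂ A₂⊆A
          s∉W : s ∉ W
          s∉W = ∉-⊆ W⊆ (−-∉ s)
          z∉W : z ∉ W
          z∉W = ∉-⊆ W⊆A₃ (−-∉ z)
          p∉W : p ∉ W
          p∉W = ∉-⊆ W⊆A₂ (−-∉ p)
          edges-H-W : edges H W ≡ edges g W
          edges-H-W = edges-addEdge-∉ g q≢s (inj₂ s∉W)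

          edges-H-Ws : ∀ {d} → deg g s W + ⟦ W q ⟧ ≡ d → edges H (W ⊹ s) ≡ edges g W + d
          edges-H-Ws eq = trans (edges-⊹ H s∉W) (cong₂ _+_ edges-H-W (trans (deg-H-s W) eq))

          two-edges : deg g s W ≡ 2 → q ∈ W → ⊥
          two-edges d q∈W = arith (P w₂ W) (P w₃ W) (edges g W) (worth w₂ s) h
            (subst₂ (λ x y → b * x ≤ y + 2) (edges-H-Ws (cong₂ _+_ d (cong ⟦_⟧ (inside q∈W)))) (P-⊹ w₂ s∉W)
              (CH.floor (⊹-⊆ W⊆A₃ s∈A₃) (≤-trans (s≤s z≤n) (≤-reflexive (sym (card-⊹ s∉W))))))
            (raise-P g w₂ s (≤-reflexive d)) low (half-worth w₂ w₂s)
            where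
            arith : ∀ p₂ p₃ e x h → (4 * h + 4) * (e + 3) ≤ p₂ + x + 2 → p₂ ≤ p₃ + (2 * h + 2) * 2 →
                    p₃ + 2 ≤ (4 * h + 4) * e → x + suc (2 * h) ≡ 2 * (4 * h + 4) → ⊥
            arith p₂ p₃ e x h h₁ h₂ h₃ h₄ = ⊥-by (2 * h) (h₁ ⊕ h₂ ⊕ h₃ ⊕ ≤-reflexive h₄) (solve (p₂ ∷ p₃ ∷ e ∷ x ∷ h ∷ []))

          only-q : deg g s W ≡ 1 → q ∈ W → ⊥
          only-q d q∈W = arith (P w₂ W) (P w₃ W) (edges g W) h
            (subst (λ x → b * x + suc b ≤ P w₂ W + 2) edges-H-W
              (CH.doubled W⊆A₃ s∈A₃ s∉W (nc-card ¬col) (≤-reflexive (sym (trans (deg-H-s W) (cong₂ _+_ d (cong ⟦_⟧ (inside q∈W))))))))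
            (raise-P g w₂ s (≤-reflexive d)) low
            where
            arith : ∀ p₂ p₃ e h → (4 * h + 4) * e + suc (4 * h + 4) ≤ p₂ + 2 → p₂ ≤ p₃ + (2 * h + 2) * 1 → p₃ + 2 ≤ (4 * h + 4) * e → ⊥
            arith p₂ p₃ e h h₁ h₂ h₃ = ⊥-by (2 * h + 2) (h₁ ⊕ h₂ ⊕ h₃) (solve (p₂ ∷ p₃ ∷ e ∷ h ∷ []))

          no-edge : deg g s W ≢ 0
          no-edge d = ¬col (bump-colorable {v = s} d (C₂.color-proper W⊆A₂ z∈A₂ z∉W))

          -- The remaining case: of the neighbours of `s` only the one other than `z` and `q` lies
          -- in `W`. The double edge makes the potential of `(W ⊹ s) ⊹ q` so low that it is all of
          -- `A₃` and `q` has no edge into `W`; the rest can then be coloured by hand.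
          module Pendant (d : deg g s W ≡ 1) (q∉W : q ∉ W) where
            m : ℕ
            m = mult H q s
            2≤m : 2 ≤ m
            2≤m = ≤-trans (+-mono-≤ sq (self q)) (≤-reflexive (trans (sym (mult-addEdge g q≢s q)) (mult-sym H s q)))
            q∉Ws : q ∉ W ⊹ s
            q∉Ws = ⊹-∉ q∉W q≢s
            deg-H-q : deg H q (W ⊹ s) ≡ deg g q W + m
            deg-H-q = trans (∑-⊹ s∉W (mult H q)) (cong (_+ m) (∑-cong W (λ u r → mult-addEdge-≢ g q≢s u (∈-≢ r s∉W))))
            edges-U : edges H ((W ⊹ s) ⊹ q) ≡ edges g W + 1 + (deg g q W + m)
            edges-U = trans (edges-⊹ H q∉Ws) (cong₂ _+_ (edges-H-Ws (cong₂ _+_ d (cong ⟦_⟧ (outside q∉W)))) deg-H-q)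
            P-U : P w₂ ((W ⊹ s) ⊹ q) ≡ P w₂ W + worth w₂ s + worth w₂ q
            P-U = trans (P-⊹ w₂ q∉Ws) (cong (_+ worth w₂ q) (P-⊹ w₂ s∉W))
            U⊆A₃ : (W ⊹ s) ⊹ q ⊆ A₃
            U⊆A₃ = ⊹-⊆ (⊹-⊆ W⊆A₃ s∈A₃) q∈A₃
            1≤U : 1 ≤ card ((W ⊹ s) ⊹ q)
            1≤U = ≤-trans (s≤s z≤n) (≤-reflexive (sym (card-⊹ q∉Ws)))
            pW = raise-P g w₂ s (≤-reflexive d)
            all : A₃ ⊆ (W ⊹ s) ⊹ q
            all with ⊆-or-∃ A₃ ((W ⊹ s) ⊹ q)
            ... | inj₁ r = r
            ... | inj₂ (u , u∈ , u∉) = ⊥-elim (arith (P w₂ W) (P w₃ W) (edges g W) (worth w₂ s) (worth w₂ q) (deg g q W) m h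
              (subst₂ (λ x y → b * x + 2 ≤ y + 2) edges-U P-U (CH.gap U⊆A₃ u∈ u∉ 1≤U)) pW low (half-worth w₂ w₂s) Cq.worth₂z 2≤m)
              where
              arith : ∀ p₂ p₃ e x y D m h → (4 * h + 4) * (e + 1 + (D + m)) + 2 ≤ p₂ + x + y + 2 → p₂ ≤ p₃ + (2 * h + 2) * 1 →
                      p₃ + 2 ≤ (4 * h + 4) * e → x + suc (2 * h) ≡ 2 * (4 * h + 4) → y + suc (4 * h + 4) ≡ 2 * (4 * h + 4) → 2 ≤ m → ⊥
              arith p₂ p₃ e x y D m h h₁ h₂ h₃ h₄ h₅ h₆ = ⊥-by ((4 * h + 4) * D + 1)
                (h₁ ⊕ h₂ ⊕ h₃ ⊕ ≤-reflexive h₄ ⊕ ≤-reflexive h₅ ⊕ scale (4 * h + 4) h₆) (solve (p₂ ∷ p₃ ∷ e ∷ x ∷ y ∷ D ∷ m ∷ h ∷ []))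
            q-isolated : deg g q W ≡ 0
            q-isolated with deg g q W in eq
            ... | zero = refl
            ... | suc D = ⊥-elim (arith (P w₂ W) (P w₃ W) (edges g W) (worth w₂ s) (worth w₂ q) D m h
              (subst₂ (λ x y → b * x ≤ y + 2) (trans edges-U (cong (λ x → edges g W + 1 + (x + m)) eq)) P-U (CH.floor U⊆A₃ 1≤U))
              pW low (half-worth w₂ w₂s) Cq.worth₂z 2≤m)
              where
              arith : ∀ p₂ p₃ e x y D m h → (4 * h + 4) * (e + 1 + (suc D + m)) ≤ p₂ + x + y + 2 → p₂ ≤ p₃ + (2 * h + 2) * 1 →
                      p₃ + 2 ≤ (4 * h + 4) * e → x + suc (2 * h) ≡ 2 * (4 * h + 4) → y + suc (4 * h + 4) ≡ 2 * (4 * h + 4) → 2 ≤ m → ⊥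
              arith p₂ p₃ e x y D m h h₁ h₂ h₃ h₄ h₅ h₆ = ⊥-by ((4 * h + 4) * D + (4 * h + 3))
                (h₁ ⊕ h₂ ⊕ h₃ ⊕ ≤-reflexive h₄ ⊕ ≤-reflexive h₅ ⊕ scale (4 * h + 4) h₆) (solve (p₂ ∷ p₃ ∷ e ∷ x ∷ y ∷ D ∷ m ∷ h ∷ []))

            module _ {c : VSet n} (ok : Ok K g w₂ W c) where
              -- The neighbour of `s` in `W` lies in `M`: otherwise its raise would not matter, and
              -- `c` would colour `W` for `w₃`.
              F-isolated : deg g s (W ∖ c) ≡ 0
              F-isolated with deg g s (W ∩ c) in eq
              ... | zero = ⊥-elim (¬col (c , Ok-weaken K ⊆-refl (λ _ _ → ≤-refl)
                (λ u r t → ≤-reflexive (bump-nonadj {g = g} {w₂} {s} u (∑-≡0 eq u (∩-∈ r (mem t))))) ok))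
              ... | suc k = n≤0⇒n≡0 (+-cancelˡ-≤ 1 _ 0 (≤-trans (+-monoˡ-≤ _ (s≤s (z≤n {k})))
                (≤-reflexive (trans (cong (_+ deg g s (W ∖ c)) (sym eq)) (trans (sym (deg-split g s W c)) d)))))

              -- `q` becomes a component of `M`; `p`, `z` and `s` follow into `F`, each with at most
              -- one edge to the part of `F` already there. The weights `w₁` are kept throughout,
              -- since they hold the reserve for `v`, which comes last.
              c₅ c₆ c₇ c₈ : VSet n
              c₅ = recolor c q true
              c₆ = recolor c₅ p false
              c₇ = recolor c₆ z false
              c₈ = recolor c₇ s false

              A₅ A₆ A₇ A₈ : VSet n
              A₅ = W ⊹ q
              A₆ = A₅ ⊹ p
              A₇ = A₆ ⊹ z
              A₈ = A₇ ⊹ s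

              A₅⊆A : A₅ ⊆ A
              A₅⊆A = ⊹-⊆ W⊆A q∈A
              A₆⊆A : A₆ ⊆ A
              A₆⊆A = ⊹-⊆ A₅⊆A (in-A bp)
              A₈⊆A : A₈ ⊆ A
              A₈⊆A = ⊹-⊆ (⊹-⊆ A₆⊆A z∈A) (in-A bs)

              F₆ : A₆ ∖ c₆ ⊆ (W ∖ c) ⊹ p
              F₆ = ⊆-trans (recolor-F-⊆) (⊹-mono (recolor-M-⊆))

              F₇ : A₇ ∖ c₇ ⊆ ((W ∖ c) ⊹ p) ⊹ z
              F₇ = ⊆-trans (recolor-F-⊆) (⊹-mono F₆)

              p∉A₅ : p ∉ A₅
              p∉A₅ = ⊹-∉ p∉W (≢-sym q≢p)
              z∉A₆ : z ∉ A₆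
              z∉A₆ = ⊹-∉ (⊹-∉ z∉W z≢q) (≢-of (mult-irr g p) pz)
              s∉A₇ : s ∉ A₇
              s∉A₇ = ⊹-∉ (⊹-∉ (⊹-∉ s∉W (≢-sym q≢s)) (≢-sym p≢s)) (≢-sym z≢s)
              v∉A₈ : v ∉ A₈
              v∉A₈ = ⊹-∉ (⊹-∉ (⊹-∉ (⊹-∉ (∉-⊆ W⊆A₂ v∉A₂) (≢-sym q≢v)) v≢p) (≢-sym (≢-of (mult-irr g v) vz))) (≢-sym s≢v)

              ok₅ : Ok K g w₁ A₅ c₅
              ok₅ = add-M K (Ok-weaken K ⊆-refl (λ _ _ → ≤-refl) (λ u _ _ → raise-≥ g p w₁ u) ok) q∉W
                (≤-trans (≤-reflexive dM≡0) z≤n)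
                (≤-trans (s≤s (≤-reflexive (trans (bump-adj {g = g} {w} {v} q vq) (cong (_+ suc h) Cq.unweighted)))) (arith h))
                (λ _ _ → ≤-refl) (λ u r t → ⊥-elim (<-irrefl refl (≤-trans t (≤-reflexive (∑-≡0 dM≡0 u r)))))
                where
                dM≡0 : deg g q (W ∩ c) ≡ 0
                dM≡0 = n≤0⇒n≡0 (≤-trans (∑-⊆ _ ∩-⊆ˡ) (≤-reflexive q-isolated))
                arith : ∀ h → suc (suc h) ≤ 2 * h + 2
                arith h = ≤-by h (z≤n {0}) (solve (h ∷ []))

              ok₆ : Ok K g w₁ A₆ c₆
              ok₆ = add-leaf-F K ok₅ p∉A₅ (≤-trans (∑-⊆ _ (⊆-trans (recolor-M-⊆) ∖-⊆))
                (+-cancelʳ-≤ 2 _ 1 (begin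
                  deg g p W + 2                        ≤⟨ +-monoʳ-≤ (deg g p W) (+-mono-≤ pz pq) ⟩
                  deg g p W + (mult g p z + mult g p q) ≡⟨ +-assoc (deg g p W) _ _ ⟨
                  deg g p W + mult g p z + mult g p q  ≡⟨ cong (_+ mult g p q) (∑-⊹ z∉W (mult g p)) ⟨
                  deg g p (W ⊹ z) + mult g p q         ≤⟨ ∑-∉ (⊹-⊆ W⊆A z∈A) q∈A (⊹-∉ q∉W (≢-sym z≢q)) (mult g p) ⟩
                  deg g p A                            ≡⟨ degree bp ⟩
                  3 ∎)))
                where open ≤-Reasoning

              ok₇ : Ok K g w₁ A₇ c₇
              ok₇ = add-leaf-F K ok₆ z∉A₆ (≤-trans (∑-⊆ _ F₆) (≤-trans (≤-reflexive (deg-z-≡ (⊹-⊆ (⊆-trans ∖-⊆ W⊆A) (in-A bp))))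
                (≤-reflexive (cong₂ _+_ (cong₂ _+_ (cong₂ _+_
                  (cong ⟦_⟧ (outside (⊹-∉ (∉-⊆ (∖-⊆ {T = c}) (∉-⊆ W⊆A₂ v∉A₂)) v≢p)))
                  (cong ⟦_⟧ (inside (⊹-∈ (W ∖ c) p))))
                  (cong ⟦_⟧ (outside (⊹-∉ (∉-⊆ (∖-⊆ {T = c}) s∉W) (≢-sym p≢s)))))
                  (cong ⟦_⟧ (outside (⊹-∉ (∉-⊆ (∖-⊆ {T = c}) q∉W) q≢p)))))))

              ok₈ : Ok K g w₁ A₈ c₈
              ok₈ = add-leaf-F K ok₇ s∉A₇ (≤-trans (∑-⊆ _ F₇) (≤-reflexive (begin
                deg g s (((W ∖ c) ⊹ p) ⊹ z)
                  ≡⟨ ∑-⊹ (⊹-∉ (∉-⊆ ∖-⊆ z∉W) (≢-of (mult-irr g p) pz)) (mult g s) ⟩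
                deg g s ((W ∖ c) ⊹ p) + mult g s z
                  ≡⟨ cong (_+ mult g s z) (∑-⊹ (∉-⊆ ∖-⊆ p∉W) (mult g s)) ⟩
                deg g s (W ∖ c) + mult g s p + mult g s z
                  ≡⟨ cong₂ _+_ (cong₂ _+_ F-isolated (independent bs bp)) (mult-1 bs z∈A sz) ⟩
                1 ∎)))
                where open ≡-Reasoning

              cover : A ⊆ A₈ ⊹ v
              cover u u∈ with ≡-or-≢ u v | ≡-or-≢ u p | ≡-or-≢ u z
              ... | inj₁ refl | _ | _ = ⊹-∈ A₈ u
              ... | inj₂ _ | inj₁ refl | _ = ⊹-⊇ u (⊹-⊇ u (⊹-⊇ u (⊹-∈ A₅ u)))
              ... | inj₂ _ | inj₂ _ | inj₁ refl = ⊹-⊇ u (⊹-⊇ u (⊹-∈ A₆ u))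
              ... | inj₂ r₁ | inj₂ r₂ | inj₂ r₃ = ⊹-⊇ u (⊹-⊆ (⊹-⊆ (⊆-trans ⊹-⊇ in₈) (⊹-∈ A₇ s)) (in₈ q (⊹-∈ W q)) u (all u (−-∈ (−-∈ (−-∈ u∈ r₁) r₂) r₃)))
                where
                in₈ : A₅ ⊆ A₈
                in₈ = ⊆-trans ⊹-⊇ (⊆-trans ⊹-⊇ ⊹-⊇)

              contradictory : ⊥
              contradictory = nc minimal (Colorable-⊆ K cover (add-vertex K (c₈ , ok₈) v∉A₈
                (≤-trans (∑-⊆ _ A₈⊆A) (≤-reflexive (degree bv))) (bad-light bv) (λ u _ → raise-≥ g v w u)
                (λ u _ r → ≤-reflexive (trans (cong (λ k → w u + suc k) (half bv)) (sym (bump-adj {g = g} {w} {v} u r))))))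

        impossible : ⊥
        impossible = go low₃
          where
          go : (∃[ W ] W ⊆ A₄ × ¬ Colorable K g w₃ W × P w₃ W + 2 ≤ Q g W) → ⊥
          go (W , W⊆ , ¬col , low) = split (∈-or-∉ W q) (deg g s W) refl
            where
            z∉ : z ∉ W
            z∉ = z∉W W⊆ ¬col low
            split : q ∈ W ⊎ q ∉ W → ∀ k → deg g s W ≡ k → ⊥
            split _ 0 d = no-edge W⊆ ¬col low d
            split (inj₁ r) 1 d = only-q W⊆ ¬col low d r
            split (inj₁ r) 2 d = two-edges W⊆ ¬col low d r
            split (inj₂ r) 1 d = Pendant.contradictory W⊆ ¬col low d r 
              (proj₂ (C₂.color-proper (⊆-trans W⊆ (⊆-trans −-⊆ −-⊆)) z∈A₂ z∉))
            split (inj₂ r) 2 d = <-irrefl refl (≤-trans (≤-reflexive (cong (_+ 1) (sym (cong₂ _+_ d (mult-1 bs z∈A sz)))))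
              (≤-trans (+-monoʳ-≤ _ sq) (≤-trans (≤-reflexive (cong (_+ mult g s q) (sym (∑-⊹ z∉ (mult g s)))))
                (≤-trans (∑-∉ (⊹-⊆ (⊆-trans W⊆ A₄⊆A) z∈A) q∈A (⊹-∉ r (≢-sym z≢q)) (mult g s)) (≤-reflexive (degree bs))))))
            split _ (suc (suc (suc k))) d = <-irrefl refl (≤-trans (s≤s (s≤s (s≤s z≤n))) (≤-trans (≤-reflexive (sym d)) (deg-s W⊆)))

    -- The three bad neighbours play the same role, so rotating them makes `q` adjacent to each.
    no-quad : ∀ {z v p s q} → ¬ Quad z v p s q
    no-quad qd = Quadruple.Special.impossible qd (Quadruple.q-adjacent (turn qd)) (Quadruple.q-adjacent (turn (turn qd))) (Quadruple.q-adjacent qd)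

    -- Discharging

    bad? : ∀ u → Dec (Bad u)
    bad? u = map′ (λ (a , d , e) → bad (mem a) d e) (λ (bad a d e) → inside a , d , e)
      ((A u Bool.≟ true) ×-dec ((deg g u A ℕ.≟ 3) ×-dec (w u ℕ.≟ h)))

    B O : VSet n
    B u = does (bad? u)
    O = A ∖ B

    B-bad : ∀ {u} → u ∈ B → Bad u
    B-bad {u} (mem r) = witness (bad? u) r

    bad-B : ∀ {u} → Bad u → u ∈ B
    bad-B {u} bu = mem (dec-true (bad? u) bu)

    B⊆A : B ⊆ A
    B⊆A u r = in-A (B-bad r)

    pick : ∀ {z S k} → z ∈ A → S ⊆ B → suc k ≤ deg g z S → ∃[ v ] v ∈ S × Bad v × mult g z v ≡ 1 × k ≤ deg g z (S − v)
    pick {z} {S} {k} z∈A S⊆B r with ∑-pos S (mult g z) (≤-trans (s≤s z≤n) r)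
    ... | v , v∈S , m = v , v∈S , bv , zv , +-cancelʳ-≤ 1 k _ (subst₂ _≤_ (+-comm 1 k) (trans (deg-−-∈ g z v∈S) (cong (deg g z (S − v) +_) zv)) r)
      where
      bv = B-bad (S⊆B v v∈S)
      zv : mult g z v ≡ 1
      zv = trans (mult-sym g z v) (mult-1 bv z∈A (≤-trans m (≤-reflexive (mult-sym g z v))))

    adj : ∀ {z v} → mult g z v ≡ 1 → 1 ≤ mult g v z
    adj {z} {v} eq = ≤-reflexive (sym (trans (mult-sym g v z) eq))

    two-bad : ∀ {z} → z ∈ A → 2 ≤ deg g z B → 4 ≤ deg g z A
    two-bad z∈A r =
      let v , v∈ , bv , zv , r₁ = pick z∈A ⊆-refl r
          p , p∈ , bp , zp , _ = pick z∈A −-⊆ r₁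
      in Pair.Common.deg≥4 bv bp (≢-sym (−-≢ p∈)) z∈A (adj zv) (adj zp)

    fourth : ∀ {z v p s} → z ∈ A → deg g z A ≡ 4 → Bad v → Bad p → Bad s → mult g z v ≡ 1 → mult g z p ≡ 1 → mult g z s ≡ 1 →
             p ∈ B − v → s ∈ (B − v) − p → ⊥
    fourth {z} {v} {p} {s} z∈A d≡4 bv bp bs zv zp zs p∈ s∈ = last-one (∑-pos R (mult g z) (≤-reflexive (sym dR)))
      where
      v≢p : v ≢ p
      v≢p = ≢-sym (−-≢ p∈)
      p≢s : p ≢ s
      p≢s = ≢-sym (−-≢ s∈)
      s≢v : s ≢ v
      s≢v = −-≢ (−-⊆ s s∈)
      R : VSet n
      R = ((A − v) − p) − s
      dR : deg g z R ≡ 1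
      dR = +-cancelʳ-≡ 3 _ 1 (begin
        deg g z R + 3                                          ≡⟨ +-assoc (deg g z R) 1 2 ⟨
        deg g z R + 1 + 2                                      ≡⟨ cong (λ x → deg g z R + x + 2) zs ⟨
        deg g z R + mult g z s + 2                             ≡⟨ cong (_+ 2) (deg-−-∈ g z (−-∈ (−-∈ (in-A bs) s≢v) (≢-sym p≢s))) ⟨
        deg g z ((A − v) − p) + 2                              ≡⟨ +-assoc (deg g z ((A − v) − p)) 1 1 ⟨
        deg g z ((A − v) − p) + 1 + 1                          ≡⟨ cong (λ x → deg g z ((A − v) − p) + x + 1) zp ⟨
        deg g z ((A − v) − p) + mult g z p + 1                 ≡⟨ cong (_+ 1) (deg-−-∈ g z (−-∈ (in-A bp) (≢-sym v≢p))) ⟨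
        deg g z (A − v) + 1                                    ≡⟨ cong (deg g z (A − v) +_) zv ⟨
        deg g z (A − v) + mult g z v                           ≡⟨ deg-−-∈ g z (in-A bv) ⟨
        deg g z A                                              ≡⟨ d≡4 ⟩
        4 ∎)
        where open ≡-Reasoning
      last-one : (∃[ q ] q ∈ R × 1 ≤ mult g z q) → ⊥
      last-one (q , q∈ , m) = no-quad (record
        { bv = bv ; bp = bp ; bs = bs ; v≢p = v≢p ; p≢s = p≢s ; s≢v = s≢v ; z∈A = z∈A
        ; q∈A = −-⊆ q (−-⊆ q (−-⊆ q q∈)) ; q≢v = q≢v ; q≢p = q≢p ; q≢s = q≢s ; mult-z = spec })
        where
        q≢v : q ≢ v
        q≢v = −-≢ (−-⊆ q (−-⊆ q q∈))
        q≢p : q ≢ p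
        q≢p = −-≢ (−-⊆ q q∈)
        q≢s : q ≢ s
        q≢s = −-≢ q∈
        rest : deg g z (R − q) + mult g z q ≡ 1
        rest = trans (sym (deg-−-∈ g z q∈)) dR
        zq : mult g z q ≡ 1
        zq = ≤-antisym (≤-trans (m≤n+m _ (deg g z (R − q))) (≤-reflexive rest)) m
        none : deg g z (R − q) ≡ 0
        none = +-cancelʳ-≡ 1 _ 0 (trans (cong (deg g z (R − q) +_) (sym zq)) rest)
        values : ∀ u {a b c d} → ⁅ v ⁆ u ≡ a → ⁅ p ⁆ u ≡ b → ⁅ s ⁆ u ≡ c → ⁅ q ⁆ u ≡ d →
                 ⟦ a ⟧ + ⟦ b ⟧ + ⟦ c ⟧ + ⟦ d ⟧ ≡ ⟦ ⁅ v ⁆ u ⟧ + ⟦ ⁅ p ⁆ u ⟧ + ⟦ ⁅ s ⁆ u ⟧ + ⟦ ⁅ q ⁆ u ⟧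
        values _ refl refl refl refl = refl
        no! : ∀ {x y : Fin n} → x ≢ y → ⁅ y ⁆ x ≡ false
        no! x≢y = outside (∉-⁅⁆ x≢y)
        yes! : ∀ (x : Fin n) → ⁅ x ⁆ x ≡ true
        yes! x = inside (∈-⁅⁆ x)
        spec : ∀ u → u ∈ A → mult g z u ≡ ⟦ ⁅ v ⁆ u ⟧ + ⟦ ⁅ p ⁆ u ⟧ + ⟦ ⁅ s ⁆ u ⟧ + ⟦ ⁅ q ⁆ u ⟧
        spec u u∈A with ≡-or-≢ u v | ≡-or-≢ u p | ≡-or-≢ u s | ≡-or-≢ u q
        ... | inj₁ refl | _ | _ | _ = trans zv (values u (yes! u) (no! v≢p) (no! (≢-sym s≢v)) (no! (≢-sym q≢v)))
        ... | inj₂ a | inj₁ refl | _ | _ = trans zp (values u (no! a) (yes! u) (no! p≢s) (no! (≢-sym q≢p)))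
        ... | inj₂ a | inj₂ b | inj₁ refl | _ = trans zs (values u (no! a) (no! b) (yes! u) (no! (≢-sym q≢s)))
        ... | inj₂ a | inj₂ b | inj₂ c | inj₁ refl = trans zq (values u (no! a) (no! b) (no! c) (yes! u))
        ... | inj₂ a | inj₂ b | inj₂ c | inj₂ d = trans (∑-≡0 none u (−-∈ (−-∈ (−-∈ (−-∈ u∈A a) b) c) d))
          (values u (no! a) (no! b) (no! c) (no! d))

    three-bad : ∀ {z} → z ∈ A → deg g z A ≡ 4 → 3 ≤ deg g z B → ⊥
    three-bad {z} z∈A d≡4 r =
      let v , v∈ , bv , zv , r₁ = pick z∈A ⊆-refl r
          p , p∈ , bp , zp , r₂ = pick z∈A −-⊆ r₁
          s , s∈ , bs , zs , _ = pick z∈A (⊆-trans −-⊆ −-⊆) r₂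
      in fourth z∈A d≡4 bv bp bs zv zp zs p∈ s∈


    cost-above : ∀ {x} → suc h ≤ x → 2 * h + 2 ≤ cost x
    cost-above {x} r = ⊓-glb (≤-trans (≤-reflexive (eq h)) (*-monoʳ-≤ 2 r)) (+-mono-≤ (*-monoˡ-≤ h {2} {4} (s≤s (s≤s z≤n))) (s≤s (s≤s z≤n)))
      where
      eq : ∀ h → 2 * h + 2 ≡ 2 * suc h
      eq = solve-∀

    -- Below `h` three raises are too cheap for `cubic-cost`, and at `h` the vertex would be bad.
    cubic-heavy : ∀ {z} → z ∈ A → z ∉ B → deg g z A ≡ 3 → suc (w z) ≤ K → suc h ≤ w z
    cubic-heavy {z} z∈A z∉B d≡3 wz≤K with suc h ≤? w z
    ... | yes r = r
    ... | no r with w z ℕ.≟ h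
    ...   | yes e = ⊥-elim (∈∉-⊥ (bad-B (bad z∈A d≡3 e)) z∉B)
    ...   | no e = ⊥-elim (go (cubic-cost z∈A d≡3 wz≤K (subst (λ x → 2 * x ≤ suc b) (sym C≡) (arith₁ h (w z) lt))))
      where
      lt : suc (w z) ≤ h
      lt = ≤∧≢⇒< (s≤s⁻¹ (≰⇒> r)) e
      low-cost : ∀ x → x ≤ h → cost x ≡ 2 * x
      low-cost x q = m≤n⇒m⊓n≡m (≤-trans (*-mono-≤ {2} {4} (s≤s (s≤s z≤n)) q) (m≤m+n (4 * h) 4))
      C≡ : cost (suc (w z)) ≡ 2 * suc (w z)
      C≡ = low-cost (suc (w z)) lt
      c≡ : cost (w z) ≡ 2 * w z
      c≡ = low-cost (w z) (≤-trans (n≤1+n _) lt)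
      arith₁ : ∀ h x → suc x ≤ h → 2 * (2 * suc x) ≤ suc (4 * h + 4)
      arith₁ h x q = ≤-by 5 (scale 4 q) (solve (h ∷ x ∷ []))
      arith₂ : ∀ h x → suc x ≤ h → 4 * h + 4 + 2 + 2 * x ≤ 2 * suc x * 3 → ⊥
      arith₂ h x q t = ⊥-by 3 (scale 4 q ⊕ t) (solve (h ∷ x ∷ []))
      go : ∃[ W ] W ⊆ A − z × deg g z W ≡ 3 × b + 2 + cost (w z) ≤ cost (suc (w z)) * ∑ W (λ u → 1 ⊓ mult g z u) → ⊥
      go (W , W⊆ , d , c) = arith₂ h (w z) lt (subst₂ (λ c C → b + 2 + c ≤ C * 3) c≡ C≡
        (≤-trans c (*-monoʳ-≤ (cost (suc (w z))) (≤-trans (∑⊓≤deg g z W) (≤-reflexive d)))))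

    charge : ∀ {z} → z ∈ A → z ∉ B → 2 * worth w z + 2 ≤ b * deg g z A
    charge {z} z∈A z∉B with K ≤? w z
    ... | yes r = heavy-charge z∈A r
    ... | no r with 4 ≤? deg g z A
    ...   | yes d≥4 = ≤-trans (arith (worth w z) (cost (w z)) b (worth-eq w z)) (*-monoʳ-≤ b d≥4)
      where
      arith : ∀ x c b → x + suc c ≡ 2 * b → 2 * x + 2 ≤ b * 4
      arith x c b h = ≤-by (2 * c) (scale 2 (≤-reflexive h)) (solve (x ∷ c ∷ b ∷ []))
    ...   | no d<4 = subst (λ d → 2 * worth w z + 2 ≤ b * d) (sym d≡3)
        (arith (worth w z) (cost (w z)) h (worth-eq w z) (cost-above (cubic-heavy z∈A z∉B d≡3 (≰⇒> r))))
      where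
      d≡3 : deg g z A ≡ 3
      d≡3 = ≤-antisym (s≤s⁻¹ (≰⇒> d<4)) (min-degree-light z∈A (≰⇒> r))
      arith : ∀ x c h → x + suc c ≡ 2 * (4 * h + 4) → 2 * h + 2 ≤ c → 2 * x + 2 ≤ (4 * h + 4) * 3
      arith x c h p q = ≤-by 0 (scale 2 (≤-reflexive p) ⊕ scale 2 q) (solve (x ∷ c ∷ h ∷ []))

    -- Charges are multiplied by 6 from here on: a bad vertex has excess 6 and gives 2 to each
    -- neighbour. At an exceptional vertex the bound of `weak-charge` is an equality,
    -- `6 * (2 * b - 1) + 4 + 2 = 12 * b`.
    Exceptional : Fin n → Set
    Exceptional z = deg g z A ≡ 4 × deg g z B ≡ 2 × w z ≡ 0

    -- Every bad vertex distributes its excess equally among its three neighbours.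
    final-charge : ∀ {z} → z ∈ A → z ∉ B → 6 * worth w z + 2 * deg g z B + 3 ≤ 3 * (b * deg g z A) ⊎ Exceptional z
    final-charge {z} z∈A z∉B with deg g z B ≤? 1
    ... | yes r = inj₁ (arith (worth w z) (deg g z B) (b * deg g z A) (charge z∈A z∉B) r)
      where
      arith : ∀ x β y → 2 * x + 2 ≤ y → β ≤ 1 → 6 * x + 2 * β + 3 ≤ 3 * y
      arith x β y h₁ h₂ = ≤-by 1 (scale 3 h₁ ⊕ scale 2 h₂) (solve (x ∷ β ∷ y ∷ []))
    ... | no r with deg g z A ℕ.≟ 4
    ...   | no d≢4 = inj₁ (subst (λ d → 6 * worth w z + 2 * deg g z B + 3 ≤ 3 * (b * d)) (m+[n∸m]≡n 5≤d)
        (arith (worth w z) (cost (w z)) (deg g z B) (deg g z A ∸ 5) h (worth-eq w z)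
          (≤-trans (∑-⊆ _ B⊆A) (≤-reflexive (sym (m+[n∸m]≡n 5≤d))))))
      where
      5≤d : 5 ≤ deg g z A
      5≤d = ≤∧≢⇒< (two-bad z∈A (≰⇒> r)) (≢-sym d≢4)
      arith : ∀ x c β k h → x + suc c ≡ 2 * (4 * h + 4) → β ≤ 5 + k → 6 * x + 2 * β + 3 ≤ 3 * ((4 * h + 4) * (5 + k))
      arith x c β k h h₁ h₂ = ≤-by (6 * c + 5 + 12 * h + 12 * h * k + 10 * k) (scale 6 (≤-reflexive h₁) ⊕ scale 2 h₂)
        (solve (x ∷ c ∷ β ∷ k ∷ h ∷ []))
    ...   | yes d≡4 = exact
      where
      β≡2 : deg g z B ≡ 2
      β≡2 = ≤-antisym (s≤s⁻¹ (≰⇒> (three-bad z∈A d≡4))) (≰⇒> r)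
      exact : 6 * worth w z + 2 * deg g z B + 3 ≤ 3 * (b * deg g z A) ⊎ Exceptional z
      exact with w z ℕ.≟ 0
      ... | yes e = inj₂ (d≡4 , β≡2 , e)
      ... | no e = inj₁ (subst₂ (λ β d → 6 * worth w z + 2 * β + 3 ≤ 3 * (b * d)) (sym β≡2) (sym d≡4)
        (arith (worth w z) (cost (w z)) b (worth-eq w z) (⊓-glb (*-monoʳ-≤ 2 (n≢0⇒n>0 e)) (≤-trans (n≤1+n 2) 3≤b))))
        where
        arith : ∀ x c b → x + suc c ≡ 2 * b → 2 ≤ c → 6 * x + 2 * 2 + 3 ≤ 3 * (b * 4)
        arith x c b h₁ h₂ = ≤-by 11 (scale 6 (≤-reflexive h₁) ⊕ scale 6 h₂) (solve (x ∷ c ∷ b ∷ []))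

    weak-charge : ∀ z → z ∈ O → 6 * worth w z + 2 * deg g z B + 2 ≤ 3 * (b * deg g z A)
    weak-charge z z∈O with final-charge (∖-⊆ z z∈O) (∖-∉ {S = A} z∈O)
    ... | inj₁ r = ≤-trans (+-monoʳ-≤ (6 * worth w z + 2 * deg g z B) (n≤1+n 2)) r
    ... | inj₂ (d , β , e) = subst₂ (λ β d → 6 * worth w z + 2 * β + 2 ≤ 3 * (b * d)) (sym β) (sym d)
        (arith (worth w z) (cost (w z)) b (worth-eq w z))
      where
      arith : ∀ x c b → x + suc c ≡ 2 * b → 6 * x + 2 * 2 + 2 ≤ 3 * (b * 4)
      arith x c b h = ≤-by (6 * c) (scale 6 (≤-reflexive h)) (solve (x ∷ c ∷ b ∷ []))

    deg-BO : ∀ u → deg g u A ≡ deg g u B + deg g u O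
    deg-BO u = ∑-part (part-⊆ B⊆A) (mult g u)

    deg-B-0 : ∀ {u} → u ∈ B → deg g u B ≡ 0
    deg-B-0 u∈B = ∑-0 B (λ x x∈B → independent (B-bad u∈B) (B-bad x∈B))

    deg-O-3 : ∀ {u} → u ∈ B → deg g u O ≡ 3
    deg-O-3 {u} u∈B = trans (sym (trans (deg-BO u) (cong (_+ deg g u O) (deg-B-0 u∈B)))) (degree (B-bad u∈B))

    sum-β : ∑ O (λ z → deg g z B) ≡ 3 * card B
    sum-β = trans (deg-∑-swap g O B) (trans (∑-cong B (λ u u∈B → deg-O-3 u∈B)) (∑-* B 3 (λ _ → 1)))

    private
      lhs : Fin n → ℕ
      lhs z = 6 * worth w z + 2 * deg g z B + 2

    -- The sixfold charges sum to six times the potential, at least -6, and after discharging each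
    -- vertex of `O` has at most -2. The slack `ε` serves to show that with three vertices in `O` no
    -- charge can be lower.
    count : ∀ ε → ∑ O lhs + ε ≤ ∑ O (λ z → 3 * (b * deg g z A)) → 2 * card O + ε ≤ 6
    count ε r = arith (P w B) (P w O) (∑ B d) (∑ O d) (card B) (card O) (Q g A) h ε
      (subst₂ (λ x y → x + ε ≤ y)
        (trans (∑-+ O _ _) (cong₂ _+_ (trans (∑-+ O _ _) (cong₂ _+_ (∑-* O 6 _) (trans (∑-* O 2 _) (cong (2 *_) sum-β)))) (∑-* O 2 (λ _ → 1))))
        (trans (∑-* O 3 _) (cong (3 *_) (∑-* O b _))) r)
      P-B D-B total (subst (λ x → Q g A ≤ x + 1) (∑-part (part-⊆ B⊆A) _) high)
      where
      d : Fin n → ℕ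
      d z = deg g z A
      P-B : 2 * P w B ≡ (12 * h + 14) * card B
      P-B = trans (sym (∑-* B 2 _)) (trans (∑-cong B (λ u u∈B → bad-worth (worth w u) h (half-worth w (half (B-bad u∈B)))))
        (∑-* B (12 * h + 14) (λ _ → 1)))
        where
        bad-worth : ∀ x h → x + suc (2 * h) ≡ 2 * (4 * h + 4) → 2 * x ≡ (12 * h + 14) * 1
        bad-worth x h eq = +-cancelʳ-≡ (2 * suc (2 * h)) _ _ (trans (e₁ x h) (trans (cong (2 *_) eq) (e₂ h)))
          where
          e₁ : ∀ x h → 2 * x + 2 * suc (2 * h) ≡ 2 * (x + suc (2 * h))
          e₁ = solve-∀
          e₂ : ∀ h → 2 * (2 * (4 * h + 4)) ≡ (12 * h + 14) * 1 + 2 * suc (2 * h)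
          e₂ = solve-∀
      D-B : ∑ B d ≡ 3 * card B
      D-B = trans (∑-cong B (λ u u∈B → degree (B-bad u∈B))) (∑-* B 3 (λ _ → 1))
      total : b * (∑ B d + ∑ O d) ≡ 2 * Q g A
      total = trans (cong (b *_) (trans (sym (∑-part (part-⊆ B⊆A) d)) (handshake g A))) (*-swap b 2 (edges g A))
      arith : ∀ pB pO dB dO nB nO q h ε → 6 * pO + 2 * (3 * nB) + 2 * nO + ε ≤ 3 * ((4 * h + 4) * dO) →
              2 * pB ≡ (12 * h + 14) * nB → dB ≡ 3 * nB → (4 * h + 4) * (dB + dO) ≡ 2 * q → q ≤ pB + pO + 1 → 2 * nO + ε ≤ 6
      arith pB pO dB dO nB nO q h ε h₁ h₂ h₃ h₄ h₅ = ≤-by 0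
        (h₁ ⊕ scale 3 (≤-reflexive h₂) ⊕ scale (3 * (4 * h + 4)) (≤-reflexive (sym h₃)) ⊕ scale 3 (≤-reflexive h₄) ⊕ scale 6 h₅)
        (solve (pB ∷ pO ∷ dB ∷ dO ∷ nB ∷ nO ∷ q ∷ h ∷ ε ∷ []))

    card-O≤3 : card O ≤ 3
    card-O≤3 = *-cancelˡ-≤ 2 (subst (_≤ 6) (+-identityʳ (2 * card O))
      (count 0 (subst (_≤ ∑ O (λ z → 3 * (b * deg g z A))) (sym (+-identityʳ (∑ O lhs))) (∑-mono O weak-charge))))

    exceptional : 3 ≤ card O → ∀ z → z ∈ O → Exceptional z
    exceptional 3≤O z z∈O with final-charge (∖-⊆ z z∈O) (∖-∉ {S = A} z∈O)
    ... | inj₂ e = e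
    ... | inj₁ r = ⊥-elim (<-irrefl refl (≤-trans (s≤s (*-monoʳ-≤ 2 3≤O)) (subst (_≤ 6) (+-comm (2 * card O) 1)
      (count 1 (∑-mono-at O 1 weak-charge z∈O (≤-trans (≤-reflexive (+-assoc (6 * worth w z + 2 * deg g z B) 2 1)) r))))))

    no-bad : card B ≢ 0
    no-bad eq = arith (P w A) (Q g A) (card A) (subst₂ _≤_
        (trans (∑-+ A _ _) (cong₂ _+_ (∑-* A 2 _) (∑-* A 2 (λ _ → 1))))
        (trans (∑-* A b _) (trans (cong (b *_) (handshake g A)) (*-swap b 2 (edges g A))))
        (∑-mono A (λ v v∈A → charge v∈A (card-0 eq v)))) high (nc-card (nc minimal))
      where
      arith : ∀ x y k → 2 * x + 2 * k ≤ 2 * y → y ≤ x + 1 → 2 ≤ k → ⊥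
      arith x y k h₁ h₂ h₃ = ⊥-by 1 (h₁ ⊕ scale 2 h₂ ⊕ scale 2 h₃) (solve (x ∷ y ∷ k ∷ []))

    -- The last configuration: three vertices in `O` and two in `B`

    module Last {v : Fin n} (v∈B : v ∈ B) (cu : Cubic g A v) where
      bv : Bad v
      bv = B-bad v∈B

      open Cubic cu

      one : ∀ {x y z} → ⟦ x ⟧ + ⟦ y ⟧ + ⟦ z ⟧ ≡ 3 → x ≡ true × y ≡ true × z ≡ true
      one {true} {true} {true} _ = refl , refl , refl
      one {true} {true} {false} ()
      one {true} {false} {true} ()
      one {true} {false} {false} ()
      one {false} {true} {true} ()
      one {false} {true} {false} ()
      one {false} {false} {true} ()
      one {false} {false} {false} ()

      in-O : x₁ ∈ O × x₂ ∈ O × x₃ ∈ O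
      in-O = let p , q , r = one (trans (sym (deg-≡ ∖-⊆)) (deg-O-3 v∈B)) in mem p , mem q , mem r

      x₁∈O = proj₁ in-O
      x₂∈O = proj₁ (proj₂ in-O)
      x₃∈O = proj₂ (proj₂ in-O)

      R : VSet n
      R = ((O − x₁) − x₂) − x₃

      x₂∈′ : x₂ ∈ O − x₁
      x₂∈′ = −-∈ x₂∈O (≢-sym x₁≢x₂)

      x₃∈′ : x₃ ∈ (O − x₁) − x₂
      x₃∈′ = −-∈ (−-∈ x₃∈O x₃≢x₁) (≢-sym x₂≢x₃)

      card-O : card O ≡ 3 + card R
      card-O = trans (card-− x₁∈O) (cong suc (trans (card-− x₂∈′) (cong suc (card-− x₃∈′))))

      R-empty : card R ≡ 0
      R-empty = n≤0⇒n≡0 (+-cancelˡ-≤ 3 _ 0 (subst (_≤ 3) card-O card-O≤3))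

      ∑-O : ∀ f → ∑ O f ≡ f x₃ + f x₂ + f x₁
      ∑-O f = trans (∑-− x₁∈O f) (cong (_+ f x₁) (trans (∑-− x₂∈′ f) (cong (_+ f x₂) (trans (∑-− x₃∈′ f) (cong (_+ f x₃) (∑-card-0 R-empty f))))))

      O-cases : ∀ u → u ∈ O → u ≡ x₁ ⊎ u ≡ x₂ ⊎ u ≡ x₃
      O-cases u u∈O with ≡-or-≢ u x₁ | ≡-or-≢ u x₂ | ≡-or-≢ u x₃
      ... | inj₁ r | _ | _ = inj₁ r
      ... | inj₂ _ | inj₁ r | _ = inj₂ (inj₁ r)
      ... | inj₂ _ | inj₂ _ | inj₁ r = inj₂ (inj₂ r)
      ... | inj₂ r₁ | inj₂ r₂ | inj₂ r₃ = ⊥-elim (∈∉-⊥ (−-∈ (−-∈ (−-∈ u∈O r₁) r₂) r₃) (card-0 R-empty u))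

      exc : ∀ z → z ∈ O → Exceptional z
      exc = exceptional (≤-trans (m≤m+n 3 (card R)) (≤-reflexive (sym card-O)))

      deg-O-2 : ∀ {z} → z ∈ O → mult g z x₃ + mult g z x₂ + mult g z x₁ ≡ 2
      deg-O-2 {z} z∈O = let d , β , _ = exc z z∈O in
        trans (sym (∑-O (mult g z))) (+-cancelˡ-≡ 2 _ 2 (trans (cong (_+ deg g z O) (sym β)) (trans (sym (deg-BO z)) d)))

      -- Three multiplicities whose pairwise sums are all 2 are equal to 1, so `O` spans a triangle.
      x₂x₁ : mult g x₂ x₁ ≤ 1
      x₂x₁ = arith (mult g x₂ x₁) (mult g x₃ x₁) (mult g x₃ x₂)
        (trans (cong₂ _+_ (cong₂ _+_ (mult-sym g x₃ x₁) (mult-sym g x₂ x₁)) (sym (mult-irr g x₁))) (deg-O-2 x₁∈O))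
        (trans (cong₂ _+_ (cong₂ _+_ (mult-sym g x₃ x₂) (sym (mult-irr g x₂))) refl) (deg-O-2 x₂∈O))
        (trans (cong₂ _+_ (cong₂ _+_ (sym (mult-irr g x₃)) refl) refl) (deg-O-2 x₃∈O))
        where
        arith : ∀ a b c → b + a + 0 ≡ 2 → c + 0 + a ≡ 2 → 0 + c + b ≡ 2 → a ≤ 1
        arith a b c h₁ h₂ h₃ = *-cancelˡ-≤ 2 (≤-by 0 (≤-reflexive h₁ ⊕ ≤-reflexive h₂ ⊕ ≤-reflexive (sym h₃)) (solve (a ∷ b ∷ c ∷ [])))

      bad-x₁ : ∀ {u} → u ∈ B → mult g u x₁ ≡ 1
      bad-x₁ {u} u∈B = ≤-antisym (le x₁∈O) (arith (mult g u x₁) (mult g u x₂) (mult g u x₃)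
        (trans (sym (∑-O (mult g u))) (deg-O-3 u∈B)) (le x₂∈O) (le x₃∈O))
        where
        le : ∀ {x} → x ∈ O → mult g u x ≤ 1
        le x∈O = simple (B-bad u∈B) _ (∖-⊆ _ x∈O)
        arith : ∀ a b c → c + b + a ≡ 3 → b ≤ 1 → c ≤ 1 → 1 ≤ a
        arith a b c h₁ h₂ h₃ = ≤-by 0 (≤-reflexive (sym h₁) ⊕ h₂ ⊕ h₃) (solve (a ∷ b ∷ c ∷ []))

      card-B : card B ≡ 2
      card-B = trans (sym (∑-cong B (λ u u∈B → trans (mult-sym g x₁ u) (bad-x₁ u∈B)))) (proj₁ (proj₂ (exc x₁ x₁∈O)))

      module Partner {p : Fin n} (p∈ : p ∈ B − v) where
        bp : Bad p
        bp = B-bad (−-⊆ p p∈)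

        p≢v : p ≢ v
        p≢v = −-≢ p∈

        B-cases : ∀ u → u ∈ B → u ≡ v ⊎ u ≡ p
        B-cases u u∈B with ≡-or-≢ u v | ≡-or-≢ u p
        ... | inj₁ r | _ = inj₁ r
        ... | inj₂ _ | inj₁ r = inj₂ r
        ... | inj₂ r₁ | inj₂ r₂ = ⊥-elim (∈∉-⊥ (−-∈ (−-∈ u∈B r₁) r₂)
          (card-0 (suc-injective (suc-injective (trans (cong suc (sym (card-− p∈))) (trans (sym (card-− v∈B)) card-B)))) u))

        ∉O-≢ : ∀ {u x} → u ∈ B → x ∈ O → x ≢ u
        ∉O-≢ u∈B x∈O refl = ∈∉-⊥ u∈B (∖-∉ {S = A} x∈O)

        -- The extra unit reserves room for `x₂`, which joins `x₁` in `M`, while `x₃` with `v` and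
        -- `p` forms a star in `F`. Two vertices of weight 0 fit into one component because `2 ≤ K`.
        w′ : Weight n
        w′ u = suc (w u)

        F₀ F₁ F₂ F₃ c₀ c₁ c₂ c₃ : VSet n
        F₀ = ⁅ x₃ ⁆
        F₁ = F₀ ⊹ v
        F₂ = F₁ ⊹ p
        F₃ = F₂ ⊹ x₁
        c₀ _ = false
        c₁ = recolor c₀ v false
        c₂ = recolor c₁ p false
        c₃ = recolor c₂ x₁ true

        still-F : ∀ {c : VSet n} (x : Fin n) → (∀ u → c u ≡ false) → ∀ u → recolor c x false u ≡ false
        still-F {c} x all-false u with ≡-or-≢ u x
        ... | inj₁ refl = recolor-≡ c u false
        ... | inj₂ u≢x = trans (recolor-≢ c false u≢x) (all-false u)

        c₂-F : ∀ u → c₂ u ≡ false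
        c₂-F = still-F {c₁} p (still-F {c₀} v (λ _ → refl))

        no-M : ∀ {S} u → u ∈ S ∩ c₂ → ⊥
        no-M {S} u r = contradiction (trans (sym (inside (∩-⊆ʳ {S = S} u r))) (c₂-F u)) λ ()

        M₃ : ∀ u → u ∈ F₃ ∩ c₃ → u ≡ x₁
        M₃ u r with ≡-or-≢ u x₁
        ... | inj₁ e = e
        ... | inj₂ u≢x₁ = contradiction (trans (sym (inside (∩-⊆ʳ {S = F₃} u r)))
          (trans (recolor-≢ c₂ true u≢x₁) (c₂-F u))) λ ()

        v∉F₀ : v ∉ F₀
        v∉F₀ = ∉-⁅⁆ (≢-sym (∉O-≢ v∈B x₃∈O))

        ok₀ : Ok K g w′ F₀ c₀
        ok₀ = all-F (≤-reflexive (∑-⁅⁆ x₃ _))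

        ok₁ : Ok K g w′ F₁ c₁
        ok₁ = add-leaf-F K ok₀ v∉F₀ (≤-trans (∑-⊆ _ ∖-⊆) (≤-trans (≤-reflexive (∑-⁅⁆ x₃ _)) (simple bv x₃ x₃∈)))

        ok₂ : Ok K g w′ F₂ c₂
        ok₂ = add-leaf-F K ok₁ (⊹-∉ (∉-⁅⁆ (≢-sym (∉O-≢ (−-⊆ p p∈) x₃∈O))) p≢v)
          (≤-trans (∑-⊆ _ ∖-⊆) (≤-trans (≤-reflexive (∑-⊹ v∉F₀ (mult g p)))
            (+-mono-≤ (≤-trans (≤-reflexive (∑-⁅⁆ x₃ (mult g p))) (simple bp x₃ x₃∈)) (≤-reflexive (independent bp bv)))))

        ok₃ : Ok K g w′ F₃ c₃
        ok₃ = add-M K ok₂ (⊹-∉ (⊹-∉ (∉-⁅⁆ (≢-sym x₃≢x₁)) (∉O-≢ v∈B x₁∈O)) (∉O-≢ (−-⊆ p p∈) x₁∈O))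
          (≤-trans (≤-reflexive (∑-0 (F₂ ∩ c₂) (λ u r → ⊥-elim (no-M {F₂} u r)))) z≤n)
          (subst (λ x → suc (suc x) ≤ K) (sym (proj₂ (proj₂ (exc x₁ x₁∈O)))) (m≤n+m 2 (2 * h)))
          (λ _ _ → ≤-refl) (λ u r → ⊥-elim (no-M {F₂} u r))

        ok₄ : Ok K g w (F₃ ⊹ x₂) (recolor c₃ x₂ true)
        ok₄ = add-M K ok₃ (⊹-∉ (⊹-∉ (⊹-∉ (∉-⁅⁆ x₂≢x₃) (∉O-≢ v∈B x₂∈O)) (∉O-≢ (−-⊆ p p∈) x₂∈O)) (≢-sym x₁≢x₂))
          (≤-trans (∑-⊆ _ (λ u r → subst (λ y → y ∈ ⁅ x₁ ⁆) (sym (M₃ u r)) (∈-⁅⁆ x₁))) (≤-trans (≤-reflexive (∑-⁅⁆ x₁ (mult g x₂))) x₂x₁))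
          (subst (λ x → suc x ≤ K) (sym wx₂) (≤-trans (n≤1+n 1) (m≤n+m 2 (2 * h))))
          (λ u _ → n≤1+n (w u)) (λ u _ _ → ≤-reflexive (trans (cong (λ x → w u + suc x) wx₂) (+-comm (w u) 1)))
          where
          wx₂ : w x₂ ≡ 0
          wx₂ = proj₂ (proj₂ (exc x₂ x₂∈O))

        cover : A ⊆ F₃ ⊹ x₂
        cover u u∈A = go (∈-or-∉ B u)
          where
          in-O′ : u ≡ x₁ ⊎ u ≡ x₂ ⊎ u ≡ x₃ → u ∈ F₃ ⊹ x₂
          in-O′ (inj₁ refl) = ⊹-⊇ u (⊹-∈ F₂ u)
          in-O′ (inj₂ (inj₁ refl)) = ⊹-∈ F₃ u
          in-O′ (inj₂ (inj₂ refl)) = ⊹-⊇ u (⊹-⊇ u (⊹-⊇ u (⊹-⊇ u (∈-⁅⁆ u))))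
          in-B : u ≡ v ⊎ u ≡ p → u ∈ F₃ ⊹ x₂
          in-B (inj₁ refl) = ⊹-⊇ u (⊹-⊇ u (⊹-⊇ u (⊹-∈ F₀ u)))
          in-B (inj₂ refl) = ⊹-⊇ u (⊹-⊇ u (⊹-∈ F₁ u))
          go : u ∈ B ⊎ u ∉ B → u ∈ F₃ ⊹ x₂
          go (inj₁ r) = in-B (B-cases u r)
          go (inj₂ r) = in-O′ (O-cases u (∖-∈ u∈A r))

      impossible : ⊥
      impossible = let p , p∈ = card-∈ (B − v) (≤-reflexive (suc-injective (trans (sym card-B) (card-− v∈B)))) in
        nc minimal (_ , Ok-⊆ K (Partner.cover p∈) (Partner.ok₄ p∈))

    impossible : ⊥
    impossible = let v , v∈B = card-∈ B (n≢0⇒n>0 no-bad) in Last.impossible v∈B (cubic-bad (B-bad v∈B))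

  theorem : ∀ n N → Extremal n N
  theorem = extremal (λ minimal high ih → Main.impossible (record { minimal = minimal ; high = high ; ih = ih }))

-- Cardinalities, images and enumerations

card-full : card (full {n}) ≡ n
card-full {zero} = n≤0⇒n≡0 (≮⇒≥ λ r → contradiction (proj₁ (card-∈ (full {0}) r)) λ ())
card-full {suc n} = trans (∑-full-suc (λ _ → 1)) (cong suc card-full)

∑-full : (T : VSet n) → ∑ full (λ u → ⟦ T u ⟧) ≡ card T
∑-full T = trans (∑-cong full (λ u _ → sym (*-identityʳ ⟦ T u ⟧))) (sym (∑-restrict ⊆-full (λ _ → 1)))

card-injective : ∀ {j} {T : VSet n} (f : Fin j → Fin n) → Injective _≡_ _≡_ f → (∀ i → f i ∈ T) → j ≤ card T
card-injective {j = zero} f inj f∈ = z≤n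
card-injective {j = suc j} {T} f inj f∈ = subst (suc j ≤_) (sym (card-− (f∈ fzero)))
  (s≤s (card-injective (f ∘ fsuc) (λ eq → fsuc-inj (inj eq)) (λ i → −-∈ (f∈ (fsuc i)) (λ eq → contradiction (inj eq) λ ()))))
  where
  fsuc-inj : ∀ {k} {x y : Fin k} → fsuc x ≡ fsuc y → x ≡ y
  fsuc-inj refl = refl

image : ∀ {j} → (Fin j → Fin n) → VSet n
image f u = does (any? (λ i → f i ≟ u))

image-∈ : ∀ {j} (f : Fin j → Fin n) i → f i ∈ image f
image-∈ f i = mem (dec-true (any? (λ j → f j ≟ f i)) (i , refl))

image-inv : ∀ {j} (f : Fin j → Fin n) {u} → u ∈ image f → ∃[ i ] f i ≡ u
image-inv f {u} (mem p) = witness (any? (λ i → f i ≟ u)) p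

card-image : ∀ {j} (f : Fin j → Fin n) → card (image f) ≤ j
card-image {j = zero} f = ≮⇒≥ λ r → contradiction (proj₁ (image-inv f (proj₂ (card-∈ (image f) r)))) λ ()
card-image {j = suc j} f = ≤-trans (∑-⊆ _ sub) (step (∈-or-∉ I (f fzero)))
  where
  I = image (f ∘ fsuc)
  sub : image f ⊆ I ⊹ f fzero
  sub u p with image-inv f p
  ... | fzero , refl = ⊹-∈ I (f fzero)
  ... | fsuc i , refl = ⊹-⊇ _ (image-∈ (f ∘ fsuc) i)
  step : f fzero ∈ I ⊎ f fzero ∉ I → card (I ⊹ f fzero) ≤ suc j
  step (inj₁ p) = ≤-trans (∑-⊆ _ (⊹-⊆ ⊆-refl p)) (≤-trans (card-image (f ∘ fsuc)) (n≤1+n j))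
  step (inj₂ p) = ≤-trans (≤-reflexive (card-⊹ p)) (s≤s (card-image (f ∘ fsuc)))

record Enumeration {n} (T : VSet n) (k : ℕ) : Set where
  field
    at : Fin k → Fin n
    at-injective : Injective _≡_ _≡_ at
    at-∈ : ∀ i → at i ∈ T
    index : ∀ v → v ∈ T → ∃[ i ] at i ≡ v
    reindex : ∀ f → ∑ T f ≡ ∑ full (f ∘ at)

enumerate : (T : VSet n) (k : ℕ) → card T ≡ k → Enumeration T k
enumerate T zero eq = record
  { at = λ () ; at-injective = λ { {()} } ; at-∈ = λ ()
  ; index = λ v v∈T → ⊥-elim (∈∉-⊥ v∈T (card-0 eq v))
  ; reindex = λ f → trans (∑-card-0 eq f) (sym (∑-0 full (λ ()))) }
enumerate {n} T (suc k) eq = extend (card-∈ T (≤-trans (s≤s z≤n) (≤-reflexive (sym eq))))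
  where
  extend : (∃[ x ] x ∈ T) → Enumeration T (suc k)
  extend (x , x∈T) = record { at = at′ ; at-injective = inj ; at-∈ = in-T ; index = ind ; reindex = re }
    where
    open Enumeration (enumerate (T − x) k (suc-injective (trans (sym (card-− x∈T)) eq)))
    at′ : Fin (suc k) → Fin n
    at′ fzero = x
    at′ (fsuc i) = at i
    inj : Injective _≡_ _≡_ at′
    inj {fzero} {fzero} _ = refl
    inj {fzero} {fsuc j} e = ⊥-elim (−-≢ (at-∈ j) (sym e))
    inj {fsuc i} {fzero} e = ⊥-elim (−-≢ (at-∈ i) e)
    inj {fsuc i} {fsuc j} e = cong fsuc (at-injective e)
    in-T : ∀ i → at′ i ∈ T
    in-T fzero = x∈T
    in-T (fsuc i) = −-⊆ _ (at-∈ i)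
    ind : ∀ v → v ∈ T → ∃[ i ] at′ i ≡ v
    ind v v∈T with ≡-or-≢ v x
    ... | inj₁ e = fzero , sym e
    ... | inj₂ v≢x = let i , e = index v (−-∈ v∈T v≢x) in fsuc i , e
    re : ∀ f → ∑ T f ≡ ∑ full (f ∘ at′)
    re f = trans (∑-− x∈T f) (trans (cong (_+ f x) (reindex f)) (trans (+-comm _ (f x)) (sym (∑-full-suc (f ∘ at′)))))

-- Edge counts and the cycles and components of a multigraph

module FromMultigraph (G : Multigraph) where
  src tgt : Fin (nE G) → Fin (nV G)
  src e = proj₁ (ends G e)
  tgt e = proj₂ (ends G e)

  graph : Graph (nV G)
  graph = record { arcs = λ u v → ∑ full (λ e → ⟦ ⁅ src e ⁆ u ⟧ * ⟦ ⁅ tgt e ⁆ v ⟧) ; arcs-irr = λ u → ∑-0 full (λ e _ → irr u e) }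
    where
    irr : ∀ u e → ⟦ ⁅ src e ⁆ u ⟧ * ⟦ ⁅ tgt e ⁆ u ⟧ ≡ 0
    irr u e with ≡-or-≢ u (src e)
    ... | inj₂ q = cong (λ x → ⟦ x ⟧ * ⟦ ⁅ tgt e ⁆ u ⟧) (outside (∉-⁅⁆ q))
    ... | inj₁ refl = trans (cong (λ x → ⟦ ⁅ u ⁆ u ⟧ * ⟦ x ⟧) (outside (∉-⁅⁆ (loopless G e)))) (*-zeroʳ ⟦ ⁅ u ⁆ u ⟧)

  inner : VSet (nV G) → VSet (nE G)
  inner S e = S (src e) ∧ S (tgt e)

  ⟦∧⟧ : ∀ x y → ⟦ x ⟧ * ⟦ y ⟧ ≡ ⟦ x ∧ y ⟧
  ⟦∧⟧ true y = *-identityˡ ⟦ y ⟧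
  ⟦∧⟧ false y = refl

  ∑-arcs-out : ∀ S u → ∑ S (arcs graph u) ≡ ∑ full (λ e → ⟦ S (tgt e) ⟧ * ⟦ ⁅ src e ⁆ u ⟧)
  ∑-arcs-out S u = trans (∑-swap S full _) (∑-cong full (λ e _ → trans (∑-* S ⟦ ⁅ src e ⁆ u ⟧ _)
    (trans (cong (⟦ ⁅ src e ⁆ u ⟧ *_) (∑-indicator S (tgt e))) (*-comm ⟦ ⁅ src e ⁆ u ⟧ _))))

  ∑-arcs-in : ∀ S u → ∑ S (λ v → arcs graph v u) ≡ ∑ full (λ e → ⟦ S (src e) ⟧ * ⟦ ⁅ tgt e ⁆ u ⟧)
  ∑-arcs-in S u = trans (∑-swap S full _) (∑-cong full (λ e _ → trans (∑-cong S (λ v _ → *-comm ⟦ ⁅ src e ⁆ v ⟧ _))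
    (trans (∑-* S ⟦ ⁅ tgt e ⁆ u ⟧ _) (trans (cong (⟦ ⁅ tgt e ⁆ u ⟧ *_) (∑-indicator S (src e))) (*-comm ⟦ ⁅ tgt e ⁆ u ⟧ _)))))

  edges-inner : ∀ S → edges graph S ≡ card (inner S)
  edges-inner S = begin
    ∑ S (λ u → ∑ S (arcs graph u))
      ≡⟨ ∑-cong S (λ u _ → ∑-arcs-out S u) ⟩
    ∑ S (λ u → ∑ full (λ e → ⟦ S (tgt e) ⟧ * ⟦ ⁅ src e ⁆ u ⟧))
      ≡⟨ ∑-swap S full _ ⟩
    ∑ full (λ e → ∑ S (λ u → ⟦ S (tgt e) ⟧ * ⟦ ⁅ src e ⁆ u ⟧))
      ≡⟨ ∑-cong full (λ e _ → trans (∑-* S ⟦ S (tgt e) ⟧ _) (trans (cong (⟦ S (tgt e) ⟧ *_) (∑-indicator S (src e)))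
           (trans (*-comm ⟦ S (tgt e) ⟧ _) (⟦∧⟧ (S (src e)) (S (tgt e)))))) ⟩
    ∑ full (λ e → ⟦ inner S e ⟧)
      ≡⟨ ∑-full (inner S) ⟩
    card (inner S) ∎
    where open ≡-Reasoning

  inner-∈ : ∀ {S e u v} → Joins G e u v → u ∈ S → v ∈ S → e ∈ inner S
  inner-∈ {S} (inj₁ eq) (mem p) (mem q) = mem (cong₂ _∧_ (trans (cong (S ∘ proj₁) eq) p) (trans (cong (S ∘ proj₂) eq) q))
  inner-∈ {S} (inj₂ eq) (mem p) (mem q) = mem (cong₂ _∧_ (trans (cong (S ∘ proj₁) eq) q) (trans (cong (S ∘ proj₂) eq) p))

  inner-inv : ∀ {S e} → e ∈ inner S → src e ∈ S × tgt e ∈ S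
  inner-inv {S} {e} (mem p) with S (src e) in eq
  ... | true = mem eq , mem p

  joins-ends : ∀ e → Joins G e (src e) (tgt e)
  joins-ends e = inj₁ refl

  joins-sym : ∀ {e u v} → Joins G e u v → Joins G e v u
  joins-sym (inj₁ p) = inj₂ p
  joins-sym (inj₂ p) = inj₁ p

  incident : Fin (nV G) → VSet (nV G) → VSet (nE G)
  incident v S e = (S (tgt e) ∧ ⁅ src e ⁆ v) ∨ (S (src e) ∧ ⁅ tgt e ⁆ v)

  incident-inv : ∀ {v S e} → e ∈ incident v S → ∃[ u ] u ∈ S × Joins G e v u
  incident-inv {v} {S} {e} p with ∪-inv {S = λ e → S (tgt e) ∧ ⁅ src e ⁆ v} {λ e → S (src e) ∧ ⁅ tgt e ⁆ v} p
  ... | inj₁ q = tgt e , mem (inside (∩-⊆ˡ {S = S ∘ tgt} {λ e → ⁅ src e ⁆ v} e (mem (inside q)))) ,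
    inj₁ (cong (_, tgt e) (sym (⁅⁆-≡ {u = v} (mem (inside (∩-⊆ʳ {S = S ∘ tgt} {λ e → ⁅ src e ⁆ v} e (mem (inside q))))))))
  ... | inj₂ q = src e , mem (inside (∩-⊆ˡ {S = S ∘ src} {λ e → ⁅ tgt e ⁆ v} e (mem (inside q)))) ,
    inj₂ (cong (src e ,_) (sym (⁅⁆-≡ {u = v} (mem (inside (∩-⊆ʳ {S = S ∘ src} {λ e → ⁅ tgt e ⁆ v} e (mem (inside q))))))))

  deg-incident : ∀ v S → deg graph v S ≡ card (incident v S)
  deg-incident v S = begin
    ∑ S (λ u → arcs graph v u + arcs graph u v)
      ≡⟨ trans (∑-+ S _ _) (cong₂ _+_ (∑-arcs-out S v) (∑-arcs-in S v)) ⟩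
    ∑ full (λ e → ⟦ S (tgt e) ⟧ * ⟦ ⁅ src e ⁆ v ⟧) + ∑ full (λ e → ⟦ S (src e) ⟧ * ⟦ ⁅ tgt e ⁆ v ⟧)
      ≡⟨ trans (sym (∑-+ full _ _)) (∑-cong full (λ e _ → trans (cong₂ _+_ (⟦∧⟧ (S (tgt e)) _) (⟦∧⟧ (S (src e)) _)) (disjoint e))) ⟩
    ∑ full (λ e → ⟦ incident v S e ⟧)
      ≡⟨ ∑-full (incident v S) ⟩
    card (incident v S) ∎
    where
    open ≡-Reasoning
    or : ∀ x y → (x ≡ true → y ≡ true → ⊥) → ⟦ x ⟧ + ⟦ y ⟧ ≡ ⟦ x ∨ y ⟧
    or true true ¬both = ⊥-elim (¬both refl refl)
    or true false _ = refl
    or false y _ = refl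
    disjoint : ∀ e → ⟦ S (tgt e) ∧ ⁅ src e ⁆ v ⟧ + ⟦ S (src e) ∧ ⁅ tgt e ⁆ v ⟧ ≡ ⟦ incident v S e ⟧
    disjoint e = or _ _ (λ p q → loopless G e (trans
      (sym (⁅⁆-≡ {u = v} (mem (inside (∩-⊆ʳ {S = S ∘ tgt} {λ e → ⁅ src e ⁆ v} e (mem p))))))
      (⁅⁆-≡ {u = v} (mem (inside (∩-⊆ʳ {S = S ∘ src} {λ e → ⁅ tgt e ⁆ v} e (mem q)))))))

  joins-incident : ∀ {v u S e} → Joins G e v u → u ∈ S → e ∈ incident v S
  joins-incident {v} {u} {S} {e} (inj₁ eq) (mem p) = ∪-⊆ˡ {S = λ e → S (tgt e) ∧ ⁅ src e ⁆ v} {λ e → S (src e) ∧ ⁅ tgt e ⁆ v} e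
    (mem (cong₂ _∧_ (trans (cong (S ∘ proj₂) eq) p) (trans (cong (λ x → ⁅ proj₁ x ⁆ v) eq) (inside (∈-⁅⁆ v)))))
  joins-incident {v} {u} {S} {e} (inj₂ eq) (mem p) = ∪-⊆ʳ {S = λ e → S (tgt e) ∧ ⁅ src e ⁆ v} {λ e → S (src e) ∧ ⁅ tgt e ⁆ v} e
    (mem (cong₂ _∧_ (trans (cong (S ∘ proj₁) eq) p) (trans (cong (λ x → ⁅ proj₂ x ⁆ v) eq) (inside (∈-⁅⁆ v)))))

  joins-deg : ∀ {v u S e} → Joins G e v u → u ∈ S → 1 ≤ deg graph v S
  joins-deg {v} {S = S} {e} j u∈S = subst (1 ≤_) (sym (deg-incident v S)) (∑-∈ (joins-incident {e = e} j u∈S) (λ _ → 1))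

  deg-joins : ∀ {v S} → 1 ≤ deg graph v S → ∃[ e ] ∃[ u ] u ∈ S × Joins G e v u
  deg-joins {v} {S} r = let e , e∈ = card-∈ (incident v S) (subst (1 ≤_) (deg-incident v S) r) in e , incident-inv e∈

  unweighted : Weight (nV G)
  unweighted _ = 0

  module _ {D : ℕ} {c : VSet (nV G)} (ok : Ok (suc D) graph unweighted full c) where

    private
      Class : Bool → Fin (nV G) → Set
      Class x v = c v ≡ x

    -- The vertex set of a cycle spans at least as many edges as it has vertices, one more than
    -- `forest` allows.
    no-cycle : ∀ x → ForestIn G (Class x)
    no-cycle x cycle = <-irrefl refl (≤-trans many (≤-trans (forest ok x S ⊆-full mono) (pred-mono-≤ (card-image vs))))
      where
      open CycleIn cycle
      S = image vs
      mono-at : ∀ i → c (vs i) ≡ x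
      mono-at fzero = proj₁ (proj₂ (step fzero))
      mono-at (fsuc i) = proj₂ (proj₂ (step i))
      mono : Mono c x S
      mono u p = let i , eq = image-inv vs p in subst (Class x) eq (mono-at i)
      inside-S : ∀ j → es j ∈ inner S
      inside-S j with view j
      ... | ‵fromℕ = inner-∈ (proj₁ close) (image-∈ vs _) (image-∈ vs _)
      ... | ‵inject₁ i = inner-∈ (proj₁ (step i)) (image-∈ vs _) (image-∈ vs _)
      many : suc (suc k) ≤ edges graph S
      many = subst (suc (suc k) ≤_) (sym (edges-inner S)) (card-injective es es-inj inside-S)

    -- Connectedness enters only through the edge count that `small` asks for; `X` is grown along
    -- walks from `u`.
    record Connected (u : Fin (nV G)) : Set where
      field
        X : VSet (nV G)
        X-mono : Mono c true X
        u∈X : u ∈ X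
        connected : card X ≤ suc (edges graph X)

    private
      Grown : ∀ {u} → Connected u → (VSet (nV G) → Set) → Set
      Grown {u} C Z = Σ[ C′ ∈ Connected u ] Connected.X C ⊆ Connected.X C′ × Z (Connected.X C′)

    extend-along : ∀ {u w v e} (C : Connected u) → w ∈ Connected.X C → Joins G e w v → c v ≡ true → Grown C (v ∈_)
    extend-along {u} {w} {v} C w∈X j cv with ∈-or-∉ (Connected.X C) v
    ... | inj₁ v∈X = C , ⊆-refl , v∈X
    ... | inj₂ v∉X = record
      { X = X ⊹ v
      ; X-mono = mono
      ; u∈X = ⊹-⊇ u u∈X
      ; connected = subst₂ (λ x y → x ≤ suc y) (sym (card-⊹ v∉X)) (sym (edges-⊹ graph v∉X))
          (s≤s (≤-trans connected (≤-trans (≤-reflexive (+-comm 1 _)) (+-monoʳ-≤ (edges graph X) (joins-deg (joins-sym j) w∈X))))) }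
      , ⊹-⊇ , ⊹-∈ X v
      where
      open Connected C
      mono : Mono c true (X ⊹ v)
      mono y p with ⊹-inv p
      ... | inj₁ q = X-mono y q
      ... | inj₂ refl = cv

    extend-reach : ∀ {u a} (C : Connected u) → Reach G (Class true) u a → Grown C (a ∈_)
    extend-reach C (here _) = C , ⊆-refl , Connected.u∈X C
    extend-reach C (there r (j , _ , cv)) =
      let C₁ , sub₁ , w∈ = extend-reach C r
          C₂ , sub₂ , v∈ = extend-along C₁ w∈ j cv
      in C₂ , ⊆-trans sub₁ sub₂ , v∈

    extend-edges : ∀ {u} j (f : Fin j → Fin (nE G)) → (∀ i → EdgeInComp G (Class true) u (f i)) → (C : Connected u) →
                   Grown C (λ X → ∀ i → f i ∈ inner X)
    extend-edges zero f _ C = C , ⊆-refl , λ ()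
    extend-edges (suc j) f comp C =
      let a , d , (joins , _ , cd) , r = comp fzero
          C₁ , sub₁ , a∈ = extend-reach C r
          C₂ , sub₂ , d∈ = extend-along C₁ a∈ joins cd
          C₃ , sub₃ , rest = extend-edges j (f ∘ fsuc) (comp ∘ fsuc) C₂
      in C₃ , ⊆-trans sub₁ (⊆-trans sub₂ sub₃) ,
         λ { fzero → inner-∈ joins (sub₃ a (sub₂ a a∈)) (sub₃ d d∈) ; (fsuc i) → rest i }

    -- All the given edges fit into one connected set grown from `u`, which has at most `suc D`
    -- vertices and fewer edges than vertices.
    small-components : ComponentsAtMost D G (Class true)
    small-components u cu j f inj comp =
      let C , _ , inside-X = extend-edges j f comp start
          open Connected C
      in ≤-trans (card-injective f inj inside-X) (≤-trans (≤-reflexive (sym (edges-inner X)))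
           (≤-trans (forest ok true X ⊆-full X-mono) (pred-mono-≤ (small ok X ⊆-full X-mono connected))))
      where
      start : Connected u
      start = record
        { X = ⁅ u ⁆ ; X-mono = λ y p → subst (Class true) (sym (⁅⁆-≡ p)) cu ; u∈X = ∈-⁅⁆ u
        ; connected = ≤-trans (≤-reflexive (∑-⁅⁆ u _)) (s≤s z≤n) }

    coloring : Coloring D G
    coloring = c , no-cycle true , small-components , no-cycle false

  -- A path v₀, …, v_k in S, of which only the first k + 1 values are relevant.
  record Path (S : VSet (nV G)) (k : ℕ) : Set where
    field
      vs : ℕ → Fin (nV G)
      es : ℕ → Fin (nE G)
      vs-∈ : ∀ {i} → i ≤ k → vs i ∈ S
      vs-inj : ∀ {i j} → i ≤ k → j ≤ k → vs i ≡ vs j → i ≡ j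
      step : ∀ {i} → i < k → Joins G (es i) (vs i) (vs (suc i))

  joins-unique : ∀ {e u v x y} → Joins G e u v → Joins G e x y → (u ≡ x × v ≡ y) ⊎ (u ≡ y × v ≡ x)
  joins-unique (inj₁ p) (inj₁ q) = inj₁ (,-injective (trans (sym p) q))
  joins-unique (inj₁ p) (inj₂ q) = inj₂ (,-injective (trans (sym p) q))
  joins-unique (inj₂ p) (inj₁ q) = inj₂ (Product.swap (,-injective (trans (sym p) q)))
  joins-unique (inj₂ p) (inj₂ q) = inj₁ (Product.swap (,-injective (trans (sym p) q)))

  joins-≢ : ∀ {e u v} → Joins G e u v → u ≢ v
  joins-≢ {e} (inj₁ p) refl = loopless G e (trans (cong proj₁ p) (sym (cong proj₂ p)))
  joins-≢ {e} (inj₂ p) refl = loopless G e (trans (cong proj₁ p) (sym (cong proj₂ p)))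

  -- A path is extended at its front by an edge other than its first one; since the vertices run
  -- out, some extension returns to the path and closes a cycle.
  module Cycles {S : VSet (nV G)} (Z : Fin (nV G) → Set) (S⊆Z : ∀ u → u ∈ S → Z u) (2≤deg : ∀ u → u ∈ S → 2 ≤ deg graph u S) where

    module _ {k : ℕ} (path : Path S k) {e : Fin (nE G)} {v : Fin (nV G)} (joins : Joins G e v (Path.vs path 0))
             (fresh : 0 < k → e ≢ Path.es path 0) where
      open Path path

      vs⁺ : ℕ → Fin (nV G)
      vs⁺ zero = v
      vs⁺ (suc i) = vs i

      es⁺ : ℕ → Fin (nE G)
      es⁺ zero = e
      es⁺ (suc i) = es i

      step⁺ : ∀ {i} → i ≤ k → Joins G (es⁺ i) (vs⁺ i) (vs⁺ (suc i))
      step⁺ {zero} _ = joins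
      step⁺ {suc i} r = step r

      es-inj : ∀ {i j} → i < k → j < k → es i ≡ es j → i ≡ j
      es-inj {i} {j} p q eq with joins-unique (step p) (subst (λ x → Joins G x (vs j) (vs (suc j))) (sym eq) (step q))
      ... | inj₁ (r , _) = vs-inj (<⇒≤ p) (<⇒≤ q) r
      ... | inj₂ (r , t) = ⊥-elim (<-irrefl (trans (vs-inj (<⇒≤ p) q r) (cong suc (sym (vs-inj p (<⇒≤ q) t)))) (n<1+n-twice i))
        where
        n<1+n-twice : ∀ i → i < suc (suc i)
        n<1+n-twice i = s≤s (n≤1+n i)

      e≢es : ∀ {j} → j < k → e ≢ es j
      e≢es {zero} r = fresh r
      e≢es {suc j} r eq with joins-unique joins (subst (λ x → Joins G x (vs (suc j)) (vs (suc (suc j)))) (sym eq) (step r))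
      ... | inj₁ (_ , t) = contradiction (vs-inj z≤n r t) λ ()
      ... | inj₂ (_ , t) = contradiction (vs-inj z≤n (<⇒≤ r) t) λ ()

      es⁺-inj : ∀ {i j} → i ≤ k → j ≤ k → es⁺ i ≡ es⁺ j → i ≡ j
      es⁺-inj {zero} {zero} _ _ _ = refl
      es⁺-inj {zero} {suc j} _ q eq = ⊥-elim (e≢es q eq)
      es⁺-inj {suc i} {zero} p _ eq = ⊥-elim (e≢es p (sym eq))
      es⁺-inj {suc i} {suc j} p q eq = cong suc (es-inj p q eq)

      close-up : ∀ l → suc l ≤ k → v ≡ vs (suc l) → CycleIn G Z
      close-up l l<k refl = record
        { k = l
        ; vs = λ i → vs⁺ (toℕ i)
        ; es = λ i → es⁺ (toℕ i)
        ; vs-inj = λ {i} {j} eq → toℕ-injective (vs⁺-inj (s≤s⁻¹ (toℕ<n i)) (s≤s⁻¹ (toℕ<n j)) eq)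
        ; es-inj = λ {i} {j} eq → toℕ-injective (es⁺-inj (≤-trans (s≤s⁻¹ (toℕ<n i)) l<k) (≤-trans (s≤s⁻¹ (toℕ<n j)) l<k) eq)
        ; step = λ i → subst (λ x → JoinsIn G Z (es⁺ x) (vs⁺ x) (vs⁺ (suc (toℕ i)))) (sym (toℕ-inject₁ i))
            (step⁺ (≤-trans (<⇒≤ (toℕ<n i)) l<k) , in-Z (<⇒≤ (toℕ<n i)) , in-Z (toℕ<n i))
        ; close = subst (λ x → JoinsIn G Z (es⁺ x) (vs⁺ x) (vs (suc l))) (sym (toℕ-fromℕ (suc l)))
            (step⁺ l<k , in-Z ≤-refl , in-Z {0} z≤n) }
        where
        in-S : ∀ {i} → i ≤ suc l → vs⁺ i ∈ S
        in-S {zero} _ = vs-∈ l<k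
        in-S {suc i} r = vs-∈ (≤-trans (≤-trans (n≤1+n i) r) l<k)
        in-Z : ∀ {i} → i ≤ suc l → Z (vs⁺ i)
        in-Z r = S⊆Z _ (in-S r)
        vs⁺-inj : ∀ {i j} → i ≤ suc l → j ≤ suc l → vs⁺ i ≡ vs⁺ j → i ≡ j
        vs⁺-inj {zero} {zero} _ _ _ = refl
        vs⁺-inj {zero} {suc j} _ q eq = ⊥-elim (<-irrefl (vs-inj (≤-trans (≤-trans (n≤1+n j) q) l<k) l<k (sym eq)) q)
        vs⁺-inj {suc i} {zero} p _ eq = ⊥-elim (<-irrefl (vs-inj (≤-trans (≤-trans (n≤1+n i) p) l<k) l<k eq) p)
        vs⁺-inj {suc i} {suc j} p q eq = cong suc (vs-inj (≤-trans (<⇒≤ p) l<k) (≤-trans (<⇒≤ q) l<k) eq)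

      longer : v ∈ S → (∀ i → i ≤ k → v ≢ vs i) → Path S (suc k)
      longer v∈S new = record
        { vs = vs⁺ ; es = es⁺ ; vs-∈ = in-S ; vs-inj = inj ; step = λ r → step⁺ (s≤s⁻¹ r) }
        where
        in-S : ∀ {i} → i ≤ suc k → vs⁺ i ∈ S
        in-S {zero} _ = v∈S
        in-S {suc i} r = vs-∈ (s≤s⁻¹ r)
        inj : ∀ {i j} → i ≤ suc k → j ≤ suc k → vs⁺ i ≡ vs⁺ j → i ≡ j
        inj {zero} {zero} _ _ _ = refl
        inj {zero} {suc j} _ q eq = ⊥-elim (new j (s≤s⁻¹ q) eq)
        inj {suc i} {zero} p _ eq = ⊥-elim (new i (s≤s⁻¹ p) (sym eq))
        inj {suc i} {suc j} p q eq = cong suc (vs-inj (s≤s⁻¹ p) (s≤s⁻¹ q) eq)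

    other-edge : ∀ {u} (f : Fin (nE G)) → u ∈ S → ∃[ e ] e ≢ f × ∃[ v ] v ∈ S × Joins G e u v
    other-edge {u} f u∈S =
      let e , e∈ = card-∈ (incident u S − f) (s≤s⁻¹ (≤-trans (subst (2 ≤_) (deg-incident u S) (2≤deg u u∈S)) bound))
      in e , −-≢ e∈ , incident-inv (−-⊆ e e∈)
      where
      bound : card (incident u S) ≤ suc (card (incident u S − f))
      bound with ∈-or-∉ (incident u S) f
      ... | inj₁ f∈ = ≤-reflexive (card-− f∈)
      ... | inj₂ f∉ = ≤-trans (∑-⊆ _ (⊆-− ⊆-refl f∉)) (n≤1+n _)

    find : ∀ fuel k → nV G ≤ k + fuel → Path S k → CycleIn G Z
    find zero k bound path = ⊥-elim (<-irrefl refl (≤-trans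
      (injective⇒≤ {f = λ (i : Fin (suc k)) → vs (toℕ i)} (λ {i} {j} eq → toℕ-injective (vs-inj (s≤s⁻¹ (toℕ<n i)) (s≤s⁻¹ (toℕ<n j)) eq)))
      (subst (nV G ≤_) (+-identityʳ k) bound)))
      where open Path path
    -- For `k` equal to 0 the path has no edge and `es 0` is a placeholder; avoiding it costs
    -- nothing, as every vertex of `S` has two edges.
    find (suc fuel) k bound path = go (other-edge (es 0) (vs-∈ z≤n))
      where
      open Path path
      go : (∃[ e ] e ≢ es 0 × ∃[ v ] v ∈ S × Joins G e (vs 0) v) → CycleIn G Z
      go (e , e≢ , v , v∈S , joins) with any? (λ (i : Fin (suc k)) → v ≟ vs (toℕ i))
      ... | no new = find fuel (suc k) (subst (nV G ≤_) (+-suc k fuel) bound)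
              (longer path (joins-sym joins) (λ _ → e≢) v∈S (λ i i≤k eq → new (fromℕ< (s≤s i≤k) , trans eq (cong vs (sym (toℕ-fromℕ< (s≤s i≤k)))))))
      ... | yes (fzero , eq) = ⊥-elim (joins-≢ joins (sym eq))
      ... | yes (fsuc i , eq) = close-up path (joins-sym joins) (λ _ → e≢) (toℕ i) (toℕ<n i) eq

    cycle : ∀ {u} → u ∈ S → CycleIn G Z
    cycle {u} u∈S = find (nV G) 0 ≤-refl (record
      { vs = λ _ → u ; es = λ _ → proj₁ (deg-joins {u} {S} (≤-trans (s≤s z≤n) (2≤deg u u∈S))) ; vs-∈ = λ _ → u∈S
      ; vs-inj = λ { z≤n z≤n _ → refl } ; step = λ () })

  -- A vertex with at most one edge is peeled off; if there is none, all degrees are at least 2 and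
  -- a cycle exists.
  forest-bound : ∀ {Z : Fin (nV G) → Set} → ForestIn G Z → ∀ k S → card S ≡ k → (∀ u → u ∈ S → Z u) → edges graph S ≤ pred (card S)
  forest-bound ¬cycle zero S eq _ = ≤-trans (≤-reflexive (edges-card-0 graph eq)) z≤n
  forest-bound {Z} ¬cycle (suc k) S eq S⊆Z with any? (λ u → (S u Bool.≟ true) ×-dec (deg graph u S ≤? 1))
  ... | yes (u , u∈S , d≤1) = insert-bound graph (mem u∈S)
    (subst (edges graph (S − u) + deg graph u (S − u) ≤_) (+-comm _ 1) (+-monoʳ-≤ (edges graph (S − u)) (≤-trans (∑-⊆ _ −-⊆) d≤1)))
    (forest-bound ¬cycle k (S − u) (suc-injective (trans (sym (card-− (mem u∈S))) eq)) (λ v p → S⊆Z v (−-⊆ v p)))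
  ... | no none = ⊥-elim (¬cycle (Cycles.cycle Z S⊆Z (λ u u∈S → ≰⇒> (λ d≤1 → none (u , inside u∈S , d≤1)))
    (proj₂ (card-∈ S (≤-trans (s≤s z≤n) (≤-reflexive (sym eq)))))))

  module _ {Z : Fin (nV G) → Set} {S : VSet (nV G)} (¬cycle : ForestIn G Z) (S⊆Z : ∀ u → u ∈ S → Z u)
           (tree : card S ≤ suc (edges graph S)) {u : Fin (nV G)} (u∈S : u ∈ S) where

    -- A set `R` of reached vertices that cannot grow has no edge to the rest of `S`; were the rest
    -- nonempty, two forests would have too few edges for `tree`.
    reach-fuel : ∀ fuel R → card S ≤ card R + fuel → R ⊆ S → u ∈ R → (∀ v → v ∈ R → Reach G Z u v) → ∀ v → v ∈ S → Reach G Z u v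
    reach-fuel fuel R bound R⊆S u∈R reach v v∈S with any? (λ y → ((S ∖ R) y Bool.≟ true) ×-dec (1 ≤? deg graph y R))
    reach-fuel zero R bound R⊆S u∈R reach v v∈S | yes (y , y∈ , _) =
      ⊥-elim (<-irrefl refl (≤-trans (≤-reflexive (+-comm 1 (card R)))
        (≤-trans (∑-∉ R⊆S (∖-⊆ y y∈S∖R) (∖-∉ {S = S} y∈S∖R) (λ _ → 1)) (subst (card S ≤_) (+-identityʳ (card R)) bound))))
      where
      y∈S∖R : y ∈ S ∖ R
      y∈S∖R = mem y∈
    reach-fuel (suc fuel) R bound R⊆S u∈R reach v v∈S | yes (y , y∈ , adj) =
      reach-fuel fuel (R ⊹ y) (≤-trans bound (≤-reflexive (trans (+-suc (card R) fuel) (cong (_+ fuel) (sym (card-⊹ y∉R))))))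
        (⊹-⊆ R⊆S y∈S) (⊹-⊇ u u∈R) reach′ v v∈S
      where
      y∈S∖R : y ∈ S ∖ R
      y∈S∖R = mem y∈
      y∈S : y ∈ S
      y∈S = ∖-⊆ y y∈S∖R
      y∉R : y ∉ R
      y∉R = ∖-∉ {S = S} y∈S∖R
      reach′ : ∀ x → x ∈ R ⊹ y → Reach G Z u x
      reach′ x p with ⊹-inv p
      ... | inj₁ q = reach x q
      ... | inj₂ refl = let e , t , t∈R , joins = deg-joins {x} {R} adj in
        there (reach t t∈R) (joins-sym joins , S⊆Z t (R⊆S t t∈R) , S⊆Z x y∈S)
    reach-fuel fuel R bound R⊆S u∈R reach v v∈S | no none with ∈-or-∉ R v
    ... | inj₁ v∈R = reach v v∈R
    ... | inj₂ v∉R = ⊥-elim (arith (card R) (card R′) (edges graph R) (edges graph R′)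
        (subst₂ (λ x y → x ≤ suc y) (∑-part (part-⊆ R⊆S) _) (trans (edges-part graph (part-⊆ R⊆S))
          (trans (cong (edges graph R + edges graph R′ +_) (∑-0 R′ no-cross)) (+-identityʳ _))) tree)
        (forest-bound ¬cycle (card R) R refl (λ x p → S⊆Z x (R⊆S x p)))
        (forest-bound ¬cycle (card R′) R′ refl (λ x p → S⊆Z x (∖-⊆ x p)))
        (≤-trans (s≤s z≤n) (≤-reflexive (sym (card-− u∈R)))) (≤-trans (s≤s z≤n) (≤-reflexive (sym (card-− (∖-∈ v∈S v∉R))))))
      where
      R′ = S ∖ R
      no-cross : ∀ y → y ∈ R′ → deg graph y R ≡ 0
      no-cross y y∈ = n≤0⇒n≡0 (s≤s⁻¹ (≰⇒> (λ r → none (y , inside y∈ , r))))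
      arith : ∀ r r′ e e′ → r + r′ ≤ suc (e + e′) → e ≤ pred r → e′ ≤ pred r′ → 1 ≤ r → 1 ≤ r′ → ⊥
      arith (suc r) (suc r′) e e′ h₁ h₂ h₃ _ _ = two-trees r r′ e e′ h₁ h₂ h₃

    reachable : ∀ v → v ∈ S → Reach G Z u v
    reachable = reach-fuel (card S) ⁅ u ⁆ (m≤n+m (card S) _) (λ x p → subst (_∈ S) (sym (⁅⁆-≡ p)) u∈S) (∈-⁅⁆ u)
      (λ x p → subst (Reach G Z u) (sym (⁅⁆-≡ p)) (here (S⊆Z u u∈S)))

  fromColoring : ∀ {D} → Coloring D G → Colorable (suc D) graph unweighted full
  fromColoring {D} (c , forest-M , small-M , forest-F) = c , record
    { forest = λ { true S _ m → forest-bound forest-M (card S) S refl m ; false S _ m → forest-bound forest-F (card S) S refl m }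
    ; small = small′ }
    where
    small′ : ∀ S → S ⊆ full → Mono c true S → card S ≤ suc (edges graph S) → card S ≤ suc D
    small′ S _ m tree with 1 ≤? card S
    ... | no r = ≤-trans (s≤s⁻¹ (≰⇒> r)) z≤n
    -- All edges inside `S` belong to the component of `u`, so there are at most `D` of them, and a
    -- tree has one vertex more than edges.
    ... | yes r = ≤-trans tree (s≤s (≤-trans (≤-reflexive (edges-inner S))
        (small-M u (m u u∈S) (card (inner S)) at at-injective comp)))
      where
      u = proj₁ (card-∈ S r)
      u∈S = proj₂ (card-∈ S r)
      open Enumeration (enumerate (inner S) (card (inner S)) refl)
      comp : ∀ i → EdgeInComp G (λ v → c v ≡ true) u (at i)
      comp i = let p , q = inner-inv (at-∈ i) in
        src (at i) , tgt (at i) , (joins-ends (at i) , m _ p , m _ q) , reachable forest-M m tree u∈S (src (at i)) p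

-- Induced submultigraphs

module Induced (G : Multigraph) (T : VSet (nV G)) where
  open FromMultigraph G

  V = enumerate T (card T) refl
  E = enumerate (inner T) (card (inner T)) refl
  module V = Enumeration V
  module E = Enumeration E

  locate : ∀ v → v ∈ T → Fin (card T)
  locate v p = proj₁ (V.index v p)

  H-ends : Fin (card (inner T)) → Fin (card T) × Fin (card T)
  H-ends e = locate (src (E.at e)) (proj₁ (inner-inv (E.at-∈ e))) , locate (tgt (E.at e)) (proj₂ (inner-inv (E.at-∈ e)))

  at-src : ∀ e → V.at (proj₁ (H-ends e)) ≡ src (E.at e)
  at-src e = proj₂ (V.index _ _)

  at-tgt : ∀ e → V.at (proj₂ (H-ends e)) ≡ tgt (E.at e)
  at-tgt e = proj₂ (V.index _ _)

  H : Multigraph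
  H = record
    { nV = card T ; nE = card (inner T) ; ends = H-ends
    ; loopless = λ e eq → loopless G (E.at e) (trans (sym (at-src e)) (trans (cong V.at eq) (at-tgt e))) }

  subgraph : Subgraph H G
  subgraph = record
    { φ = V.at ; ψ = E.at ; φ-inj = V.at-injective ; ψ-inj = E.at-injective
    ; compat = λ e → inj₁ (cong₂ _,_ (sym (at-src e)) (sym (at-tgt e))) }

  module H = FromMultigraph H

  card-H : ∀ {S} → S ⊆ T → card S ≡ card (S ∘ V.at)
  card-H {S} S⊆T = trans (∑-restrict S⊆T _) (trans (V.reindex _) (sym (∑-restrict ⊆-full _)))

  edges-H : ∀ {S} → S ⊆ T → edges graph S ≡ edges H.graph (S ∘ V.at)
  edges-H {S} S⊆T = begin
    edges graph S                              ≡⟨ edges-inner S ⟩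
    card (inner S)                             ≡⟨ trans (∑-restrict inner-mono _) (E.reindex _) ⟩
    ∑ full (λ e → ⟦ inner S (E.at e) ⟧ * 1)    ≡⟨ ∑-cong full (λ e _ → trans (*-identityʳ _) (cong ⟦_⟧ (sym (same e)))) ⟩
    ∑ full (λ e → ⟦ H.inner (S ∘ V.at) e ⟧)    ≡⟨ ∑-full (H.inner (S ∘ V.at)) ⟩
    card (H.inner (S ∘ V.at))                  ≡⟨ H.edges-inner (S ∘ V.at) ⟨
    edges H.graph (S ∘ V.at) ∎
    where
    open ≡-Reasoning
    inner-mono : inner S ⊆ inner T
    inner-mono e p = let q , r = inner-inv {S} {e} p in inner-∈ {T} (joins-ends e) (S⊆T _ q) (S⊆T _ r)
    same : ∀ e → H.inner (S ∘ V.at) e ≡ inner S (E.at e)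
    same e = cong₂ _∧_ (cong S (at-src e)) (cong S (at-tgt e))

  color-induced : ∀ {D} → Coloring D H → Colorable (suc D) graph unweighted T
  color-induced {D} col = c , record
    { forest = λ x S S⊆T m → subst₂ (λ e k → e ≤ pred k) (sym (edges-H S⊆T)) (sym (card-H S⊆T))
        (forest ok x (S ∘ V.at) ⊆-full (mono S⊆T m))
    ; small = λ S S⊆T m tree → subst (_≤ suc D) (sym (card-H S⊆T))
        (small ok (S ∘ V.at) ⊆-full (mono S⊆T m) (subst₂ (λ k e → k ≤ suc e) (card-H S⊆T) (edges-H S⊆T) tree)) }
    where
    c′ = proj₁ (H.fromColoring col)
    ok = proj₂ (H.fromColoring col)
    c : VSet (nV G)
    -- Vertices outside `T` fall into `F` by default; nothing is claimed about them.
    c v = does (any? (λ i → (V.at i ≟ v) ×-dec (c′ i Bool.≟ true)))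
    c-at : ∀ i → c (V.at i) ≡ c′ i
    c-at i with any? (λ j → (V.at j ≟ V.at i) ×-dec (c′ j Bool.≟ true))
    ... | yes (j , eq , p) = sym (subst (λ y → c′ y ≡ true) (V.at-injective eq) p)
    ... | no none with c′ i in eq
    ...   | false = refl
    ...   | true = ⊥-elim (none (i , refl , eq))
    mono : ∀ {x S} → S ⊆ T → Mono c x S → Mono c′ x (S ∘ V.at)
    mono S⊆T m i (mem p) = trans (sym (c-at i)) (m (V.at i) (mem p))

-- The edge bound for critical multigraphs

module DensityBound (Π : Potential) where
  open WithPotential Π
  open Minimality Π

  -- The low set `U` consists of all vertices, since any other set lies in a vertex-deleted
  -- subgraph, which criticality makes colourable. With all weights 0, low potential of the whole
  -- vertex set is the claimed inequality.
  critical-bound : (∀ n N → Extremal n N) → ∀ {D} → suc D ≡ K → (G : Multigraph) → Critical D G →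
                   (2 * b ∸ 1) * nV G + 2 ≤ b * nE G
  critical-bound extremal {D} refl G (¬coloring , proper) =
    conclude (extremal (nV G) (suc (nV G)) (s≤s (≤-reflexive card-full)) (λ (_ , ok) → ¬coloring (coloring ok)))
    where
    open FromMultigraph G
    conclude : (∃[ U ] U ⊆ full × ¬ Colorable K graph unweighted U × P unweighted U + 2 ≤ Q graph U) →
               (2 * b ∸ 1) * nV G + 2 ≤ b * nE G
    conclude (U , _ , ¬col , low) with ⊆-or-∃ full U
    ... | inj₁ full⊆U = subst₂ (λ x y → x + 2 ≤ b * y)
      (trans (P-≗ unweighted ⊆-full full⊆U) (trans (∑-cong full (λ _ _ → trans (cong (λ x → 2 * b ∸ suc x) cost-0) (sym (*-identityʳ _))))
        (trans (∑-* full (2 * b ∸ 1) (λ _ → 1)) (cong ((2 * b ∸ 1) *_) card-full))))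
      (trans (edges-≗ graph ⊆-full full⊆U) (trans (edges-inner full) (trans (∑-≗ _ ⊆-full (λ _ _ → mem refl)) card-full))) low
    ... | inj₂ (u , _ , u∉U) = ⊥-elim (¬col (Colorable-⊆ K (⊆-− ⊆-full u∉U) (color-induced (proper H (subgraph , inj₁ fewer)))))
      where
      open Induced G (full − u)
      fewer : card (full − u) < nV G
      fewer = ≤-reflexive (trans (sym (card-− (mem refl))) card-full)

theorem1p6 : (∀ (t : ℕ) (G : Multigraph) → Critical (1 + 2 * t) G → 3 ≤ nV G →
    (4 * (1 + 2 * t) + 3) * nV G + 2 ≤ 2 * ((1 + 2 * t) + 1) * nE G)
    ×
    (∀ (t : ℕ) (G : Multigraph) → Critical (2 + 2 * t) G → 3 ≤ nV G →
    (4 * (2 + 2 * t) + 1) * nV G + 2 ≤ (2 * (2 + 2 * t) + 1) * nE G)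
theorem1p6 = odd , even
  where
  odd : ∀ (t : ℕ) (G : Multigraph) → Critical (1 + 2 * t) G → 3 ≤ nV G →
        (4 * (1 + 2 * t) + 3) * nV G + 2 ≤ 2 * ((1 + 2 * t) + 1) * nE G
  odd t G crit _ = subst₂ (λ x y → x * nV G + 2 ≤ y * nE G) (worth≡ t) (b≡ t)
    (DensityBound.critical-bound (Odd.potential t) (OddMain.theorem t) (+-comm 2 (2 * t)) G crit)
    where
    worth≡ : ∀ t → 2 * (4 * t + 4) ∸ 1 ≡ 4 * (1 + 2 * t) + 3
    worth≡ t = trans (cong (_∸ 1) (eq t)) (m+n∸n≡m (4 * (1 + 2 * t) + 3) 1)
      where
      eq : ∀ t → 2 * (4 * t + 4) ≡ 4 * (1 + 2 * t) + 3 + 1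
      eq = solve-∀
    b≡ : ∀ t → 4 * t + 4 ≡ 2 * ((1 + 2 * t) + 1)
    b≡ = solve-∀
  even : ∀ (t : ℕ) (G : Multigraph) → Critical (2 + 2 * t) G → 3 ≤ nV G →
         (4 * (2 + 2 * t) + 1) * nV G + 2 ≤ (2 * (2 + 2 * t) + 1) * nE G
  even t G crit _ = subst₂ (λ x y → x * nV G + 2 ≤ y * nE G) (worth≡ t) (b≡ t)
    (DensityBound.critical-bound (Even.potential t) (Even.theorem t) (K≡ t) G crit)
    where
    worth≡ : ∀ t → 2 * (4 * suc t + 1) ∸ 1 ≡ 4 * (2 + 2 * t) + 1
    worth≡ t = trans (cong (_∸ 1) (eq t)) (m+n∸n≡m (4 * (2 + 2 * t) + 1) 1)
      where
      eq : ∀ t → 2 * (4 * suc t + 1) ≡ 4 * (2 + 2 * t) + 1 + 1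
      eq = solve-∀
    b≡ : ∀ t → 4 * suc t + 1 ≡ 2 * (2 + 2 * t) + 1
    b≡ = solve-∀
    K≡ : ∀ t → suc (2 + 2 * t) ≡ 2 * suc t + 1
    K≡ = solve-∀
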